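{- Let $m,r\ge 2$ be integers. Let $F$ be an $r$-graph that either has at most $m$ vertices, or has exactly $m+1$ vertices one of which has degree $1$. If $\pi_\lambda(F)<\frac{[m]_r}{m^r}$, then $\mathcal{K}^F_{m+1}$ is $m$-stable.
   Context: An $r$-graph is a finite $r$-uniform hypergraph; $|G|$ denotes the number of edges and $n(G)$ the number of vertices of $G$. $F\subseteq G$ means $G$ contains a (not necessarily induced) copy of $F$ as a subgraph; $G$ is $F$-free if $F\not\subseteq G$, and is free of a family if it contains no member of the family. The degree of a vertex is the number of edges containing it. $[m]_r=m(m-1)\cdots(m-r+1)$ is the falling factorial. A pair of vertices is covered in a hypergraph if some edge contains both vertices. For an $r$-graph $F$ and an integer $p\ge n(F)$, $\mathcal{K}^F_p$ is the family of all $r$-graphs $H$ that contain a set $C$ of $p$ vertices (called the core) such that the subgraph $H[C]$ induced by $C$ contains a copy of $F$ and every pair of vertices in $C$ is covered in $H$. For an $r$-graph $G$ on $[t]=\{1,\dots,t\}$, let $p_G(x_1,\dots,x_t)=r!\sum_{e\in E(G)}\prod_{i\in e}x_i$. The Lagrangian of $G$ is $\lambda(G)=\max\{p_G(x): x_i\ge 0\ \forall i,\ \sum_i x_i=1\}$. The Lagrangian density of an $r$-graph $F$ is $\pi_\lambda(F)=\sup\{\lambda(G): G \text{ an } r\text{ -graph with } F\not\subseteq G\}$. An $r$-graph is $m$-partite if its vertex set can be partitioned into $m$ parts (possibly empty) such that every edge contains at most one vertex of each part. For integers $m,r\ge2$ and an $r$-graph $F$ on at most $m+1$ vertices with $\pi_\lambda(F)\le\frac{[m]_r}{m^r}$,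 the family $\mathcal{K}^F_{m+1}$ is called $m$-stable if for every real $\varepsilon>0$ there are a real $\delta_1>0$ and an integer $n_1$ such that every $\mathcal{K}^F_{m+1}$-free $r$-graph $G$ with $n\ge n_1$ vertices and more than $\left(\frac{[m]_r}{m^r}-\delta_1\right)\binom{n}{r}$ edges can be made $m$-partite by deleting at most $\varepsilon n$ vertices. -}

module Defs where

open import Data.Bool.Base using (Bool; T)
open import Data.Fin.Base using (Fin; zero; suc)
open import Data.Fin.Subset
  using (Subset; inside; outside; _∈_; ∣_∣; ⊥; ⁅_⁆; _∪_; ∁)
open import Data.Fin.Subset.Properties using (_∈?_)
open import Data.Integer.Base using (+_)
open import Data.List.Base
  using (List; []; _∷_; _++_; map; foldr; filter; filterᵇ; length; allFin)
import Data.Nat.Base as ℕ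
open ℕ using (ℕ; suc; NonTrivial; nonTrivial⇒nonZero; _⊔_; _!)
open import Data.Nat.Combinatorics using (_P_; _C_)
import Data.Nat.Properties as ℕ
open import Data.Product.Base using (Σ-syntax; ∃-syntax; _×_; _,_)
open import Data.Rational.Base as ℚ using (ℚ; 0ℚ; 1ℚ; ½; _/_; 1/_)
import Data.Rational.Properties as ℚ
open import Data.Rational.Solver using (module +-*-Solver)
open import Data.Vec.Base using ([]; _∷_)
open import Function.Base using (_∘_)
open import Function.Definitions using (Injective)
open import Relation.Binary.PropositionalEquality
  using (_≡_; _≢_; refl; sym; trans; cong; subst)
open import Relation.Nullary.Negation.Core using (¬_)

------------------------------------------------------------------------
-- Real numbers: Cauchy sequences of rationals carrying a modulus of
-- convergence, compared up to _≈ᴿ_.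

record ℝ : Set where
  field
    seq    : ℕ → ℚ
    cauchy : ∀ ε → 0ℚ ℚ.< ε →
             ∃[ N ] (∀ i j → N ℕ.≤ i → N ℕ.≤ j →
                     ℚ.∣ seq i ℚ.- seq j ∣ ℚ.≤ ε)

open ℝ public

infix  4 _<ᴿ_ _≤ᴿ_ _≈ᴿ_
infixl 6 _+ᴿ_ _-ᴿ_
infixl 7 _*ᴿ_

_<ᴿ_ : ℝ → ℝ → Set
x <ᴿ y = ∃[ ε ] (0ℚ ℚ.< ε ×
           ∃[ N ] (∀ i → N ℕ.≤ i → seq x i ℚ.+ ε ℚ.≤ seq y i))

_≤ᴿ_ : ℝ → ℝ → Set
x ≤ᴿ y = ¬ (y <ᴿ x)

_≈ᴿ_ : ℝ → ℝ → Set
x ≈ᴿ y = x ≤ᴿ y × y ≤ᴿ x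

fromℚ : ℚ → ℝ
fromℚ q = record
  { seq    = λ _ → q
  ; cauchy = λ ε 0<ε → 0 , λ _ _ _ _ →
      subst (λ z → ℚ.∣ z ∣ ℚ.≤ ε) (sym (ℚ.+-inverseʳ q)) (ℚ.<⇒≤ 0<ε)
  }

fromℕ : ℕ → ℝ
fromℕ n = fromℚ (+ n / 1)

0ᴿ 1ᴿ : ℝ
0ᴿ = fromℚ 0ℚ
1ᴿ = fromℚ 1ℚ

private
  0<½* : ∀ {ε} → 0ℚ ℚ.< ε → 0ℚ ℚ.< ½ ℚ.* ε
  0<½* {ε} 0<ε = ℚ.positive⁻¹ (½ ℚ.* ε)
    {{ℚ.pos*pos⇒pos ½ ε {{ℚ.positive 0<ε}}}}

  ½+½ : ∀ ε → ½ ℚ.* ε ℚ.+ ½ ℚ.* ε ≡ ε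
  ½+½ ε = trans (sym (ℚ.*-distribʳ-+ ε ½ ½)) (ℚ.*-identityˡ ε)

  interchange : ∀ a b c d →
    (a ℚ.+ b) ℚ.- (c ℚ.+ d) ≡ (a ℚ.- c) ℚ.+ (b ℚ.- d)
  interchange = solve 4
    (λ a b c d → (a :+ b) :- (c :+ d) := (a :- c) :+ (b :- d)) refl
    where open +-*-Solver

  neg-minus : ∀ a b → (ℚ.- a) ℚ.- (ℚ.- b) ≡ ℚ.- (a ℚ.- b)
  neg-minus = solve 2 (λ a b → (:- a) :- (:- b) := :- (a :- b)) refl
    where open +-*-Solver

  mul-minus : ∀ a b c d → (a ℚ.* b) ℚ.- (c ℚ.* d)
                        ≡ a ℚ.* (b ℚ.- d) ℚ.+ (a ℚ.- c) ℚ.* d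
  mul-minus = solve 4
    (λ a b c d → (a :* b) :- (c :* d) := a :* (b :- d) :+ (a :- c) :* d)
    refl
    where open +-*-Solver

  minus-plus : ∀ a b → (a ℚ.- b) ℚ.+ b ≡ a
  minus-plus = solve 2 (λ a b → (a :- b) :+ b := a) refl
    where open +-*-Solver

  bounded : ∀ x → ∃[ B ] (ℚ.Positive B ×
              ∃[ N ] (∀ i → N ℕ.≤ i → ℚ.∣ seq x i ∣ ℚ.≤ B))
  bounded x with cauchy x 1ℚ (ℚ.positive⁻¹ 1ℚ)
  ... | N , close = 1ℚ ℚ.+ ℚ.∣ seq x N ∣
    , ℚ.pos+nonNeg⇒pos 1ℚ ℚ.∣ seq x N ∣ {{ℚ.∣-∣-nonNeg (seq x N)}}
    , N , λ i N≤i → begin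
      ℚ.∣ seq x i ∣                                ≡⟨ cong ℚ.∣_∣ (minus-plus (seq x i) (seq x N)) ⟨
      ℚ.∣ (seq x i ℚ.- seq x N) ℚ.+ seq x N ∣       ≤⟨ ℚ.∣p+q∣≤∣p∣+∣q∣ (seq x i ℚ.- seq x N) (seq x N) ⟩
      ℚ.∣ seq x i ℚ.- seq x N ∣ ℚ.+ ℚ.∣ seq x N ∣   ≤⟨ ℚ.+-monoˡ-≤ ℚ.∣ seq x N ∣ (close i N N≤i ℕ.≤-refl) ⟩
      1ℚ ℚ.+ ℚ.∣ seq x N ∣                         ∎
    where open ℚ.≤-Reasoning

_+ᴿ_ : ℝ → ℝ → ℝ
x +ᴿ y = record { seq = λ i → seq x i ℚ.+ seq y i ; cauchy = λ ε 0<ε →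
  let N₁ , p = cauchy x (½ ℚ.* ε) (0<½* 0<ε)
      N₂ , q = cauchy y (½ ℚ.* ε) (0<½* 0<ε)
  in N₁ ⊔ N₂ , λ i j N≤i N≤j → begin
    ℚ.∣ (seq x i ℚ.+ seq y i) ℚ.- (seq x j ℚ.+ seq y j) ∣
      ≡⟨ cong ℚ.∣_∣ (interchange (seq x i) (seq y i) (seq x j) (seq y j)) ⟩
    ℚ.∣ (seq x i ℚ.- seq x j) ℚ.+ (seq y i ℚ.- seq y j) ∣
      ≤⟨ ℚ.∣p+q∣≤∣p∣+∣q∣ (seq x i ℚ.- seq x j) (seq y i ℚ.- seq y j) ⟩
    ℚ.∣ seq x i ℚ.- seq x j ∣ ℚ.+ ℚ.∣ seq y i ℚ.- seq y j ∣
      ≤⟨ ℚ.+-mono-≤ (p i j (ℕ.m⊔n≤o⇒m≤o N₁ N₂ N≤i) (ℕ.m⊔n≤o⇒m≤o N₁ N₂ N≤j))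
                    (q i j (ℕ.m⊔n≤o⇒n≤o N₁ N₂ N≤i) (ℕ.m⊔n≤o⇒n≤o N₁ N₂ N≤j)) ⟩
    ½ ℚ.* ε ℚ.+ ½ ℚ.* ε
      ≡⟨ ½+½ ε ⟩
    ε ∎ }
  where open ℚ.≤-Reasoning

-ᴿ_ : ℝ → ℝ
-ᴿ x = record { seq = λ i → ℚ.- seq x i ; cauchy = λ ε 0<ε →
  let N , p = cauchy x ε 0<ε
  in N , λ i j N≤i N≤j → begin
    ℚ.∣ (ℚ.- seq x i) ℚ.- (ℚ.- seq x j) ∣
      ≡⟨ cong ℚ.∣_∣ (neg-minus (seq x i) (seq x j)) ⟩
    ℚ.∣ ℚ.- (seq x i ℚ.- seq x j) ∣
      ≡⟨ ℚ.∣-p∣≡∣p∣ (seq x i ℚ.- seq x j) ⟩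
    ℚ.∣ seq x i ℚ.- seq x j ∣
      ≤⟨ p i j N≤i N≤j ⟩
    ε ∎ }
  where open ℚ.≤-Reasoning

_-ᴿ_ : ℝ → ℝ → ℝ
x -ᴿ y = x +ᴿ (-ᴿ y)

private
  abs-*-≤ : ∀ a b {c d} → ℚ.∣ a ∣ ℚ.≤ c → ℚ.∣ b ∣ ℚ.≤ d →
            ℚ.∣ a ℚ.* b ∣ ℚ.≤ c ℚ.* d
  abs-*-≤ a b {c} {d} a≤c b≤d = begin
    ℚ.∣ a ℚ.* b ∣         ≡⟨ ℚ.∣p*q∣≡∣p∣*∣q∣ a b ⟩
    ℚ.∣ a ∣ ℚ.* ℚ.∣ b ∣   ≤⟨ ℚ.*-monoʳ-≤-nonNeg ℚ.∣ b ∣ {{ℚ.∣-∣-nonNeg b}} a≤c ⟩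
    c ℚ.* ℚ.∣ b ∣         ≤⟨ ℚ.*-monoˡ-≤-nonNeg c
                              {{ℚ.nonNegative (ℚ.≤-trans (ℚ.0≤∣p∣ a) a≤c)}} b≤d ⟩
    c ℚ.* d               ∎
    where open ℚ.≤-Reasoning

  *-close : ∀ {A B δ} a b c d →
    ℚ.∣ a ∣ ℚ.≤ A → ℚ.∣ d ∣ ℚ.≤ B →
    ℚ.∣ a ℚ.- c ∣ ℚ.≤ δ → ℚ.∣ b ℚ.- d ∣ ℚ.≤ δ →
    ℚ.∣ a ℚ.* b ℚ.- c ℚ.* d ∣ ℚ.≤ A ℚ.* δ ℚ.+ δ ℚ.* B
  *-close {A} {B} {δ} a b c d a≤A d≤B a-c≤δ b-d≤δ = begin
    ℚ.∣ a ℚ.* b ℚ.- c ℚ.* d ∣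
      ≡⟨ cong ℚ.∣_∣ (mul-minus a b c d) ⟩
    ℚ.∣ a ℚ.* (b ℚ.- d) ℚ.+ (a ℚ.- c) ℚ.* d ∣
      ≤⟨ ℚ.∣p+q∣≤∣p∣+∣q∣ (a ℚ.* (b ℚ.- d)) ((a ℚ.- c) ℚ.* d) ⟩
    ℚ.∣ a ℚ.* (b ℚ.- d) ∣ ℚ.+ ℚ.∣ (a ℚ.- c) ℚ.* d ∣
      ≤⟨ ℚ.+-mono-≤ (abs-*-≤ a (b ℚ.- d) a≤A b-d≤δ)
                    (abs-*-≤ (a ℚ.- c) d a-c≤δ d≤B) ⟩
    A ℚ.* δ ℚ.+ δ ℚ.* B ∎
    where open ℚ.≤-Reasoning

  regroup : ∀ a b e s →
    a ℚ.* (e ℚ.* s) ℚ.+ (e ℚ.* s) ℚ.* b ≡ e ℚ.* (s ℚ.* (a ℚ.+ b))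
  regroup = solve 4
    (λ a b e s → a :* (e :* s) :+ (e :* s) :* b := e :* (s :* (a :+ b)))
    refl
    where open +-*-Solver

  split-ε : ∀ A B ε → ℚ.Positive A → ℚ.Positive B → 0ℚ ℚ.< ε →
    ∃[ δ ] (0ℚ ℚ.< δ × A ℚ.* δ ℚ.+ δ ℚ.* B ≡ ε)
  split-ε A B ε A>0 B>0 0<ε =
    ε ℚ.* S⁻¹
    , ℚ.positive⁻¹ (ε ℚ.* S⁻¹)
        {{ℚ.pos*pos⇒pos ε {{ℚ.positive 0<ε}} S⁻¹ {{ℚ.1/pos⇒pos S {{S>0}}}}}}
    , trans (regroup A B ε S⁻¹)
        (trans (cong (ε ℚ.*_) (ℚ.*-inverseˡ S {{S≠0}})) (ℚ.*-identityʳ ε))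
    where
    S = A ℚ.+ B
    S>0 : ℚ.Positive S
    S>0 = ℚ.pos+pos⇒pos A {{A>0}} B {{B>0}}
    S≠0 : ℚ.NonZero S
    S≠0 = ℚ.pos⇒nonZero S {{S>0}}
    S⁻¹ = (1/ S) {{S≠0}}

  *-cauchy : ∀ x y ε → 0ℚ ℚ.< ε →
    ∃[ N ] (∀ i j → N ℕ.≤ i → N ℕ.≤ j →
      ℚ.∣ seq x i ℚ.* seq y i ℚ.- seq x j ℚ.* seq y j ∣ ℚ.≤ ε)
  *-cauchy x y ε 0<ε =
    let A , A>0 , N₁ , x≤A = bounded x
        B , B>0 , N₂ , y≤B = bounded y
        δ , 0<δ , δ-eq     = split-ε A B ε A>0 B>0 0<ε
        N₃ , p             = cauchy x δ 0<δ
        N₄ , q             = cauchy y δ 0<δ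
    in (N₁ ⊔ N₂) ⊔ (N₃ ⊔ N₄) , λ i j N≤i N≤j →
      let i₁₂ = ℕ.m⊔n≤o⇒m≤o (N₁ ⊔ N₂) (N₃ ⊔ N₄) N≤i
          i₃₄ = ℕ.m⊔n≤o⇒n≤o (N₁ ⊔ N₂) (N₃ ⊔ N₄) N≤i
          j₁₂ = ℕ.m⊔n≤o⇒m≤o (N₁ ⊔ N₂) (N₃ ⊔ N₄) N≤j
          j₃₄ = ℕ.m⊔n≤o⇒n≤o (N₁ ⊔ N₂) (N₃ ⊔ N₄) N≤j
      in ℚ.≤-trans
           (*-close (seq x i) (seq y i) (seq x j) (seq y j)
             (x≤A i (ℕ.m⊔n≤o⇒m≤o N₁ N₂ i₁₂))
             (y≤B j (ℕ.m⊔n≤o⇒n≤o N₁ N₂ j₁₂))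
             (p i j (ℕ.m⊔n≤o⇒m≤o N₃ N₄ i₃₄) (ℕ.m⊔n≤o⇒m≤o N₃ N₄ j₃₄))
             (q i j (ℕ.m⊔n≤o⇒n≤o N₃ N₄ i₃₄) (ℕ.m⊔n≤o⇒n≤o N₃ N₄ j₃₄)))
           (ℚ.≤-reflexive δ-eq)

_*ᴿ_ : ℝ → ℝ → ℝ
x *ᴿ y = record { seq = λ i → seq x i ℚ.* seq y i ; cauchy = *-cauchy x y }

sumᴿ : List ℝ → ℝ
sumᴿ = foldr _+ᴿ_ 0ᴿ

------------------------------------------------------------------------
-- Finite sets

subsets : ∀ n → List (Subset n)
subsets 0       = [] ∷ []
subsets (suc n) = map (outside ∷_) (subsets n) ++ map (inside ∷_) (subsets n)

image : ∀ {k n} → (Fin k → Fin n) → Subset k → Subset n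
image f []            = ⊥
image f (outside ∷ e) = image (f ∘ suc) e
image f (inside ∷ e)  = ⁅ f zero ⁆ ∪ image (f ∘ suc) e

∏[_] : ∀ {n} → Subset n → (Fin n → ℝ) → ℝ
∏[ [] ]          x = 1ᴿ
∏[ outside ∷ e ] x = ∏[ e ] (x ∘ suc)
∏[ inside ∷ e ]  x = x zero *ᴿ ∏[ e ] (x ∘ suc)

-- The elements of U, in increasing order, are identified with Fin ∣ U ∣;
-- embed U views a set of them as a subset of the ambient set.
embed : ∀ {n} (U : Subset n) → Subset ∣ U ∣ → Subset n
embed []            e       = []
embed (outside ∷ U) e       = outside ∷ embed U e
embed (inside ∷ U)  (b ∷ e) = b ∷ embed U e

∣embed∣ : ∀ {n} (U : Subset n) (e : Subset ∣ U ∣) → ∣ embed U e ∣ ≡ ∣ e ∣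
∣embed∣ []            []            = refl
∣embed∣ (outside ∷ U) e             = ∣embed∣ U e
∣embed∣ (inside ∷ U)  (outside ∷ e) = ∣embed∣ U e
∣embed∣ (inside ∷ U)  (inside ∷ e)  = cong suc (∣embed∣ U e)

------------------------------------------------------------------------
-- r-graphs

record RGraph (r : ℕ) : Set where
  field
    order   : ℕ
    isEdge  : Subset order → Bool
    uniform : ∀ e → T (isEdge e) → ∣ e ∣ ≡ r

open RGraph public

Edge : ∀ {r} (G : RGraph r) → Subset (order G) → Set
Edge G e = T (isEdge G e)

edges : ∀ {r} (G : RGraph r) → List (Subset (order G))
edges G = filterᵇ (isEdge G) (subsets (order G))

size : ∀ {r} → RGraph r → ℕ
size G = length (edges G)

degree : ∀ {r} (G : RGraph r) → Fin (order G) → ℕ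
degree G v = length (filter (v ∈?_) (edges G))

-- The induced subgraph on U.
_[_] : ∀ {r} (G : RGraph r) → Subset (order G) → RGraph r
G [ U ] = record
  { order   = ∣ U ∣
  ; isEdge  = λ e → isEdge G (embed U e)
  ; uniform = λ e e∈G → trans (sym (∣embed∣ U e)) (uniform G (embed U e) e∈G)
  }

infix 4 _⊑_

-- G contains a (not necessarily induced) copy of F.
record _⊑_ {r} (F G : RGraph r) : Set where
  field
    vertex    : Fin (order F) → Fin (order G)
    injective : Injective _≡_ _≡_ vertex
    edge      : ∀ e → Edge F e → Edge G (image vertex e)

Family : ℕ → Set₁
Family r = RGraph r → Set

infix 4 _-Free_

_-Free_ : ∀ {r} → Family r → RGraph r → Set
𝓕 -Free G = ∀ H → 𝓕 H → ¬ (H ⊑ G)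

Covered : ∀ {r} (H : RGraph r) → (u v : Fin (order H)) → Set
Covered H u v = ∃[ e ] (Edge H e × u ∈ e × v ∈ e)

-- The family 𝒦 F p; it is meant for order F ≤ p.
record 𝒦 {r} (F : RGraph r) (p : ℕ) (H : RGraph r) : Set where
  field
    core     : Subset (order H)
    coreSize : ∣ core ∣ ≡ p
    copy     : F ⊑ H [ core ]
    covered  : ∀ u v → u ∈ core → v ∈ core → u ≢ v → Covered H u v

Partite : ∀ {r} → ℕ → RGraph r → Set
Partite m G = Σ[ part ∈ (Fin (order G) → Fin m) ]
  (∀ e → Edge G e → ∀ u v → u ∈ e → v ∈ e → part u ≡ part v → u ≡ v)

------------------------------------------------------------------------
-- Lagrangians

lagrangePoly : ∀ {r} (G : RGraph r) → (Fin (order G) → ℝ) → ℝ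
lagrangePoly {r} G x = fromℕ (r !) *ᴿ sumᴿ (map (λ e → ∏[ e ] x) (edges G))

Simplex : ∀ t → (Fin t → ℝ) → Set
Simplex t x = (∀ i → 0ᴿ ≤ᴿ x i) × sumᴿ (map x (allFin t)) ≈ᴿ 1ᴿ

-- v = λ(G).  The maximum of a continuous function on the compact simplex
-- is specified, as usual constructively, as an upper bound that is
-- approached arbitrarily closely; that it is attained is a theorem of
-- classical analysis and is not part of the definition.
IsLagrangian : ∀ {r} → RGraph r → ℝ → Set
IsLagrangian G v =
  (∀ x → Simplex (order G) x → lagrangePoly G x ≤ᴿ v) ×
  (∀ ε → 0ᴿ <ᴿ ε → ∃[ x ] (Simplex (order G) x × v -ᴿ ε <ᴿ lagrangePoly G x))

DensityBound : ∀ {r} → RGraph r → ℝ → Set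
DensityBound {r} F u =
  ∀ (G : RGraph r) → ¬ (F ⊑ G) → ∀ v → IsLagrangian G v → v ≤ᴿ u

-- s = π_λ(F).  Lagrangians are nonnegative, and the supremum is taken in
-- [0,∞).  This matters only for edgeless F on at most one vertex, when it
-- is the supremum of the empty set.
IsLagrangianDensity : ∀ {r} → RGraph r → ℝ → Set
IsLagrangianDensity F s =
  0ᴿ ≤ᴿ s × DensityBound F s ×
  (∀ u → 0ᴿ ≤ᴿ u → DensityBound F u → s ≤ᴿ u)

-- [m]_r / m^r
turánDensity : ∀ m r .{{_ : NonTrivial m}} → ℝ
turánDensity m r = fromℚ (_/_ (+ (m P r)) (m ℕ.^ r)
  {{ℕ.m^n≢0 m r {{nonTrivial⇒nonZero m}}}})

------------------------------------------------------------------------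
-- Stability

-- 𝒦 F (m + 1) is m-stable.
Stable : ∀ m r .{{_ : NonTrivial m}} → RGraph r → Set
Stable m r F =
  ∀ ε → 0ᴿ <ᴿ ε →
  ∃[ δ₁ ] (0ᴿ <ᴿ δ₁ × ∃[ n₁ ]
    (∀ (G : RGraph r) →
       let n = order G in
       n₁ ℕ.≤ n →
       𝒦 F (suc m) -Free G →
       (turánDensity m r -ᴿ δ₁) *ᴿ fromℕ (n C r) <ᴿ fromℕ (size G) →
       ∃[ S ] (fromℕ ∣ S ∣ ≤ᴿ ε *ᴿ fromℕ n × Partite m (G [ ∁ S ]))))

{-# OPTIONS --safe #-}

module Submission where

open import Defs

-- Let p be the edge polynomial of G and D z its partial derivatives.  For an
-- uncovered pair u, v both p and all D z are affine along the direction that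
-- moves weight between u and v, hence so is Φ = K p + Σ_z D z, and one of the
-- two shifts of all the weight of the pair to one vertex does not decrease Φ.
-- Starting from the all-ones vector this leads to a weight y of the same total,
-- supported on a set U of pairwise covered vertices, with Φ(y) ≥ (K + r) |G|.
-- If |U| > m then G[U] is F-free and p(y) is too small, because
-- π_λ(F) < [m]_r / m^r.  Otherwise near-equality in Maclaurin's inequality shows
-- that y is nearly uniform on a set T of m vertices and that T is complete.
-- Every vertex z of G has no link edge in T through some t ∈ T, since T + z would
-- be a core; if moreover its link misses an edge in T − t, then D z is smaller
-- than its maximum by a constant factor, so Φ(y) allows only few such z.  The
-- remaining vertices are classified by t, and two vertices of the same class are
-- uncovered, since T − t + u + v would be a core.
--
-- Weights are natural numbers of total |V(G)|, so all inequalities are stated in ℕ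
-- with denominators cleared.
--
-- The bound π_λ(F) < [m]_r / m^r speaks about Lagrangians that are given as real
-- numbers.  The Lagrangian of H exists constructively as the limit over i of the
-- maximum of the polynomial on the points of the simplex with denominator i + 1,
-- which is within O(1 / i) of the supremum.

-- Symmetrizing p alone would end in a weight on a few vertices that says nothing about the rest of
-- G. The derivatives D z keep that information: their coefficients come from the original G, they
-- are carried through every shift, and in the end D z measures how z attaches to T. Adding them to
-- p loses nothing. By Euler's identity Σ_z D z = r p at the all-ones vector, and at the extremal
-- values p = C(m,r) (n/m)^r and D z = C(m-1,r-1) (n/m)^(r-1) the sum of D z over all n vertices is
-- again r p. So a nearly extremal Φ forces both of its summands to be nearly extremal. K is large
-- because p(y) must be estimated before anything better than Σ_z D z ≤ n^r is known.
--
-- The hypothesis on F serves to place F in T + z when only one edge of G through z is at hand. If F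
-- has at most m vertices, it lies in T. Otherwise its vertex of degree 1 goes to z and the one edge
-- through that vertex goes to the given edge.

-- Multi-affine polynomials, their derivatives, and elementary symmetric polynomials.

module Polynomials where
  open import Data.Fin.Base using (Fin; zero; suc; punchIn)
  open import Data.Fin.Subset using (Subset; inside; outside; _∈_; _∉_; ∣_∣)
  open import Data.Nat.Base
  open import Data.Nat.Properties
  open import Data.Nat.Tactic.RingSolver using (solve-∀)
  open import Data.Vec.Base as Vec using ([]; _∷_; _[_]≔_)
  open import Data.Vec.Functional using (updateAt)
  open import Data.Vec.Properties using (≡-dec)
  open import Data.Bool.Properties using () renaming (_≟_ to _≟ᵇ_)
  open import Relation.Nullary using (yes; no)
  open import Function.Base using (_∘_; const)
  open import Relation.Binary.PropositionalEquality
  open import Relation.Nullary.Negation using (contradiction)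
  open import Algebra.Properties.CommutativeMonoid.Sum +-0-commutativeMonoid using (sum; sum-cong-≗; ∑-distrib-+; sum-replicate-zero)

  -- Multi-affine polynomials: the coefficient of ∏_{i ∈ e} y i in poly g y is g e.

  poly : ∀ {n} → (Subset n → ℕ) → (Fin n → ℕ) → ℕ
  poly {zero}  g y = g []
  poly {suc n} g y = poly (g ∘ (outside ∷_)) (y ∘ suc) + y zero * poly (g ∘ (inside ∷_)) (y ∘ suc)

  ∂ : ∀ {n} → Fin n → (Subset n → ℕ) → Subset n → ℕ
  ∂ zero    g (outside ∷ e) = g (inside ∷ e)
  ∂ zero    g (inside ∷ e)  = 0
  ∂ (suc u) g (b ∷ e)       = ∂ u (g ∘ (b ∷_)) e

  poly-cong : ∀ {n} {g h : Subset n → ℕ} {x y} → g ≗ h → x ≗ y → poly g x ≡ poly h y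
  poly-cong {zero}  g≗h x≗y = g≗h []
  poly-cong {suc n} g≗h x≗y = cong₂ _+_ (poly-cong (g≗h ∘ (outside ∷_)) (x≗y ∘ suc))
    (cong₂ _*_ (x≗y zero) (poly-cong (g≗h ∘ (inside ∷_)) (x≗y ∘ suc)))

  poly-mono : ∀ {n} {g h : Subset n → ℕ} {x y} → (∀ e → g e ≤ h e) → (∀ i → x i ≤ y i) → poly g x ≤ poly h y
  poly-mono {zero}  g≤h x≤y = g≤h []
  poly-mono {suc n} g≤h x≤y = +-mono-≤ (poly-mono (g≤h ∘ (outside ∷_)) (x≤y ∘ suc))
    (*-mono-≤ (x≤y zero) (poly-mono (g≤h ∘ (inside ∷_)) (x≤y ∘ suc)))

  poly-zero : ∀ {n} (g : Subset n → ℕ) y → (∀ e → g e ≡ 0) → poly g y ≡ 0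
  poly-zero {zero}  g y g≡0 = g≡0 []
  poly-zero {suc n} g y g≡0 = cong₂ _+_ (poly-zero _ (y ∘ suc) (g≡0 ∘ (outside ∷_)))
    (trans (cong (y zero *_) (poly-zero _ (y ∘ suc) (g≡0 ∘ (inside ∷_)))) (*-zeroʳ (y zero)))

  poly-+ : ∀ {n} (g h : Subset n → ℕ) y → poly (λ e → g e + h e) y ≡ poly g y + poly h y
  poly-+ {zero}  g h y = refl
  poly-+ {suc n} g h y = trans
    (cong₂ _+_ (poly-+ (g ∘ (outside ∷_)) (h ∘ (outside ∷_)) (y ∘ suc))
               (cong (y zero *_) (poly-+ (g ∘ (inside ∷_)) (h ∘ (inside ∷_)) (y ∘ suc))))
    (rearr (poly (g ∘ (outside ∷_)) (y ∘ suc)) _ (y zero) (poly (g ∘ (inside ∷_)) (y ∘ suc)) _)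
    where
    rearr : ∀ a b x c d → (a + b) + x * (c + d) ≡ (a + x * c) + (b + x * d)
    rearr = solve-∀

  poly-* : ∀ {n} k (g : Subset n → ℕ) y → poly (λ e → k * g e) y ≡ k * poly g y
  poly-* {zero}  k g y = refl
  poly-* {suc n} k g y = trans
    (cong₂ (λ a b → a + y zero * b) (poly-* k (g ∘ (outside ∷_)) (y ∘ suc)) (poly-* k (g ∘ (inside ∷_)) (y ∘ suc)))
    (rearr k _ (y zero) _)
    where
    rearr : ∀ k a x b → k * a + x * (k * b) ≡ k * (a + x * b)
    rearr = solve-∀

  poly-sum : ∀ {n l} (g : Fin l → Subset n → ℕ) y →
          poly (λ e → sum (λ z → g z e)) y ≡ sum (λ z → poly (g z) y)
  poly-sum {l = zero}  g y = poly-zero _ y (λ _ → refl)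
  poly-sum {l = suc l} g y = trans (poly-+ (g zero) _ y) (cong (poly (g zero) y +_) (poly-sum (g ∘ suc) y))

  sum-updateAt : ∀ {n} u (y : Fin n → ℕ) a → sum (updateAt y u (const a)) + y u ≡ sum y + a
  sum-updateAt zero y a = rearr a (y zero) _
    where
    rearr : ∀ a b s → a + s + b ≡ b + s + a
    rearr = solve-∀
  sum-updateAt (suc u) y a = trans (+-assoc (y zero) _ _)
    (trans (cong (y zero +_) (sum-updateAt u (y ∘ suc) a)) (sym (+-assoc (y zero) _ _)))

  -- The first-order Taylor expansion is exact, as every variable has degree at most 1. No monomial
  -- of `∂ u g` contains `u`, so it may be evaluated at `y` itself.
  poly-updateAt : ∀ {n} u g (y : Fin n → ℕ) a →
    poly g (updateAt y u (const a)) ≡ poly g (updateAt y u (const 0)) + a * poly (∂ u g) y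
  poly-updateAt {suc n} zero g y a = sym (trans
    (cong (λ b → p + 0 + a * (q + y zero * b)) (poly-zero {n} (λ _ → 0) (y ∘ suc) (λ _ → refl))) (rearr p q a (y zero)))
    where
    p = poly (g ∘ (outside ∷_)) (y ∘ suc)
    q = poly (g ∘ (inside ∷_)) (y ∘ suc)
    rearr : ∀ p q a x → p + 0 + a * (q + x * 0) ≡ p + a * q
    rearr = solve-∀
  poly-updateAt (suc u) g y a = trans
    (cong₂ (λ b c → b + y zero * c) (poly-updateAt u (g ∘ (outside ∷_)) (y ∘ suc) a)
                                    (poly-updateAt u (g ∘ (inside ∷_)) (y ∘ suc) a))
    (rearr _ _ (y zero) _ a _)
    where
    rearr : ∀ p q x r a s → (p + a * q) + x * (r + a * s) ≡ p + x * r + a * (q + x * s)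
    rearr = solve-∀

  ∂-∈ : ∀ {n u} (g : Subset n → ℕ) {e} → u ∈ e → ∂ u g e ≡ 0
  ∂-∈ {u = zero}  g {inside ∷ e} Vec.here = refl
  ∂-∈ {u = suc u} g {b ∷ e} (Vec.there u∈e) = ∂-∈ (g ∘ (b ∷_)) u∈e

  ∂-∉ : ∀ {n} u (g : Subset n → ℕ) {e} → u ∉ e → ∂ u g e ≡ g (e [ u ]≔ inside)
  ∂-∉ zero    g {outside ∷ e} u∉e = refl
  ∂-∉ zero    g {inside ∷ e}  u∉e = contradiction Vec.here u∉e
  ∂-∉ (suc u) g {b ∷ e} u∉e = ∂-∉ u (g ∘ (b ∷_)) (u∉e ∘ Vec.there)

  ∂-zero : ∀ {n} u (g : Subset n → ℕ) e → (∀ e → g e ≡ 0) → ∂ u g e ≡ 0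
  ∂-zero zero    g (outside ∷ e) g≡0 = g≡0 (inside ∷ e)
  ∂-zero zero    g (inside ∷ e)  g≡0 = refl
  ∂-zero (suc u) g (b ∷ e)       g≡0 = ∂-zero u (g ∘ (b ∷_)) e (g≡0 ∘ (b ∷_))

  -- The elementary symmetric polynomial of degree `r`, split by whether a monomial contains the
  -- first variable.
  E : ℕ → ∀ {n} → (Fin n → ℕ) → ℕ
  E zero            w = 1
  E (suc r) {zero}  w = 0
  E (suc r) {suc n} w = E (suc r) (w ∘ suc) + w zero * E r (w ∘ suc)

  -- The coefficient function of `E r`. A bound `g e ≤ χ r e` for all `e` says at once that `g` is
  -- homogeneous of degree `r` and that its coefficients are 0 or 1.
  χ : ∀ {n} → ℕ → Subset n → ℕ
  χ zero    []            = 1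
  χ (suc r) []            = 0
  χ r       (outside ∷ e) = χ r e
  χ zero    (inside ∷ e)  = 0
  χ (suc r) (inside ∷ e)  = χ r e

  χ-size : ∀ {n} (e : Subset n) → χ ∣ e ∣ e ≡ 1
  χ-size []            = refl
  χ-size (outside ∷ e) with ∣ e ∣ | χ-size e
  ... | zero  | eq = eq
  ... | suc _ | eq = eq
  χ-size (inside ∷ e)  = χ-size e

  χ-out : ∀ {n} r (e : Subset n) → χ r (outside ∷ e) ≡ χ r e
  χ-out zero    e = refl
  χ-out (suc r) e = refl

  χ-∣∣ : ∀ {n} r (e : Subset n) → χ r e ≢ 0 → ∣ e ∣ ≡ r
  χ-∣∣ zero    []            χ≢0 = refl
  χ-∣∣ (suc r) []            χ≢0 = contradiction refl χ≢0
  χ-∣∣ zero    (outside ∷ e) χ≢0 = χ-∣∣ zero e χ≢0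
  χ-∣∣ (suc r) (outside ∷ e) χ≢0 = χ-∣∣ (suc r) e χ≢0
  χ-∣∣ zero    (inside ∷ e)  χ≢0 = contradiction refl χ≢0
  χ-∣∣ (suc r) (inside ∷ e)  χ≢0 = cong suc (χ-∣∣ r e χ≢0)

  ∂-constant : ∀ {n} u (g : Subset n → ℕ) → (∀ e → g e ≤ χ 0 e) → ∀ e → ∂ u g e ≡ 0
  ∂-constant zero    g g≤χ (outside ∷ e) = n≤0⇒n≡0 (g≤χ (inside ∷ e))
  ∂-constant zero    g g≤χ (inside ∷ e)  = refl
  ∂-constant (suc u) g g≤χ (outside ∷ e) = ∂-constant u (g ∘ (outside ∷_)) (g≤χ ∘ (outside ∷_)) e
  ∂-constant (suc u) g g≤χ (inside ∷ e)  = ∂-zero u (g ∘ (inside ∷_)) e (λ d → n≤0⇒n≡0 (g≤χ (inside ∷ d)))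

  ∂-≤χ : ∀ {n} r u (g : Subset n → ℕ) → (∀ e → g e ≤ χ (suc r) e) → ∀ e → ∂ u g e ≤ χ r e
  ∂-≤χ r       zero    g g≤χ (outside ∷ e) = ≤-trans (g≤χ (inside ∷ e)) (≤-reflexive (sym (χ-out r e)))
  ∂-≤χ r       zero    g g≤χ (inside ∷ e)  = z≤n
  ∂-≤χ r       (suc u) g g≤χ (outside ∷ e) =
    ≤-trans (∂-≤χ r u (g ∘ (outside ∷_)) (g≤χ ∘ (outside ∷_)) e) (≤-reflexive (sym (χ-out r e)))
  ∂-≤χ zero    (suc u) g g≤χ (inside ∷ e)  =
    ≤-reflexive (∂-constant u (g ∘ (inside ∷_)) (g≤χ ∘ (inside ∷_)) e)
  ∂-≤χ (suc r) (suc u) g g≤χ (inside ∷ e)  = ∂-≤χ r u (g ∘ (inside ∷_)) (g≤χ ∘ (inside ∷_)) e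

  poly-χ : ∀ {n} r (w : Fin n → ℕ) → poly (χ r) w ≡ E r w
  poly-χ {zero}  zero    w = refl
  poly-χ {zero}  (suc r) w = refl
  poly-χ {suc n} zero    w = cong₂ _+_ (poly-χ zero (w ∘ suc))
    (trans (cong (w zero *_) (poly-zero {n} _ (w ∘ suc) (λ _ → refl))) (*-zeroʳ (w zero)))
  poly-χ {suc n} (suc r) w = cong₂ (λ a b → a + w zero * b) (poly-χ (suc r) (w ∘ suc)) (poly-χ r (w ∘ suc))

  E-cong : ∀ r {n} {v w : Fin n → ℕ} → v ≗ w → E r v ≡ E r w
  E-cong r {v = v} {w} v≗w = trans (sym (poly-χ r v)) (trans (poly-cong (λ _ → refl) v≗w) (poly-χ r w))

  -- The Kronecker delta, that is, the coefficient function of the single monomial of `e`.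
  δ : ∀ {n} → Subset n → Subset n → ℕ
  δ []            []            = 1
  δ (outside ∷ e) (outside ∷ d) = δ e d
  δ (inside ∷ e)  (inside ∷ d)  = δ e d
  δ (outside ∷ e) (inside ∷ d)  = 0
  δ (inside ∷ e)  (outside ∷ d) = 0

  δ-zero : ∀ {n} (e d : Subset n) → e ≢ d → δ e d ≡ 0
  δ-zero []            []            e≢d = contradiction refl e≢d
  δ-zero (outside ∷ e) (outside ∷ d) e≢d = δ-zero e d (e≢d ∘ cong (outside ∷_))
  δ-zero (inside ∷ e)  (inside ∷ d)  e≢d = δ-zero e d (e≢d ∘ cong (inside ∷_))
  δ-zero (outside ∷ e) (inside ∷ d)  e≢d = refl
  δ-zero (inside ∷ e)  (outside ∷ d) e≢d = refl

  δ-refl : ∀ {n} (e : Subset n) → δ e e ≡ 1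
  δ-refl []            = refl
  δ-refl (outside ∷ e) = δ-refl e
  δ-refl (inside ∷ e)  = δ-refl e

  poly-δ-≥ : ∀ {n} (e : Subset n) (w : Fin n → ℕ) k b → (∀ {i} → i ∈ e → b ≤ k * w i) →
          b ^ ∣ e ∣ ≤ k ^ ∣ e ∣ * poly (δ e) w
  poly-δ-≥ [] w k b b≤ = ≤-refl
  poly-δ-≥ (outside ∷ e) w k b b≤ = ≤-trans (poly-δ-≥ e (w ∘ suc) k b (b≤ ∘ Vec.there))
    (*-monoʳ-≤ (k ^ ∣ e ∣) (m≤m+n _ _))
  poly-δ-≥ (inside ∷ e) w k b b≤ = begin
    b * b ^ ∣ e ∣                               ≤⟨ *-mono-≤ (b≤ Vec.here) (poly-δ-≥ e (w ∘ suc) k b (b≤ ∘ Vec.there)) ⟩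
    k * w zero * (k ^ ∣ e ∣ * poly (δ e) (w ∘ suc)) ≡⟨ rearr k (w zero) _ _ ⟩
    k * k ^ ∣ e ∣ * (w zero * poly (δ e) (w ∘ suc)) ≤⟨ *-monoʳ-≤ (k * k ^ ∣ e ∣) (m≤n+m _ _) ⟩
    k * k ^ ∣ e ∣ * poly (δ (inside ∷ e)) w         ∎
    where
    open ≤-Reasoning
    rearr : ∀ k x a b → k * x * (a * b) ≡ k * a * (x * b)
    rearr = solve-∀

  poly≤E : ∀ {n} r {g : Subset n → ℕ} w → (∀ e → g e ≤ χ r e) → poly g w ≤ E r w
  poly≤E r w g≤χ = ≤-trans (poly-mono g≤χ (λ _ → ≤-refl)) (≤-reflexive (poly-χ r w))

  -- The quantitative use of a missing set: its whole monomial is left over below `E r`.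
  poly+δ≤E : ∀ {n} r {g : Subset n → ℕ} w e₀ → (∀ e → g e ≤ χ r e) → g e₀ ≡ 0 → ∣ e₀ ∣ ≡ r →
          poly g w + poly (δ e₀) w ≤ E r w
  poly+δ≤E {n} r {g} w e₀ g≤χ g≡0 refl = ≤-trans (≤-reflexive (sym (poly-+ g (δ e₀) w))) (poly≤E r w bound)
    where
    bound : ∀ e → g e + δ e₀ e ≤ χ ∣ e₀ ∣ e
    bound e with ≡-dec _≟ᵇ_ e₀ e
    ... | yes refl = ≤-reflexive (trans (cong₂ _+_ g≡0 (δ-refl e)) (sym (χ-size e)))
    ... | no e₀≢e  = ≤-trans (≤-reflexive (trans (cong (g e +_) (δ-zero e₀ e e₀≢e)) (+-identityʳ _))) (g≤χ e)

  E≤sum^ : ∀ r {n} (w : Fin n → ℕ) → E r w ≤ sum w ^ r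
  E≤sum^ zero            w = ≤-refl
  E≤sum^ (suc r) {zero}  w = z≤n
  E≤sum^ (suc r) {suc n} w = begin
    E (suc r) w′ + x * E r w′ ≤⟨ +-mono-≤ (E≤sum^ (suc r) w′) (*-monoʳ-≤ x (E≤sum^ r w′)) ⟩
    s * s ^ r + x * s ^ r     ≡⟨ rearr s x (s ^ r) ⟩
    (x + s) * s ^ r           ≤⟨ *-monoʳ-≤ (x + s) (^-monoˡ-≤ r (m≤n+m s x)) ⟩
    (x + s) * (x + s) ^ r     ∎
    where
    open ≤-Reasoning
    w′ = w ∘ suc
    x = w zero
    s = sum w′
    rearr : ∀ s x a → s * a + x * a ≡ (x + s) * a
    rearr = solve-∀

  E-punchIn : ∀ r {n} (w : Fin (suc n) → ℕ) t →
              E (suc r) w ≡ E (suc r) (w ∘ punchIn t) + w t * E r (w ∘ punchIn t)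
  E-punchIn r w zero = refl
  E-punchIn zero {suc n} w (suc t) = trans (cong (_+ w zero * 1) (E-punchIn zero (w ∘ suc) t)) (rearr (E 1 (w ∘ suc ∘ punchIn t)) (w (suc t)) (w zero))
    where
    rearr : ∀ a x y → a + x * 1 + y * 1 ≡ a + y * 1 + x * 1
    rearr = solve-∀
  E-punchIn (suc r) {suc n} w (suc t) = trans
    (cong₂ (λ a b → a + w zero * b) (E-punchIn (suc r) (w ∘ suc) t) (E-punchIn r (w ∘ suc) t))
    (rearr (E (2 + r) v) (w (suc t)) (E (1 + r) v) (w zero) (E r v))
    where
    v = w ∘ suc ∘ punchIn t
    rearr : ∀ a x b y c → a + x * b + y * (b + x * c) ≡ a + y * b + x * (b + y * c)
    rearr = solve-∀

  -- Euler's identity for homogeneous polynomials at the all-ones vector, where it is the degree-sum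
  -- formula: each set is counted once for each of its `r` elements.
  euler : ∀ {n} r (g : Subset n → ℕ) → (∀ e → g e ≤ χ r e) →
          sum (λ z → poly (∂ z g) (const 1)) ≡ r * poly g (const 1)
  euler {zero} zero g g≤χ = refl
  euler {zero} (suc r) g g≤χ = sym (trans (cong (suc r *_) (n≤0⇒n≡0 (g≤χ []))) (*-zeroʳ (suc r)))
  euler {suc n} r g g≤χ = begin
    (b + 1 * poly {n} (λ _ → 0) (const 1)) + sum (λ z → poly (∂ z g₀) (const 1) + 1 * poly (∂ z g₁) (const 1))
      ≡⟨ cong₂ (λ a c → (b + 1 * a) + c) (poly-zero {n} (λ _ → 0) (const 1) (λ _ → refl))
          (trans (sum-cong-≗ (λ z → cong (poly (∂ z g₀) (const 1) +_) (*-identityˡ _)))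
            (∑-distrib-+ (λ z → poly (∂ z g₀) (const 1)) (λ z → poly (∂ z g₁) (const 1)))) ⟩
    (b + 0) + (sum (λ z → poly (∂ z g₀) (const 1)) + sum (λ z → poly (∂ z g₁) (const 1)))
      ≡⟨ cong (λ c → (b + 0) + (c + sum (λ z → poly (∂ z g₁) (const 1)))) (euler r g₀ (λ e → ≤-trans (g≤χ _) (≤-reflexive (χ-out r e)))) ⟩
    (b + 0) + (r * poly g₀ (const 1) + sum (λ z → poly (∂ z g₁) (const 1)))
      ≡⟨ rest r g≤χ ⟩
    r * (poly g₀ (const 1) + 1 * b) ∎
    where
    open ≡-Reasoning
    g₀ = g ∘ (outside ∷_)
    g₁ = g ∘ (inside ∷_)
    b = poly g₁ (const 1)
    rearr : ∀ r a b → (b + 0) + (suc r * a + r * b) ≡ suc r * (a + 1 * b)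
    rearr = solve-∀
    rest : ∀ r → (∀ e → g e ≤ χ r e) → (b + 0) + (r * poly g₀ (const 1) + sum (λ z → poly (∂ z g₁) (const 1)))
           ≡ r * (poly g₀ (const 1) + 1 * b)
    rest zero g≤χ = cong₂ (λ x y → x + 0 + y) (poly-zero g₁ (const 1) g₁≡0)
      (trans (sum-cong-≗ (λ z → poly-zero (∂ z g₁) (const 1) (λ e → ∂-zero z g₁ e g₁≡0))) (sum-replicate-zero n))
      where
      g₁≡0 : ∀ e → g₁ e ≡ 0
      g₁≡0 e = n≤0⇒n≡0 (g≤χ (inside ∷ e))
    rest (suc r) g≤χ = trans
      (cong (λ c → (b + 0) + (suc r * poly g₀ (const 1) + c)) (euler r g₁ (g≤χ ∘ (inside ∷_))))
      (rearr r (poly g₀ (const 1)) b)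

-- Maclaurin's inequality with denominators cleared, and binomial estimates.

module Maclaurin where
  open Polynomials
  open import Data.Fin.Base using (Fin; zero; suc)
  open import Data.Nat.Base
  open import Data.Bool.Base using (true)
  open import Data.Nat.Divisibility using (_∣_; m*n∣o⇒n∣o/m)
  open import Data.Nat.DivMod using (m*[n/m]≡n)
  open import Relation.Nullary using (yes; no)
  open import Data.Nat.Combinatorics using (_C_; _P_; nCk+nC[k+1]≡[n+1]C[k+1]; nC1≡n; nCk≡nPk/k!; nPk≡n!/[n∸k]!; k>n⇒nPk≡0; k>n⇒nCk≡0; [n∸k]!k!∣n!)
  open import Data.Nat.Combinatorics.Base using (_P′_)
  open import Data.Nat.Properties
  open import Data.Nat.Tactic.RingSolver using (solve-∀)
  open import Function.Base using (_∘_)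
  open import Relation.Binary.PropositionalEquality
  open import Algebra.Properties.CommutativeMonoid.Sum +-0-commutativeMonoid using (sum)

  ∣-∣² : ∀ a b → a * a + b * b ≡ 2 * (a * b) + ∣ a - b ∣ * ∣ a - b ∣
  ∣-∣² zero    b       = refl
  ∣-∣² (suc a) zero    = rearr (suc a)
    where
    rearr : ∀ a → a * a + 0 * 0 ≡ 2 * (a * 0) + a * a
    rearr = solve-∀
  ∣-∣² (suc a) (suc b) = trans (rearr a b (a * a) (b * b)) (trans (cong (_+ (2 + 2 * a + 2 * b)) (∣-∣² a b)) (rearr₂ a b _))
    where
    rearr : ∀ a b c d → suc a * suc a + suc b * suc b ≡ a * a + b * b + (2 + 2 * a + 2 * b)
    rearr = solve-∀
    rearr₂ : ∀ a b d → 2 * (a * b) + d + (2 + 2 * a + 2 * b) ≡ 2 * (suc a * suc b) + d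
    rearr₂ = solve-∀

  -- The tangent line of x ↦ x ^ (2 + i) at a, with the defect that makes the
  -- equality case quantitative.
  bernoulli : ∀ i a b → (2 + i) * a ^ (1 + i) * b + ∣ a - b ∣ * ∣ a - b ∣ * b ^ i
                      ≤ b ^ (2 + i) + (1 + i) * a ^ (2 + i)
  bernoulli zero a b = ≤-reflexive (trans (rearr a b _) (trans (sym (∣-∣² a b)) (rearr₂ a b)))
    where
    rearr : ∀ a b d → 2 * (a * 1) * b + d * 1 ≡ 2 * (a * b) + d
    rearr = solve-∀
    rearr₂ : ∀ a b → a * a + b * b ≡ b * (b * 1) + 1 * (a * (a * 1))
    rearr₂ = solve-∀
  -- The term added on both sides completes `3 + i` to `2 * (2 + i)`, so that 2ab ≤ a² + b² applies;
  -- what it produces contains `b` times the inequality for `i`.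
  bernoulli (suc i) a b = +-cancelʳ-≤ ((1 + i) * (a * p) * b) _ _ (begin
    (3 + i) * (a * p) * b + d * (b * q) + (1 + i) * (a * p) * b
      ≡⟨ rearr i a p b d q ⟩
    (2 + i) * p * (2 * (a * b)) + d * (b * q)
      ≤⟨ +-monoˡ-≤ _ (*-monoʳ-≤ ((2 + i) * p) (≤-trans (m≤m+n _ d) (≤-reflexive (sym (∣-∣² a b))))) ⟩
    (2 + i) * p * (a * a + b * b) + d * (b * q)
      ≡⟨ rearr₂ i a p b d q ⟩
    (2 + i) * (a * (a * p)) + b * ((2 + i) * p * b + d * q)
      ≤⟨ +-monoʳ-≤ ((2 + i) * (a * (a * p))) (*-monoʳ-≤ b (bernoulli i a b)) ⟩
    (2 + i) * (a * (a * p)) + b * (b * (b * q) + (1 + i) * (a * p))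
      ≡⟨ rearr₃ i a p b q ⟩
    b * (b * (b * q)) + (2 + i) * (a * (a * p)) + (1 + i) * (a * p) * b ∎)
    where
    open ≤-Reasoning
    d = ∣ a - b ∣ * ∣ a - b ∣
    p = a ^ (1 + i)
    q = b ^ i
    rearr : ∀ i a p b d q → (3 + i) * (a * p) * b + d * (b * q) + (1 + i) * (a * p) * b
            ≡ (2 + i) * p * (2 * (a * b)) + d * (b * q)
    rearr = solve-∀
    rearr₂ : ∀ i a p b d q → (2 + i) * p * (a * a + b * b) + d * (b * q)
            ≡ (2 + i) * (a * (a * p)) + b * ((2 + i) * p * b + d * q)
    rearr₂ = solve-∀
    rearr₃ : ∀ i a p b q → (2 + i) * (a * (a * p)) + b * (b * (b * q) + (1 + i) * (a * p))
            ≡ b * (b * (b * q)) + (2 + i) * (a * (a * p)) + (1 + i) * (a * p) * b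
    rearr₃ = solve-∀

  bernoulli₀ : ∀ i a b → suc i * a ^ i * b ≤ b ^ suc i + i * a ^ suc i
  bernoulli₀ zero    a b = ≤-reflexive (rearr b)
    where
    rearr : ∀ b → 1 * 1 * b ≡ b * 1 + 0
    rearr = solve-∀
  bernoulli₀ (suc i) a b = ≤-trans (m≤m+n _ _) (bernoulli i a b)

  -- For m = k + 1 and r = i + 1 this compares C(m,r) with C(m-1,r-1), the extremal coefficients of
  -- p and of D z; `arith-links` relies on it.
  suc*C : ∀ i k → suc i * (suc k C suc i) ≡ suc k * (k C i)
  suc*C zero    k       = trans (*-identityˡ _) (trans (nC1≡n (suc k)) (sym (*-identityʳ (suc k))))
  suc*C (suc i) zero    = trans (cong ((2 + i) *_) (k>n⇒nCk≡0 {1} {2 + i} (s≤s (s≤s z≤n)))) (trans (*-zeroʳ i)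
    (sym (trans (*-identityˡ _) (k>n⇒nCk≡0 {0} {suc i} (s≤s z≤n)))))
  suc*C (suc i) (suc k) = begin
    (2 + i) * ((2 + k) C (2 + i))
      ≡⟨ cong ((2 + i) *_) (nCk+nC[k+1]≡[n+1]C[k+1] (suc k) (suc i)) ⟨
    (2 + i) * (c + (suc k C (2 + i)))
      ≡⟨ *-distribˡ-+ (2 + i) c _ ⟩
    (2 + i) * c + (2 + i) * (suc k C (2 + i))
      ≡⟨ cong₂ _+_ (cong (c +_) (suc*C i k)) (suc*C (suc i) k) ⟩
    (c + suc k * (k C i)) + suc k * (k C suc i)
      ≡⟨ +-assoc c _ _ ⟩
    c + (suc k * (k C i) + suc k * (k C suc i))
      ≡⟨ cong (c +_) (*-distribˡ-+ (suc k) (k C i) _) ⟨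
    c + suc k * ((k C i) + (k C suc i))
      ≡⟨ cong (λ x → c + suc k * x) (nCk+nC[k+1]≡[n+1]C[k+1] k i) ⟩
    (2 + k) * c ∎
    where
    open ≡-Reasoning
    c = suc k C suc i

  k!*C≡P : ∀ n k → k ! * (n C k) ≡ n P k
  k!*C≡P n k with k ≤? n
  ... | no k≰n = trans (cong (k ! *_) (k>n⇒nCk≡0 (≰⇒> k≰n))) (trans (*-zeroʳ (k !)) (sym (k>n⇒nPk≡0 (≰⇒> k≰n))))
  ... | yes k≤n = trans (cong (k ! *_) (nCk≡nPk/k! k≤n)) (m*[n/m]≡n
    (subst (k ! ∣_) (sym (nPk≡n!/[n∸k]! k≤n)) (m*n∣o⇒n∣o/m ((n ∸ k) !) (k !) ([n∸k]!k!∣n! k≤n))))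
    where instance
      _ = k !≢0
      _ = (n ∸ k) !≢0

  P≡P′ : ∀ {n k} → k ≤ n → n P k ≡ n P′ k
  P≡P′ {n} {k} k≤n with k ≤ᵇ n | ≤⇒≤ᵇ k≤n
  ... | true | _ = refl

  P′≤^ : ∀ n k → n P′ k ≤ n ^ k
  P′≤^ n zero    = ≤-refl
  P′≤^ n (suc k) = *-mono-≤ (m∸n≤m n k) (P′≤^ n k)

  -- The falling factorial differs from the power only in lower order. The square is a crude
  -- constant that survives the induction, as k + k² ≤ (k + 1)². Truncated subtraction is harmless
  -- because n ≤ (n ∸ k) + k always holds.
  ^≤P′ : ∀ n i → n ^ suc i ≤ n P′ suc i + suc i * suc i * n ^ i
  ^≤P′ n zero    = m≤m+n _ _
  ^≤P′ n (suc i) = begin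
    n * n ^ suc i
      ≤⟨ *-monoʳ-≤ n (^≤P′ n i) ⟩
    n * (p + k * k * n ^ i)
      ≤⟨ ≤-reflexive (rearr n p k (n ^ i)) ⟩
    n * p + k * k * (n * n ^ i)
      ≤⟨ +-monoˡ-≤ _ (*-monoˡ-≤ p (≤-trans (m≤n+m∸n n k) (≤-reflexive (+-comm k _)))) ⟩
    ((n ∸ k) + k) * p + k * k * n ^ suc i
      ≡⟨ rearr₂ (n ∸ k) k p (n ^ suc i) ⟩
    (n ∸ k) * p + (k * p + k * k * n ^ suc i)
      ≤⟨ +-monoʳ-≤ ((n ∸ k) * p) (+-monoˡ-≤ _ (*-monoʳ-≤ k (P′≤^ n k))) ⟩
    (n ∸ k) * p + (k * n ^ suc i + k * k * n ^ suc i)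
      ≤⟨ +-monoʳ-≤ ((n ∸ k) * p) (≤-trans (m≤m+n _ (suc k * n ^ suc i)) (≤-reflexive (rearr₃ k (n ^ suc i)))) ⟩
    (n ∸ k) * p + suc k * suc k * n ^ suc i ∎
    where
    open ≤-Reasoning
    k = suc i
    p = n P′ k
    rearr : ∀ n p k a → n * (p + k * k * a) ≡ n * p + k * k * (n * a)
    rearr = solve-∀
    rearr₂ : ∀ d k p a → (d + k) * p + k * k * a ≡ d * p + (k * p + k * k * a)
    rearr₂ = solve-∀
    rearr₃ : ∀ k a → k * a + k * k * a + suc k * a ≡ suc k * suc k * a
    rearr₃ = solve-∀

  ^-* : ∀ a b r → (a * b) ^ r ≡ a ^ r * b ^ r
  ^-* a b zero    = refl
  ^-* a b (suc r) = trans (cong (a * b *_) (^-* a b r)) (rearr a b _ _)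
    where
    rearr : ∀ a b c d → a * b * (c * d) ≡ a * c * (b * d)
    rearr = solve-∀

  -- The induction step of Maclaurin's inequality: with a and b proportional to
  -- the mean of the old and of all values, it is the tangent line inequality.
  maclaurin-step : ∀ i k e e′ x s β → let a = suc k * s; b = k * (x + s) in
    k ^ suc i * e ≤ (k C suc i) * s ^ suc i →
    k ^ i * e′ ≤ (k C i) * s ^ i →
    suc i * a ^ i * b + β ≤ b ^ suc i + i * a ^ suc i →
    k ^ suc i * suc k ^ suc i * (e + x * e′) + (suc k C suc i) * β ≤ (suc k C suc i) * b ^ suc i
  maclaurin-step i k e e′ x s β e≤ e′≤ bern =
    -- After multiplication by `r`, Pascal's rule and `suc*C` turn every binomial coefficient into
    -- `suc k * q`, and the tangent inequality `bern`, with its defect `β`, applies once as a whole.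
    *-cancelˡ-≤ r (+-cancelʳ-≤ (suc k * q * (r * (a * aⁱ))) _ _ (begin
      r * (k * kⁱ * (suc k * mⁱ) * (e + x * e′) + c * β) + suc k * q * (r * (a * aⁱ))
        ≡⟨ rearr₁ r k kⁱ mⁱ e x e′ c β q (a * aⁱ) ⟩
      r * (suc k * mⁱ * (k * kⁱ * e) + k * (suc k * mⁱ) * x * (kⁱ * e′)) + (r * c * β + suc k * q * (r * (a * aⁱ)))
        ≤⟨ +-monoˡ-≤ _ (*-monoʳ-≤ r (+-mono-≤ (*-monoʳ-≤ (suc k * mⁱ) e≤) (*-monoʳ-≤ (k * (suc k * mⁱ) * x) e′≤))) ⟩
      r * (suc k * mⁱ * ((k C r) * (s * sⁱ)) + k * (suc k * mⁱ) * x * (q * sⁱ)) + (r * c * β + suc k * q * (r * (a * aⁱ)))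
        ≡⟨ rearr₂ r k mⁱ (k C r) s sⁱ x q (r * c * β) (aⁱ) (^-* (suc k) s i) ⟩
      (r * (k C r) + r * q) * (a * aⁱ) + suc k * q * (r * aⁱ * b) + r * c * β
        ≡⟨ cong₂ (λ u v → u * (a * aⁱ) + suc k * q * (r * aⁱ * b) + v * β) pascal (suc*C i k) ⟩
      suc k * q * (a * aⁱ) + suc k * q * (r * aⁱ * b) + suc k * q * β
        ≡⟨ rearr₃ (suc k * q) (a * aⁱ) (r * aⁱ * b) β ⟩
      suc k * q * (a * aⁱ + (r * aⁱ * b + β))
        ≤⟨ *-monoʳ-≤ (suc k * q) (+-monoʳ-≤ (a * aⁱ) bern) ⟩
      suc k * q * (a * aⁱ + (b ^ r + i * (a * aⁱ)))
        ≡⟨ rearr₄ (suc k * q) (a * aⁱ) (b ^ r) i ⟩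
      suc k * q * b ^ r + suc k * q * (r * (a * aⁱ))
        ≡⟨ cong (λ u → u * b ^ r + suc k * q * (r * (a * aⁱ))) (suc*C i k) ⟨
      r * c * b ^ r + suc k * q * (r * (a * aⁱ))
        ≡⟨ cong (_+ suc k * q * (r * (a * aⁱ))) (*-assoc r c _) ⟩
      r * (c * b ^ r) + suc k * q * (r * (a * aⁱ)) ∎))
    where
    open ≤-Reasoning
    r = suc i
    a = suc k * s
    b = k * (x + s)
    q = k C i
    c = suc k C suc i
    kⁱ = k ^ i
    mⁱ = suc k ^ i
    sⁱ = s ^ i
    aⁱ = a ^ i
    pascal : r * (k C r) + r * q ≡ suc k * q
    pascal = trans (sym (*-distribˡ-+ r (k C r) q)) (trans (cong (r *_)
      (trans (+-comm (k C r) q) (nCk+nC[k+1]≡[n+1]C[k+1] k i))) (suc*C i k))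
    rearr₁ : ∀ r k kⁱ mⁱ e x e′ c β q p → r * (k * kⁱ * (suc k * mⁱ) * (e + x * e′) + c * β) + suc k * q * (r * p)
      ≡ r * (suc k * mⁱ * (k * kⁱ * e) + k * (suc k * mⁱ) * x * (kⁱ * e′)) + (r * c * β + suc k * q * (r * p))
    rearr₁ = solve-∀
    rearr₂ : ∀ r k mⁱ c′ s sⁱ x q z aⁱ → aⁱ ≡ mⁱ * sⁱ →
      r * (suc k * mⁱ * (c′ * (s * sⁱ)) + k * (suc k * mⁱ) * x * (q * sⁱ)) + (z + suc k * q * (r * (suc k * s * aⁱ)))
      ≡ (r * c′ + r * q) * (suc k * s * aⁱ) + suc k * q * (r * aⁱ * (k * (x + s))) + z
    rearr₂ r k mⁱ c′ s sⁱ x q z _ refl = lemma r k mⁱ c′ s sⁱ x q z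
      where
      lemma : ∀ r k mⁱ c′ s sⁱ x q z →
        r * (suc k * mⁱ * (c′ * (s * sⁱ)) + k * (suc k * mⁱ) * x * (q * sⁱ)) + (z + suc k * q * (r * (suc k * s * (mⁱ * sⁱ))))
        ≡ (r * c′ + r * q) * (suc k * s * (mⁱ * sⁱ)) + suc k * q * (r * (mⁱ * sⁱ) * (k * (x + s))) + z
      lemma = solve-∀
    rearr₃ : ∀ q p t β → q * p + q * t + q * β ≡ q * (p + (t + β))
    rearr₃ = solve-∀
    rearr₄ : ∀ q p b i → q * (p + (b + i * p)) ≡ q * b + q * (suc i * p)
    rearr₄ = solve-∀

  -- Induction on the number of variables for all degrees at once. One variable is a separate case,
  -- because the step cancels a power of the number of remaining variables, which would be 0.
  maclaurin : ∀ r m (w : Fin m → ℕ) → m ^ r * E r w ≤ (m C r) * sum w ^ r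
  maclaurin zero          m             w = ≤-refl
  maclaurin (suc i)       zero          w = z≤n
  maclaurin (suc zero)    (suc zero)    w = ≤-reflexive (trans (+-identityʳ _) (rearr (w zero)))
    where
    rearr : ∀ x → x * 1 ≡ (x + 0) * 1 + 0
    rearr = solve-∀
  maclaurin (suc (suc i)) (suc zero)    w = ≤-trans (≤-reflexive (trans (cong (1 ^ (2 + i) *_) (*-zeroʳ (w zero))) (*-zeroʳ (1 ^ (2 + i))))) z≤n
  maclaurin (suc i)       (suc (suc k)) w = *-cancelˡ-≤ (suc k ^ suc i) {{m^n≢0 (suc k) (suc i)}} (begin
    K * (M * E (suc i) w)              ≡⟨ *-assoc K M _ ⟨
    K * M * (E (suc i) w)              ≡⟨ +-identityʳ _ ⟨
    K * M * E (suc i) w + 0            ≡⟨ cong (K * M * E (suc i) w +_) (*-zeroʳ c) ⟨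
    K * M * E (suc i) w + c * 0        ≤⟨ maclaurin-step i (suc k) (E (suc i) w′) (E i w′) x s 0
                                           (maclaurin (suc i) (suc k) w′) (maclaurin i (suc k) w′)
                                           (≤-trans (≤-reflexive (+-identityʳ _)) (bernoulli₀ i _ _)) ⟩
    c * (suc k * (x + s)) ^ suc i      ≡⟨ cong (c *_) (^-* (suc k) (x + s) (suc i)) ⟩
    c * (K * (x + s) ^ suc i)          ≡⟨ rearr c K _ ⟩
    K * (c * (x + s) ^ suc i)          ∎)
    where
    open ≤-Reasoning
    w′ = w ∘ suc
    x = w zero
    s = sum w′
    c = (2 + k) C suc i
    K = suc k ^ suc i
    M = (2 + k) ^ suc i
    rearr : ∀ a b c → a * (b * c) ≡ b * (a * c)
    rearr = solve-∀

-- Stability in Maclaurin's inequality, and bounds for links.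

module NearUniformity where
  open Polynomials
  open Maclaurin
  open import Data.Fin.Base using (Fin; suc; punchIn)
  open import Data.Fin.Properties using (punchInᵢ≢i)
  open import Data.Fin.Subset using (Subset; _∈_; _∉_; ∣_∣)
  open import Data.Fin.Subset.Properties using (_∈?_)
  open import Data.Nat.Base
  open import Data.Nat.Combinatorics using (_C_)
  open import Data.Nat.Properties
  open import Data.Nat.Tactic.RingSolver using (solve-∀)
  open import Data.Vec.Properties using ([]≔-updates)
  open import Data.Vec.Functional using (updateAt)
  open import Data.Vec.Functional.Properties using (updateAt-id-local; updateAt-minimal; updateAt-updates)
  open import Function.Base using (_∘_; const; it)
  open import Relation.Binary.PropositionalEquality hiding (J)
  open import Relation.Nullary using (yes; no)
  open import Algebra.Properties.CommutativeMonoid.Sum +-0-commutativeMonoid using (sum; sum-remove)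

  -- Maclaurin's inequality with the defect from separating the variable `t`. Since m s - k n = n -
  -- m w_t, the squared distance is m² times the squared deviation of w_t from the mean n/m.
  E-punchIn-≤ : ∀ κ ρ (w : Fin (2 + κ) → ℕ) t → let m = 2 + κ; k = 1 + κ; r = 2 + ρ; n = sum w; s = sum (w ∘ punchIn t)
    in k ^ r * m ^ r * E r w + (m C r) * (∣ m * s - k * n ∣ * ∣ m * s - k * n ∣ * (k * n) ^ ρ) ≤ (m C r) * (k * n) ^ r
  E-punchIn-≤ κ ρ w t = subst₂
    (λ n e → k ^ r * m ^ r * e + (m C r) * (∣ m * s - k * n ∣ * ∣ m * s - k * n ∣ * (k * n) ^ ρ) ≤ (m C r) * (k * n) ^ r)
    (sym (sum-remove w)) (sym (E-punchIn (suc ρ) w t))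
    (maclaurin-step (suc ρ) k (E r w′) (E (suc ρ) w′) (w t) s _
      (maclaurin r k w′) (maclaurin (suc ρ) k w′) (bernoulli ρ (m * s) (k * (w t + s))))
    where
    m = 2 + κ
    k = 1 + κ
    r = 2 + ρ
    w′ = w ∘ punchIn t
    s = sum w′

  ≡+∣-∣ : ∀ a b → b ≤ a → a ≡ b + ∣ a - b ∣
  ≡+∣-∣ a b b≤a = sym (trans (cong (b +_) (m≤n⇒∣n-m∣≡n∸m b≤a)) (m+[n∸m]≡n b≤a))

  -- The conclusion reads w_t ≥ (1 - 1/R) n/m. Otherwise the deviation exceeds n/R, and its defect
  -- puts `E r w` below the maximum by at least the fraction 1/(R² k²). The precision 1/J is finer
  -- than that by the factor `X`, and X ≥ 2 makes the contradiction strict.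
  near-uniform : ∀ κ ρ R X p (w : Fin (2 + κ) → ℕ) t → let m = 2 + κ; k = 1 + κ; r = 2 + ρ; n = sum w; J = R * R * (k * k) * X in
    1 ≤ n → 1 ≤ m C r → 2 ≤ X → p ≤ E r w →
    J * ((m C r) * n ^ r) ≤ J * (m ^ r * p) + n ^ r →
    R * (m * sum (w ∘ punchIn t)) ≤ R * (k * n) + n
  near-uniform κ ρ R X p w t 1≤n 1≤c 2≤X p≤E J≤ = ≮⇒≥ λ far →
    let B<A : R * B < R * A
        B<A = ≤-<-trans (m≤m+n _ _) far
        B≤A : B ≤ A
        B≤A = <⇒≤ (*-cancelˡ-< R B A B<A)
        RD≥n : n ≤ R * D
        RD≥n = +-cancelˡ-≤ (R * B) n (R * D) (≤-trans (<⇒≤ far) (≤-reflexive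
                 (trans (cong (R *_) (≡+∣-∣ A B B≤A)) (*-distribˡ-+ R B D))))
        gap : R * R * (k * k) * (M * E r w) + c * n ^ r ≤ R * R * (k * k) * (c * n ^ r)
        gap = *-cancelˡ-≤ (k ^ ρ) {{m^n≢0 k ρ}} (begin
          k ^ ρ * (R * R * (k * k) * (M * E r w) + c * n ^ r)
            ≡⟨ rearr₁ (k ^ ρ) R k M (E r w) c n (n ^ ρ) ⟩
          R * R * (k ^ r * M * E r w) + c * (n * n * (k ^ ρ * n ^ ρ))
            ≤⟨ +-monoʳ-≤ (R * R * (k ^ r * M * E r w)) (*-monoʳ-≤ c (*-monoˡ-≤ (k ^ ρ * n ^ ρ) (*-mono-≤ RD≥n RD≥n))) ⟩
          R * R * (k ^ r * M * E r w) + c * (R * D * (R * D) * (k ^ ρ * n ^ ρ))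
            ≡⟨ cong (λ x → R * R * (k ^ r * M * E r w) + c * (R * D * (R * D) * x)) (^-* k n ρ) ⟨
          R * R * (k ^ r * M * E r w) + c * (R * D * (R * D) * (k * n) ^ ρ)
            ≡⟨ rearr₂ R (k ^ r * M * E r w) c D ((k * n) ^ ρ) ⟩
          R * R * (k ^ r * M * E r w + c * (D * D * (k * n) ^ ρ))
            ≤⟨ *-monoʳ-≤ (R * R) (E-punchIn-≤ κ ρ w t) ⟩
          R * R * (c * (k * n) ^ r)
            ≡⟨ cong (λ x → R * R * (c * x)) (^-* k n r) ⟩
          R * R * (c * (k ^ r * n ^ r))
            ≡⟨ rearr₃ R c (k ^ ρ) k (n ^ r) ⟩
          k ^ ρ * (R * R * (k * k) * (c * n ^ r)) ∎)
        2c≤ : J * (M * E r w) + 2 * (c * n ^ r) ≤ J * (M * E r w) + n ^ r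
        2c≤ = begin
          J * (M * E r w) + 2 * (c * n ^ r)
            ≤⟨ +-monoʳ-≤ (J * (M * E r w)) (*-monoˡ-≤ (c * n ^ r) 2≤X) ⟩
          J * (M * E r w) + X * (c * n ^ r)
            ≡⟨ rearr₄ (R * R * (k * k)) X (M * E r w) (c * n ^ r) ⟩
          X * (R * R * (k * k) * (M * E r w) + c * n ^ r)
            ≤⟨ *-monoʳ-≤ X gap ⟩
          X * (R * R * (k * k) * (c * n ^ r))
            ≡⟨ rearr₅ X (R * R * (k * k)) (c * n ^ r) ⟩
          J * (c * n ^ r)
            ≤⟨ J≤ ⟩
          J * (M * p) + n ^ r
            ≤⟨ +-monoˡ-≤ (n ^ r) (*-monoʳ-≤ J (*-monoʳ-≤ M p≤E)) ⟩
          J * (M * E r w) + n ^ r ∎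
        0<nʳ : 0 < n ^ r
        0<nʳ = m^n>0 n {{>-nonZero 1≤n}} r
    in <⇒≱ (begin-strict
         n ^ r           <⟨ m<m+n (n ^ r) 0<nʳ ⟩
         n ^ r + n ^ r   ≡⟨ cong (n ^ r +_) (+-identityʳ _) ⟨
         2 * n ^ r       ≤⟨ *-monoʳ-≤ 2 (m≤n*m (n ^ r) c {{>-nonZero 1≤c}}) ⟩
         2 * (c * n ^ r) ∎)
       (+-cancelˡ-≤ (J * (M * E r w)) _ _ 2c≤)
    where
    open ≤-Reasoning
    m = 2 + κ
    k = 1 + κ
    r = 2 + ρ
    n = sum w
    J = R * R * (k * k) * X
    c = m C r
    M = m ^ r
    A = m * sum (w ∘ punchIn t)
    B = k * n
    D = ∣ A - B ∣
    rearr₁ : ∀ q R k M e c n p → q * (R * R * (k * k) * (M * e) + c * (n * (n * p)))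
      ≡ R * R * (k * (k * q) * M * e) + c * (n * n * (q * p))
    rearr₁ = solve-∀
    rearr₂ : ∀ R e c D p → R * R * e + c * (R * D * (R * D) * p) ≡ R * R * (e + c * (D * D * p))
    rearr₂ = solve-∀
    rearr₃ : ∀ R c q k n → R * R * (c * (k * (k * q) * n)) ≡ q * (R * R * (k * k) * (c * n))
    rearr₃ = solve-∀
    rearr₄ : ∀ a X e c → a * X * e + X * c ≡ X * (a * e + c)
    rearr₄ = solve-∀
    rearr₅ : ∀ X a c → X * (a * c) ≡ a * X * c
    rearr₅ = solve-∀

  weight-≥ : ∀ k R {n x s} → n ≡ x + s → R * (suc k * s) ≤ R * (k * n) + n → 2 ≤ R → n ≤ 2 * suc k * x
  weight-≥ k (suc (suc R)) {x = x} {s} refl near (s≤s (s≤s z≤n)) = *-cancelˡ-≤ (1 + R) (begin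
    (1 + R) * n                     ≤⟨ +-cancelˡ-≤ ((2 + R) * (k * n) + n) _ _ (begin
      (2 + R) * (k * n) + n + (1 + R) * n                    ≡⟨ rearr₁ R k x s ⟩
      (2 + R) * (suc k * s) + (2 + R) * (suc k * x)          ≤⟨ +-monoˡ-≤ _ near ⟩
      (2 + R) * (k * n) + n + (2 + R) * (suc k * x)          ∎) ⟩
    (2 + R) * (suc k * x)           ≤⟨ m≤m+n _ (R * (suc k * x)) ⟩
    (2 + R) * (suc k * x) + R * (suc k * x) ≡⟨ rearr₂ R k x ⟩
    (1 + R) * (2 * suc k * x)       ∎)
    where
    open ≤-Reasoning
    n = x + s
    rearr₁ : ∀ R k x s → (2 + R) * (k * (x + s)) + (x + s) + (1 + R) * (x + s) ≡ (2 + R) * (suc k * s) + (2 + R) * (suc k * x)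
    rearr₁ = solve-∀
    rearr₂ : ∀ R k x → (2 + R) * (suc k * x) + R * (suc k * x) ≡ (1 + R) * (2 * suc k * x)
    rearr₂ = solve-∀

  -- Near uniformity bounds the weight outside `t` by kn/m plus a small error, and Maclaurin's
  -- inequality on the other k variables bounds `E j`. The error passes through x ↦ q x^j on an
  -- interval up to m n, whose slope there is q j (m n)^ρ; `W` is that slope without the power of n,
  -- so an error of 1/(R W) ends as 1/R.
  E-punchIn-bound : ∀ κ ρ R (w : Fin (2 + κ) → ℕ) t →
    let m = 2 + κ; k = 1 + κ; j = suc ρ; n = sum w; W = (k C j) * j * m ^ ρ in .{{_ : NonZero W}} →
    R * W * (m * sum (w ∘ punchIn t)) ≤ R * W * (k * n) + n →
    R * (m ^ j * E j (w ∘ punchIn t)) ≤ (R * (k C j) + 1) * n ^ j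
  E-punchIn-bound κ ρ R w t near = *-cancelˡ-≤ (W * k ^ j) {{m*n≢0 W (k ^ j) {{it}} {{m^n≢0 k j}}}} (begin
    W * k ^ j * (R * (m ^ j * e))
      ≡⟨ rearr₁ W (k ^ j) R (m ^ j) e ⟩
    R * W * (m ^ j) * (k ^ j * e)
      ≤⟨ *-monoʳ-≤ (R * W * m ^ j) (maclaurin j k (w ∘ punchIn t)) ⟩
    R * W * m ^ j * (q * s ^ j)
      ≡⟨ rearr₂ (R * W) (m ^ j) q (s ^ j) ⟩
    q * (R * W * (m ^ j * s ^ j))
      ≡⟨ cong (λ x → q * (R * W * x)) (^-* m s j) ⟨
    q * (R * W * (A * A ^ ρ))
      ≤⟨ *-monoʳ-≤ q tangent ⟩
    q * (R * W * B ^ j + j * A ^ ρ * n)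
      ≤⟨ *-monoʳ-≤ q (+-monoʳ-≤ (R * W * B ^ j) (*-monoˡ-≤ n (*-monoʳ-≤ j (^-monoˡ-≤ ρ (*-monoʳ-≤ m s≤n))))) ⟩
    q * (R * W * B ^ j + j * (m * n) ^ ρ * n)
      ≡⟨ cong₂ (λ x y → q * (R * W * x + j * y * n)) (^-* k n j) (^-* m n ρ) ⟩
    q * (R * W * (k ^ j * n ^ j) + j * (m ^ ρ * n ^ ρ) * n)
      ≡⟨ rearr₃ q R j (m ^ ρ) (k ^ j) n (n ^ ρ) ⟩
    W * (R * q * k ^ j * n ^ j) + W * n ^ j
      ≤⟨ +-monoʳ-≤ (W * (R * q * k ^ j * n ^ j)) (m≤m*n (W * n ^ j) (k ^ j) {{m^n≢0 k j}}) ⟩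
    W * (R * q * k ^ j * n ^ j) + W * n ^ j * k ^ j
      ≡⟨ rearr₄ W (R * q) (k ^ j) (n ^ j) ⟩
    W * k ^ j * ((R * q + 1) * n ^ j) ∎)
    where
    open ≤-Reasoning
    m = 2 + κ
    k = 1 + κ
    j = suc ρ
    n = sum w
    s = sum (w ∘ punchIn t)
    q = k C j
    W = q * j * m ^ ρ
    A = m * s
    B = k * n
    s≤n : s ≤ n
    s≤n = ≤-trans (m≤n+m s (w t)) (≤-reflexive (sym (sum-remove w)))
    -- The tangent at A gives A^j - B^j ≤ j A^ρ (A - B), and R W (A - B) ≤ n is the hypothesis
    -- `near`.
    tangent : R * W * (A * A ^ ρ) ≤ R * W * B ^ j + j * A ^ ρ * n
    tangent = +-cancelʳ-≤ (R * W * (ρ * A ^ j)) _ _ (begin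
      R * W * (A * A ^ ρ) + R * W * (ρ * A ^ j)
        ≡⟨ rearr₅ (R * W) A (A ^ ρ) ρ ⟩
      j * A ^ ρ * (R * W * A)
        ≤⟨ *-monoʳ-≤ (j * A ^ ρ) near ⟩
      j * A ^ ρ * (R * W * B + n)
        ≡⟨ rearr₆ (j * A ^ ρ) (R * W) B n ⟩
      R * W * (j * A ^ ρ * B) + j * A ^ ρ * n
        ≤⟨ +-monoˡ-≤ _ (*-monoʳ-≤ (R * W) (bernoulli₀ ρ A B)) ⟩
      R * W * (B ^ j + ρ * A ^ j) + j * A ^ ρ * n
        ≡⟨ rearr₇ (R * W) (B ^ j) (ρ * A ^ j) (j * A ^ ρ * n) ⟩
      R * W * B ^ j + j * A ^ ρ * n + R * W * (ρ * A ^ j) ∎)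
      where
      rearr₅ : ∀ R A p ρ → R * (A * p) + R * (ρ * (A * p)) ≡ suc ρ * p * (R * A)
      rearr₅ = solve-∀
      rearr₆ : ∀ p R B n → p * (R * B + n) ≡ R * (p * B) + p * n
      rearr₆ = solve-∀
      rearr₇ : ∀ R b a c → R * (b + a) + c ≡ R * b + c + R * a
      rearr₇ = solve-∀
    e = E j (w ∘ punchIn t)
    rearr₁ : ∀ W k R m e → W * k * (R * (m * e)) ≡ R * W * m * (k * e)
    rearr₁ = solve-∀
    rearr₂ : ∀ R m q s → R * m * (q * s) ≡ q * (R * (m * s))
    rearr₂ = solve-∀
    rearr₃ : ∀ q R j mρ k n nρ → q * (R * (q * j * mρ) * (k * (n * nρ)) + j * (mρ * nρ) * n)
      ≡ q * j * mρ * (R * q * k * (n * nρ)) + q * j * mρ * (n * nρ)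
    rearr₃ = solve-∀
    rearr₄ : ∀ W R k n → W * (R * k * n) + W * n * k ≡ W * k * ((R + 1) * n)
    rearr₄ = solve-∀

  module _ {m ρ} (h : Subset (suc m) → ℕ) (w : Fin (suc m) → ℕ) t
           (h≤χ : ∀ e → h e ≤ χ (suc ρ) e) (h-t : ∀ e → t ∈ e → h e ≡ 0) where
    private
      w₀ : Fin (suc m) → ℕ
      w₀ = updateAt w t (const 0)

      poly-w₀ : poly h w ≡ poly h w₀
      poly-w₀ = trans (poly-cong {g = h} (λ _ → refl) (λ i → sym (updateAt-id-local t w refl i)))
        (trans (poly-updateAt t h w (w t))
          (trans (cong (λ x → poly h w₀ + w t * x) (poly-zero (∂ t h) w ∂≡0))
            (trans (cong (poly h w₀ +_) (*-zeroʳ (w t))) (+-identityʳ _))))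
        where
        ∂≡0 : ∀ e → ∂ t h e ≡ 0
        ∂≡0 e with t ∈? e
        ... | yes t∈e = ∂-∈ h t∈e
        ... | no t∉e  = trans (∂-∉ t h t∉e) (h-t _ ([]≔-updates e t))

      E-w₀ : E (suc ρ) w₀ ≡ E (suc ρ) (w ∘ punchIn t)
      E-w₀ = trans (E-punchIn ρ w₀ t)
        (trans (cong₂ (λ a b → a + b * E ρ (w₀ ∘ punchIn t))
                 (E-cong (suc ρ) (λ i → updateAt-minimal (punchIn t i) t w (punchInᵢ≢i t i)))
                 (updateAt-updates t w))
          (+-identityʳ _))

    -- No monomial of `h` contains `t`, so the weight of `t` may be replaced by 0 on the left. With
    -- that weight 0, `E` over all variables is `E` over those other than `t`.
    link-≤E : poly h w ≤ E (suc ρ) (w ∘ punchIn t)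
    link-≤E = subst₂ _≤_ (sym poly-w₀) E-w₀ (poly≤E (suc ρ) w₀ h≤χ)

    link+δ≤E : ∀ e₀ → ∣ e₀ ∣ ≡ suc ρ → t ∉ e₀ → h e₀ ≡ 0 →
               poly h w + poly (δ e₀) w₀ ≤ E (suc ρ) (w ∘ punchIn t)
    link+δ≤E e₀ size t∉e₀ he₀≡0 =
      subst₂ _≤_ (cong (_+ poly (δ e₀) w₀) (sym poly-w₀)) E-w₀ (poly+δ≤E (suc ρ) w₀ e₀ h≤χ he₀≡0 size)

    -- The loss caused by a link set that is missing although it avoids `t`: its monomial is at
    -- least (b/k)^j, where j = ρ + 1.
    link+^≤E : ∀ k b e₀ → (∀ i → b ≤ k * w i) → ∣ e₀ ∣ ≡ suc ρ → t ∉ e₀ → h e₀ ≡ 0 →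
               k ^ suc ρ * poly h w + b ^ suc ρ ≤ k ^ suc ρ * E (suc ρ) (w ∘ punchIn t)
    link+^≤E k b e₀ b≤ size t∉e₀ he₀≡0 = begin
      k ^ suc ρ * poly h w + b ^ suc ρ                        ≤⟨ +-monoʳ-≤ _ (subst (λ x → b ^ x ≤ k ^ x * poly (δ e₀) w₀) size (poly-δ-≥ e₀ w₀ k b b≤w₀)) ⟩
      k ^ suc ρ * poly h w + k ^ suc ρ * poly (δ e₀) w₀       ≡⟨ *-distribˡ-+ (k ^ suc ρ) (poly h w) _ ⟨
      k ^ suc ρ * (poly h w + poly (δ e₀) w₀)                 ≤⟨ *-monoʳ-≤ (k ^ suc ρ) (link+δ≤E e₀ size t∉e₀ he₀≡0) ⟩
      k ^ suc ρ * E (suc ρ) (w ∘ punchIn t)                   ∎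
      where
      open ≤-Reasoning
      b≤w₀ : ∀ {i} → i ∈ e₀ → b ≤ k * w₀ i
      b≤w₀ {i} i∈e₀ = ≤-trans (b≤ i) (≤-reflexive (cong (k *_)
        (sym (updateAt-minimal i t w (λ { refl → t∉e₀ i∈e₀ })))))

-- Restriction to vertex subsets, and shifting weight between uncovered vertices.

module Symmetrization where
  open Polynomials
  open import Data.Empty using (⊥-elim)
  open import Data.Product.Base using (_×_; _,_; ∃-syntax; Σ-syntax)
  open import Data.Sum.Base using (_⊎_; inj₁; inj₂)
  open import Data.Fin.Base using (Fin; zero; suc)
  import Data.Fin.Properties as Fin
  open import Data.Fin.Subset using (Subset; inside; outside; _∈_; _∉_; ∣_∣; _-_; ⁅_⁆; _∪_; ⊤)
  open import Data.Fin.Subset.Properties using (_∈?_; ∣p∣≤n; ∈⊤; x∈p⇒∣p-x∣<∣p∣; x∈p∧x≢y⇒x∈p-y; x∈p∪q⁻; x∈p∪q⁺; x∈⁅x⁆; x∈⁅y⁆⇒x≡y; ∉⊥; ⊆-antisym; ∪-identityˡ; ∣⊥∣≡0)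
  open import Data.Nat.Base
  open import Data.Nat.Properties
  open import Data.Nat.Tactic.RingSolver using (solve-∀)
  open import Data.Vec.Base as Vec using ([]; _∷_; _[_]≔_)
  open import Data.Vec.Properties using ([]≔-updates; []≔-minimal)
  open import Data.Vec.Functional using (updateAt)
  open import Data.Vec.Functional.Properties using (updateAt-id-local; updateAt-minimal; updateAt-updates; updateAt-commutes)
  open import Function.Base using (_∘_; const)
  open import Function.Definitions using (Injective)
  open import Relation.Binary.PropositionalEquality hiding (J)
  open import Relation.Nullary using (¬_; Dec; yes; no; contradiction)
  open import Relation.Nullary.Decidable using (_×-dec_; ¬?; decidable-stable)
  open import Algebra.Properties.CommutativeMonoid.Sum +-0-commutativeMonoid using (sum)

  -- The increasing enumeration of `U`; `embed U` is its action on sets, as `embed≡image` states.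
  ι : ∀ {n} (U : Subset n) → Fin ∣ U ∣ → Fin n
  ι (outside ∷ U) i       = suc (ι U i)
  ι (inside ∷ U)  zero    = zero
  ι (inside ∷ U)  (suc i) = suc (ι U i)

  ι-∈ : ∀ {n} (U : Subset n) i → ι U i ∈ U
  ι-∈ (outside ∷ U) i       = Vec.there (ι-∈ U i)
  ι-∈ (inside ∷ U)  zero    = Vec.here
  ι-∈ (inside ∷ U)  (suc i) = Vec.there (ι-∈ U i)

  ι-injective : ∀ {n} (U : Subset n) → Injective _≡_ _≡_ (ι U)
  ι-injective (outside ∷ U) {i}     {j}     eq = ι-injective U (Fin.suc-injective eq)
  ι-injective (inside ∷ U)  {zero}  {zero}  eq = refl
  ι-injective (inside ∷ U)  {suc i} {suc j} eq = cong suc (ι-injective U (Fin.suc-injective eq))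

  ι-surjective : ∀ {n} (U : Subset n) {v} → v ∈ U → ∃[ i ] ι U i ≡ v
  ι-surjective (inside ∷ U)  Vec.here        = zero , refl
  ι-surjective (outside ∷ U) (Vec.there v∈U) = let i , eq = ι-surjective U v∈U in i , cong suc eq
  ι-surjective (inside ∷ U)  (Vec.there v∈U) = let i , eq = ι-surjective U v∈U in suc i , cong suc eq

  ∈-image⁺ : ∀ {k n} (f : Fin k → Fin n) {e i} → i ∈ e → f i ∈ image f e
  ∈-image⁺ f {inside ∷ e}  Vec.here        = x∈p∪q⁺ (inj₁ (x∈⁅x⁆ _))
  ∈-image⁺ f {outside ∷ e} (Vec.there i∈e) = ∈-image⁺ (f ∘ suc) i∈e
  ∈-image⁺ f {inside ∷ e}  (Vec.there i∈e) = x∈p∪q⁺ (inj₂ (∈-image⁺ (f ∘ suc) i∈e))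

  ∈-image⁻ : ∀ {k n} (f : Fin k → Fin n) e {v} → v ∈ image f e → ∃[ i ] i ∈ e × f i ≡ v
  ∈-image⁻ f []            v∈ = ⊥-elim (∉⊥ v∈)
  ∈-image⁻ f (outside ∷ e) v∈ = let i , i∈e , eq = ∈-image⁻ (f ∘ suc) e v∈ in suc i , Vec.there i∈e , eq
  ∈-image⁻ f (inside ∷ e)  v∈ with x∈p∪q⁻ ⁅ f zero ⁆ _ v∈
  ... | inj₁ v∈₁ = zero , Vec.here , sym (x∈⁅y⁆⇒x≡y (f zero) v∈₁)
  ... | inj₂ v∈₂ = let i , i∈e , eq = ∈-image⁻ (f ∘ suc) e v∈₂ in suc i , Vec.there i∈e , eq

  ∣⁅x⁆∪p∣ : ∀ {n} x (p : Subset n) → x ∉ p → ∣ ⁅ x ⁆ ∪ p ∣ ≡ suc ∣ p ∣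
  ∣⁅x⁆∪p∣ zero    (inside ∷ p)  x∉p = contradiction Vec.here x∉p
  ∣⁅x⁆∪p∣ zero    (outside ∷ p) x∉p = cong (suc ∘ ∣_∣) (∪-identityˡ p)
  ∣⁅x⁆∪p∣ (suc x) (inside ∷ p)  x∉p = cong suc (∣⁅x⁆∪p∣ x p (x∉p ∘ Vec.there))
  ∣⁅x⁆∪p∣ (suc x) (outside ∷ p) x∉p = ∣⁅x⁆∪p∣ x p (x∉p ∘ Vec.there)

  ∣image∣ : ∀ {k n} {f : Fin k → Fin n} → Injective _≡_ _≡_ f → ∀ e → ∣ image f e ∣ ≡ ∣ e ∣
  ∣image∣ {n = n} inj [] = ∣⊥∣≡0 n
  ∣image∣ inj (outside ∷ e) = ∣image∣ (Fin.suc-injective ∘ inj) e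
  ∣image∣ {f = f} inj (inside ∷ e)  = trans
    (∣⁅x⁆∪p∣ (f zero) _ λ f0∈ → let i , _ , eq = ∈-image⁻ (f ∘ suc) e f0∈ in Fin.0≢1+n (sym (inj eq)))
    (cong suc (∣image∣ (Fin.suc-injective ∘ inj) e))

  image-cong : ∀ {k n} {f g : Fin k → Fin n} → f ≗ g → ∀ e → image f e ≡ image g e
  image-cong f≗g []            = refl
  image-cong f≗g (outside ∷ e) = image-cong (f≗g ∘ suc) e
  image-cong f≗g (inside ∷ e)  = cong₂ (λ x p → ⁅ x ⁆ ∪ p) (f≗g zero) (image-cong (f≗g ∘ suc) e)

  image-∘ : ∀ {j k n} (f : Fin k → Fin n) (g : Fin j → Fin k) e → image (f ∘ g) e ≡ image f (image g e)
  image-∘ f g e = ⊆-antisym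
    (λ v∈ → let i , i∈e , eq = ∈-image⁻ (f ∘ g) e v∈
            in subst (_∈ _) eq (∈-image⁺ f (∈-image⁺ g i∈e)))
    (λ v∈ → let j , j∈ , eq = ∈-image⁻ f (image g e) v∈
                i , i∈e , eq′ = ∈-image⁻ g e j∈
            in subst (_∈ _) (trans (cong f eq′) eq) (∈-image⁺ (f ∘ g) i∈e))

  embed-∈⁺ : ∀ {n} (U : Subset n) {e i} → i ∈ e → ι U i ∈ embed U e
  embed-∈⁺ (outside ∷ U) i∈e = Vec.there (embed-∈⁺ U i∈e)
  embed-∈⁺ (inside ∷ U)  {b ∷ e} Vec.here = Vec.here
  embed-∈⁺ (inside ∷ U)  {b ∷ e} (Vec.there i∈e) = Vec.there (embed-∈⁺ U i∈e)

  embed-∈⁻ : ∀ {n} (U : Subset n) e {v} → v ∈ embed U e → ∃[ i ] i ∈ e × ι U i ≡ v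
  embed-∈⁻ (outside ∷ U) e (Vec.there v∈) =
    let i , i∈e , eq = embed-∈⁻ U e v∈ in i , i∈e , cong suc eq
  embed-∈⁻ (inside ∷ U) (inside ∷ e) Vec.here = zero , Vec.here , refl
  embed-∈⁻ (inside ∷ U) (b ∷ e) (Vec.there v∈) =
    let i , i∈e , eq = embed-∈⁻ U e v∈ in suc i , Vec.there i∈e , cong suc eq

  embed≡image : ∀ {n} (U : Subset n) e → embed U e ≡ image (ι U) e
  embed≡image U e = ⊆-antisym
    (λ v∈ → let i , i∈e , eq = embed-∈⁻ U e v∈ in subst (_∈ _) eq (∈-image⁺ (ι U) i∈e))
    (λ v∈ → let i , i∈e , eq = ∈-image⁻ (ι U) e v∈ in subst (_∈ _) eq (embed-∈⁺ U i∈e))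

  poly-restrict : ∀ {n} (U : Subset n) g y → (∀ v → v ∉ U → y v ≡ 0) →
                  poly g y ≡ poly (g ∘ embed U) (y ∘ ι U)
  poly-restrict []            g y y≡0 = refl
  poly-restrict (outside ∷ U) g y y≡0 = trans
    (cong₂ (λ a b → a + b * poly (g ∘ (inside ∷_)) (y ∘ suc))
      (poly-restrict U (g ∘ (outside ∷_)) (y ∘ suc) (λ v v∉ → y≡0 (suc v) λ { (Vec.there v∈) → v∉ v∈ }))
      (y≡0 zero λ ()))
    (+-identityʳ _)
  poly-restrict (inside ∷ U)  g y y≡0 = cong₂ (λ a b → a + y zero * b)
    (poly-restrict U (g ∘ (outside ∷_)) (y ∘ suc) y≡0′)
    (poly-restrict U (g ∘ (inside ∷_)) (y ∘ suc) y≡0′)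
    where
    y≡0′ : ∀ v → v ∉ U → y (suc v) ≡ 0
    y≡0′ v v∉ = y≡0 (suc v) λ { (Vec.there v∈) → v∉ v∈ }

  sum-restrict : ∀ {n} (U : Subset n) y → (∀ v → v ∉ U → y v ≡ 0) → sum y ≡ sum (y ∘ ι U)
  sum-restrict []            y y≡0 = refl
  sum-restrict (outside ∷ U) y y≡0 = cong₂ _+_ (y≡0 zero λ ())
    (sum-restrict U (y ∘ suc) (λ v v∉ → y≡0 (suc v) λ { (Vec.there v∈) → v∉ v∈ }))
  sum-restrict (inside ∷ U)  y y≡0 = cong (y zero +_)
    (sum-restrict U (y ∘ suc) (λ v v∉ → y≡0 (suc v) λ { (Vec.there v∈) → v∉ v∈ }))

  shift : ∀ {n} → Fin n → Fin n → (Fin n → ℕ) → Fin n → ℕ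
  shift u v y = updateAt (updateAt y v (const 0)) u (const (y u + y v))

  sum-shift : ∀ {n} {u v : Fin n} y → u ≢ v → sum (shift u v y) ≡ sum y
  sum-shift {u = u} {v} y u≢v = +-cancelʳ-≡ (y u) _ _ (begin
    sum (shift u v y) + y u         ≡⟨ cong (sum (shift u v y) +_) (updateAt-minimal u v y u≢v) ⟨
    sum (shift u v y) + z u         ≡⟨ sum-updateAt u z (y u + y v) ⟩
    sum z + (y u + y v)             ≡⟨ cong (sum z +_) (+-comm (y u) (y v)) ⟩
    sum z + (y v + y u)             ≡⟨ +-assoc (sum z) (y v) (y u) ⟨
    sum z + y v + y u               ≡⟨ cong (_+ y u) (trans (sum-updateAt v y 0) (+-identityʳ _)) ⟩
    sum y + y u                     ∎)
    where
    open ≡-Reasoning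
    z = updateAt y v (const 0)

  -- A polynomial without monomials containing both u and v is affine in the
  -- pair (y u , y v), so one of the two shifts does not decrease it.
  module _ {n} {u v : Fin n} (g : Subset n → ℕ) (y : Fin n → ℕ) (u≢v : u ≢ v)
           (g≡0 : ∀ e → u ∈ e → v ∈ e → g e ≡ 0) where
    private
      set : ℕ → ℕ → Fin n → ℕ
      set a b = updateAt (updateAt y v (const b)) u (const a)

      a b c : ℕ
      a = poly g (set 0 0)
      b = poly (∂ u g) (updateAt y v (const 0))
      c = poly (∂ v g) (updateAt y u (const 0))

      ∂∂≡0 : ∀ e → ∂ v (∂ u g) e ≡ 0
      ∂∂≡0 e with v ∈? e
      ... | yes v∈e = ∂-∈ (∂ u g) v∈e
      ... | no v∉e with u ∈? (e [ v ]≔ inside)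
      ...   | yes u∈ = trans (∂-∉ v (∂ u g) v∉e) (∂-∈ g u∈)
      ...   | no u∉  = trans (∂-∉ v (∂ u g) v∉e) (trans (∂-∉ u g u∉) (g≡0 _
        ([]≔-updates (e [ v ]≔ inside) u)
        ([]≔-minimal (e [ v ]≔ inside) v u (u≢v ∘ sym) ([]≔-updates e v))))

      affine : ∀ p q → poly g (set p q) ≡ a + q * c + p * b
      affine p q = trans (poly-updateAt u g (updateAt y v (const q)) p) (cong₂ (λ s t → s + p * t) set-0 ∂-set)
        where
        open ≡-Reasoning
        set-0 : poly g (set 0 q) ≡ a + q * c
        set-0 = begin
          poly g (set 0 q)
            ≡⟨ poly-cong {g = g} (λ _ → refl) (updateAt-commutes u v u≢v y) ⟩
          poly g (updateAt (updateAt y u (const 0)) v (const q))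
            ≡⟨ poly-updateAt v g (updateAt y u (const 0)) q ⟩
          poly g (updateAt (updateAt y u (const 0)) v (const 0)) + q * c
            ≡⟨ cong (_+ q * c) (poly-cong {g = g} (λ _ → refl) (updateAt-commutes u v u≢v y)) ⟨
          a + q * c ∎
        ∂-set : poly (∂ u g) (updateAt y v (const q)) ≡ b
        ∂-set = trans (poly-updateAt v (∂ u g) y q)
          (trans (cong (λ x → b + q * x) (poly-zero (∂ v (∂ u g)) y ∂∂≡0)) (trans (cong (b +_) (*-zeroʳ q)) (+-identityʳ b)))

      poly-y : poly g y ≡ a + y v * c + y u * b
      poly-y = trans (poly-cong {g = g} (λ _ → refl) λ i → sym (trans
          (updateAt-id-local u (updateAt y v (const (y v))) (sym (updateAt-minimal u v y u≢v)) i)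
          (updateAt-id-local v y refl i)))
        (affine (y u) (y v))

    poly-shift : poly g y ≤ poly g (shift u v y) ⊎ poly g y ≤ poly g (shift v u y)
    -- `b` and `c` are the slopes in `y u` and `y v`. They are constant, as there is no mixed term,
    -- and the vertex with the larger slope receives the weight.
    poly-shift with ≤-total c b
    ... | inj₁ c≤b = inj₁ (begin
      poly g y                        ≡⟨ poly-y ⟩
      a + y v * c + y u * b           ≤⟨ +-monoˡ-≤ (y u * b) (+-monoʳ-≤ a (*-monoʳ-≤ (y v) c≤b)) ⟩
      a + y v * b + y u * b           ≡⟨ rearr a (y v) (y u) b c ⟩
      a + 0 * c + (y u + y v) * b     ≡⟨ affine (y u + y v) 0 ⟨
      poly g (shift u v y)            ∎)
      where
      open ≤-Reasoning
      rearr : ∀ a v u b c → a + v * b + u * b ≡ a + 0 * c + (u + v) * b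
      rearr = solve-∀
    ... | inj₂ b≤c = inj₂ (begin
      poly g y                        ≡⟨ poly-y ⟩
      a + y v * c + y u * b           ≤⟨ +-monoʳ-≤ (a + y v * c) (*-monoʳ-≤ (y u) b≤c) ⟩
      a + y v * c + y u * c           ≡⟨ rearr a (y v) (y u) b c ⟩
      a + (y v + y u) * c + 0 * b     ≡⟨ affine 0 (y v + y u) ⟨
      poly g (set 0 (y v + y u))      ≡⟨ poly-cong (λ _ → refl) (updateAt-commutes u v u≢v y) ⟩
      poly g (shift v u y)            ∎)
      where
      open ≤-Reasoning
      rearr : ∀ a v u b c → a + v * c + u * c ≡ a + (v + u) * c + 0 * b
      rearr = solve-∀

  shift-∉ : ∀ {n} {U : Subset n} {u v} y → u ∈ U → u ≢ v → (∀ x → x ∉ U → y x ≡ 0) →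
            ∀ x → x ∉ U - v → shift u v y x ≡ 0
  shift-∉ {u = u} {v} y u∈U u≢v y≡0 x x∉ with x Fin.≟ u
  ... | yes refl = contradiction (x∈p∧x≢y⇒x∈p-y u∈U u≢v) x∉
  ... | no x≢u with x Fin.≟ v
  ...   | yes refl = trans (updateAt-minimal x u _ x≢u) (updateAt-updates x y)
  ...   | no x≢v   = trans (updateAt-minimal x u _ x≢u) (trans (updateAt-minimal x v y x≢v)
                       (y≡0 x λ x∈U → x∉ (x∈p∧x≢y⇒x∈p-y x∈U x≢v)))

  module _ {n} (g : Subset n → ℕ) (Linked : Fin n → Fin n → Set) (linked? : ∀ u v → Dec (Linked u v))
           (g≡0 : ∀ {u v} → ¬ Linked u v → ∀ e → u ∈ e → v ∈ e → g e ≡ 0) where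

    -- Every shift deletes a vertex from `U`, so the bound `k` on its size also bounds the number of
    -- shifts. `U` contains the support and may also hold vertices of weight 0; the measure is `U`,
    -- not the support.
    symmetrize-within : ∀ k (U : Subset n) y → ∣ U ∣ ≤ k → (∀ v → v ∉ U → y v ≡ 0) →
      ∃[ W ] Σ[ z ∈ (Fin n → ℕ) ] ((∀ v → v ∉ W → z v ≡ 0) × sum z ≡ sum y × poly g y ≤ poly g z ×
        (∀ u v → u ∈ W → v ∈ W → u ≢ v → Linked u v))
    symmetrize-within k U y ∣U∣≤k y≡0
      with Fin.any? (λ u → Fin.any? λ v → (u ∈? U) ×-dec (v ∈? U) ×-dec ¬? (u Fin.≟ v) ×-dec ¬? (linked? u v))
    ... | no none = U , y , y≡0 , refl , ≤-refl , λ u v u∈U v∈U u≢v →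
          decidable-stable (linked? u v) λ ¬l → none (u , v , u∈U , v∈U , u≢v , ¬l)
    symmetrize-within zero U y ∣U∣≤k y≡0 | yes (u , v , u∈U , _) =
      contradiction (≤-trans (x∈p⇒∣p-x∣<∣p∣ u∈U) ∣U∣≤k) λ ()
    symmetrize-within (suc k) U y ∣U∣≤k y≡0 | yes (u , v , u∈U , v∈U , u≢v , ¬l) with poly-shift g y u≢v (g≡0 ¬l)
    ... | inj₁ le = let W , z , z≡0 , sum≡ , le′ , linked = symmetrize-within k (U - v) (shift u v y)
                          (s≤s⁻¹ (≤-trans (x∈p⇒∣p-x∣<∣p∣ v∈U) ∣U∣≤k)) (shift-∉ y u∈U u≢v y≡0)
                    in W , z , z≡0 , trans sum≡ (sum-shift y u≢v) , ≤-trans le le′ , linked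
    ... | inj₂ le = let W , z , z≡0 , sum≡ , le′ , linked = symmetrize-within k (U - u) (shift v u y)
                          (s≤s⁻¹ (≤-trans (x∈p⇒∣p-x∣<∣p∣ u∈U) ∣U∣≤k)) (shift-∉ y v∈U (u≢v ∘ sym) y≡0)
                    in W , z , z≡0 , trans sum≡ (sum-shift y (u≢v ∘ sym)) , ≤-trans le le′ , linked

    symmetrize : ∀ y → ∃[ W ] Σ[ z ∈ (Fin n → ℕ) ] ((∀ v → v ∉ W → z v ≡ 0) × sum z ≡ sum y × poly g y ≤ poly g z ×
        (∀ u v → u ∈ W → v ∈ W → u ≢ v → Linked u v))
    symmetrize y = symmetrize-within n ⊤ y (∣p∣≤n ⊤) λ v v∉ → contradiction ∈⊤ v∉

-- Cores of the forbidden family, and placing F in a clique with one extra vertex.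

module Cores where
  open Symmetrization
  open import Data.Bool.Properties using (T?)
  open import Data.Empty using () renaming (⊥ to Empty)
  open import Data.Product.Base using (_×_; _,_; proj₁; proj₂; ∃-syntax; Σ-syntax)
  open import Data.Sum.Base using (_⊎_; inj₁; inj₂)
  open import Data.Fin.Base using (Fin; zero; suc; punchOut; inject≤; cast; toℕ)
  import Data.Fin.Properties as Fin
  open import Data.Fin.Subset using (Subset; inside; outside; _∈_; _∉_; ∣_∣; _⊆_; ⁅_⁆; _∪_; ⊤; ∁)
  open import Data.Fin.Subset.Properties using (_∈?_; ∈⊤; ∣⊤∣≡n; x∈p⇒x∉∁p; x∉p⇒x∈∁p; ∣∁p∣≡n∸∣p∣; p⊂q⇒∣p∣<∣q∣; drop-∷-⊆; ⊆-antisym; ∪-identityˡ; out⊆; s⊆s; ⊆-refl)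
  open import Data.List.Base using (List; []; _∷_; length; filter)
  import Data.List.Membership.Propositional as List
  open import Data.List.Membership.Propositional.Properties using (∈-++⁺ˡ; ∈-++⁺ʳ; ∈-map⁺; ∈-filter⁺; ∈-filter⁻)
  open import Data.List.Relation.Unary.Any using (here; there)
  open import Data.Nat.Base
  open import Data.Nat.Properties
  open import Data.Vec.Base as Vec using ([]; _∷_; removeAt)
  open import Data.Vec.Properties using ([]=⇒lookup; lookup⇒[]=; removeAt-punchOut)
  open import Function.Base using (_∘_; id)
  open import Function.Definitions using (Injective)
  open import Relation.Binary.PropositionalEquality hiding (J; [_])
  open import Relation.Nullary using (¬_; yes; no; contradiction)

  ⊆∧∣∣≡⇒≡ : ∀ {n} {p q : Subset n} → p ⊆ q → ∣ p ∣ ≡ ∣ q ∣ → p ≡ q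
  ⊆∧∣∣≡⇒≡ {p = p} {q} p⊆q eq = ⊆-antisym p⊆q q⊆p
    where
    q⊆p : q ⊆ p
    q⊆p {x} x∈q with x ∈? p
    ... | yes x∈p = x∈p
    ... | no x∉p  = contradiction eq (<⇒≢ (p⊂q⇒∣p∣<∣q∣ (p⊆q , x , x∈q , x∉p)))

  intermediate : ∀ {n k} (A B : Subset n) → A ⊆ B → ∣ A ∣ ≤ k → k ≤ ∣ B ∣ → ∃[ C ] A ⊆ C × C ⊆ B × ∣ C ∣ ≡ k
  intermediate {k = zero} [] [] A⊆B _ _ = [] , ⊆-refl , ⊆-refl , refl
  intermediate (outside ∷ A) (outside ∷ B) A⊆B A≤k k≤B =
    let C , A⊆C , C⊆B , eq = intermediate A B (drop-∷-⊆ A⊆B) A≤k k≤B in outside ∷ C , s⊆s A⊆C , s⊆s C⊆B , eq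
  intermediate (inside ∷ A)  (outside ∷ B) A⊆B A≤k k≤B = contradiction (A⊆B Vec.here) λ ()
  intermediate (inside ∷ A)  (inside ∷ B)  A⊆B (s≤s A≤k) (s≤s k≤B) =
    let C , A⊆C , C⊆B , eq = intermediate A B (drop-∷-⊆ A⊆B) A≤k k≤B in inside ∷ C , s⊆s A⊆C , s⊆s C⊆B , cong suc eq
  intermediate {k = k} (outside ∷ A) (inside ∷ B)  A⊆B A≤k k≤B with k ≤? ∣ B ∣
  ... | yes k≤B′ = let C , A⊆C , C⊆B , eq = intermediate A B (drop-∷-⊆ A⊆B) A≤k k≤B′
                   in outside ∷ C , out⊆ A⊆C , out⊆ C⊆B , eq
  ... | no k≰B   = inside ∷ B , A⊆B , ⊆-refl , ≤-antisym (≰⇒> k≰B) k≤B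

  image-suc : ∀ {k n} (f : Fin k → Fin n) e → image (suc ∘ f) e ≡ outside ∷ image f e
  image-suc f []            = refl
  image-suc f (outside ∷ e) = image-suc (f ∘ suc) e
  image-suc f (inside ∷ e)  = cong (⁅ suc (f zero) ⁆ ∪_) (image-suc (f ∘ suc) e)

  image-id : ∀ {n} (e : Subset n) → image id e ≡ e
  image-id []            = refl
  image-id (outside ∷ e) = trans (image-suc id e) (cong (outside ∷_) (image-id e))
  image-id (inside ∷ e)  = trans (cong (⁅ zero ⁆ ∪_) (image-suc id e))
    (cong (inside ∷_) (trans (∪-identityˡ (image id e)) (image-id e)))

  ∈-subsets : ∀ {n} (e : Subset n) → e List.∈ subsets n
  ∈-subsets []            = here refl
  ∈-subsets (outside ∷ e) = ∈-++⁺ˡ (∈-map⁺ (outside ∷_) (∈-subsets e))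
  ∈-subsets (inside ∷ e)  = ∈-++⁺ʳ _ (∈-map⁺ (inside ∷_) (∈-subsets e))

  ∈-edges⁺ : ∀ {r} (G : RGraph r) {e} → Edge G e → e List.∈ edges G
  ∈-edges⁺ G {e} e∈G = ∈-filter⁺ (T? ∘ isEdge G) (∈-subsets e) e∈G

  ∈-edges⁻ : ∀ {r} (G : RGraph r) {e} → e List.∈ edges G → Edge G e
  ∈-edges⁻ G e∈ = proj₂ (∈-filter⁻ (T? ∘ isEdge G) {xs = subsets (order G)} e∈)

  length≡1 : ∀ {A : Set} (xs : List A) → length xs ≡ 1 → ∃[ x ] x List.∈ xs × (∀ y → y List.∈ xs → y ≡ x)
  length≡1 (x ∷ []) refl = x , here refl , λ { y (here y≡x) → y≡x }

  degree≡1 : ∀ {r} (G : RGraph r) {v} → degree G v ≡ 1 →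
             ∃[ e ] Edge G e × v ∈ e × (∀ d → Edge G d → v ∈ d → d ≡ e)
  degree≡1 G {v} eq =
    let e , e∈ , unique = length≡1 (filter (v ∈?_) (edges G)) eq
        e∈edges , v∈e   = ∈-filter⁻ (v ∈?_) {xs = edges G} e∈
    in e , ∈-edges⁻ G e∈edges , v∈e , λ d d∈G v∈d → unique d (∈-filter⁺ (v ∈?_) (∈-edges⁺ G d∈G) v∈d)

  match : ∀ {n} (A B : Subset n) → ∣ A ∣ ≡ ∣ B ∣ → ∀ {i} → i ∈ A → Fin n
  match A B eq i∈A = ι B (cast eq (proj₁ (ι-surjective A i∈A)))

  match-injective : ∀ {n} (A B : Subset n) (eq : ∣ A ∣ ≡ ∣ B ∣) {i j} (i∈A : i ∈ A) (j∈A : j ∈ A) →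
                    match A B eq i∈A ≡ match A B eq j∈A → i ≡ j
  match-injective A B eq i∈A j∈A eq′ =
    let k , ιk≡i = ι-surjective A i∈A
        l , ιl≡j = ι-surjective A j∈A
        k≡l = Fin.toℕ-injective (trans (sym (Fin.toℕ-cast eq k)) (trans (cong toℕ (ι-injective B eq′)) (Fin.toℕ-cast eq l)))
    in trans (sym ιk≡i) (trans (cong (ι A) k≡l) ιl≡j)

  module _ {n} (A B : Subset n) (eq : ∣ A ∣ ≡ ∣ B ∣) where
    private
      eq∁ : ∣ ∁ A ∣ ≡ ∣ ∁ B ∣
      eq∁ = trans (∣∁p∣≡n∸∣p∣ A) (trans (cong (n ∸_) eq) (sym (∣∁p∣≡n∸∣p∣ B)))

    -- A permutation that carries `A` onto `B`, composed of the order-preserving bijections between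
    -- the two sets and between their complements.
    rearrange : Fin n → Fin n
    rearrange i with i ∈? A
    ... | yes i∈A = match A B eq i∈A
    ... | no i∉A  = match (∁ A) (∁ B) eq∁ (x∉p⇒x∈∁p i∉A)

    rearrange-∈ : ∀ {i} → i ∈ A → rearrange i ∈ B
    rearrange-∈ {i} i∈A with i ∈? A
    ... | yes i∈A′ = ι-∈ B _
    ... | no i∉A   = contradiction i∈A i∉A

    rearrange-injective : Injective _≡_ _≡_ rearrange
    rearrange-injective {i} {j} eq′ with i ∈? A | j ∈? A
    ... | yes i∈A | yes j∈A = match-injective A B eq i∈A j∈A eq′
    ... | no i∉A  | no j∉A  = match-injective (∁ A) (∁ B) eq∁ (x∉p⇒x∈∁p i∉A) (x∉p⇒x∈∁p j∉A) eq′
    ... | yes i∈A | no j∉A  = contradiction (subst (_∈ ∁ B) (sym eq′) (ι-∈ (∁ B) _)) (x∈p⇒x∉∁p (ι-∈ B _))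
    ... | no i∉A  | yes j∈A = contradiction (subst (_∈ ∁ B) eq′ (ι-∈ (∁ B) _)) (x∈p⇒x∉∁p (ι-∈ B _))

  ∣removeAt∣ : ∀ {n} (e : Subset (suc n)) {x} → x ∈ e → ∣ e ∣ ≡ suc ∣ removeAt e x ∣
  ∣removeAt∣ (inside ∷ e)            Vec.here        = refl
  ∣removeAt∣ (inside ∷ e@(_ ∷ _))    (Vec.there x∈e) = cong suc (∣removeAt∣ e x∈e)
  ∣removeAt∣ (outside ∷ e@(_ ∷ _))   (Vec.there x∈e) = ∣removeAt∣ e x∈e

  module _ {m} (x : Fin (suc m)) (e : Subset (suc m)) (x∈e : x ∈ e)
           (e₁ : Subset m) (∣e₁∣ : suc ∣ e₁ ∣ ≡ ∣ e ∣) where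
    private
      eq : ∣ removeAt e x ∣ ≡ ∣ e₁ ∣
      eq = suc-injective (trans (sym (∣removeAt∣ e x∈e)) (sym ∣e₁∣))

      π : Fin m → Fin m
      π = rearrange (removeAt e x) e₁ eq

    -- A relabelling of the vertices of F that puts the vertex `x` of degree 1 at `zero` and the
    -- rest of its edge `e` onto the prescribed set `e₁`.
    pendant : Fin (suc m) → Fin (suc m)
    pendant j with x Fin.≟ j
    ... | yes _   = zero
    ... | no x≢j  = suc (π (punchOut x≢j))

    pendant-injective : Injective _≡_ _≡_ pendant
    pendant-injective {i} {j} eq′ with x Fin.≟ i | x Fin.≟ j
    ... | yes refl | yes refl = refl
    ... | no x≢i   | no x≢j   = Fin.punchOut-injective x≢i x≢j
      (rearrange-injective (removeAt e x) e₁ eq (Fin.suc-injective eq′))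

    zero∉image-pendant : ∀ {d} → x ∉ d → zero ∉ image pendant d
    zero∉image-pendant {d} x∉d 0∈ with ∈-image⁻ pendant d 0∈
    ... | j , j∈d , eq′ with x Fin.≟ j
    ...   | yes refl = x∉d j∈d

    image-pendant : image pendant e ≡ inside ∷ e₁
    image-pendant = ⊆∧∣∣≡⇒≡ ⊆-image (trans (∣image∣ pendant-injective e) (sym ∣e₁∣))
      where
      pendant-∈ : ∀ {j} → j ∈ e → pendant j ∈ inside ∷ e₁
      pendant-∈ {j} j∈e with x Fin.≟ j
      ... | yes _  = Vec.here
      ... | no x≢j = Vec.there (rearrange-∈ (removeAt e x) e₁ eq
        (lookup⇒[]= _ _ (trans (removeAt-punchOut e x≢j) ([]=⇒lookup j∈e))))
      ⊆-image : image pendant e ⊆ inside ∷ e₁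
      ⊆-image v∈ = let j , j∈e , eq′ = ∈-image⁻ pendant e v∈ in subst (_∈ inside ∷ e₁) eq′ (pendant-∈ j∈e)

  outside-head : ∀ {n} (p : Subset (suc n)) → zero ∉ p → ∃[ d ] p ≡ outside ∷ d
  outside-head (outside ∷ d) 0∉p = d , refl
  outside-head (inside ∷ d)  0∉p = contradiction Vec.here 0∉p

  -- Both forms of the hypothesis on F become one statement here: `zero` stands for a vertex outside
  -- a clique, and at most the one set `inside ∷ e₁` through it has to be an edge. A small F avoids
  -- `zero` altogether; otherwise all edges of F but one avoid its vertex of degree 1.
  pendant-embedding : ∀ {r} (F : RGraph r) m →
    (order F ≤ m ⊎ (order F ≡ suc m × ∃[ v ] (degree F v ≡ 1))) →
    (e₁ : Subset m) → suc ∣ e₁ ∣ ≡ r →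
    Σ[ θ ∈ (Fin (order F) → Fin (suc m)) ] (Injective _≡_ _≡_ θ ×
      (∀ e → Edge F e → (∃[ d ] ∣ d ∣ ≡ r × image θ e ≡ outside ∷ d) ⊎ image θ e ≡ inside ∷ e₁))
  pendant-embedding F m (inj₁ ≤m) e₁ ∣e₁∣ =
    suc ∘ f , Fin.inject≤-injective ≤m ≤m _ _ ∘ Fin.suc-injective , λ e e∈F →
    inj₁ (image f e , trans (∣image∣ (Fin.inject≤-injective ≤m ≤m _ _) e) (uniform F e e∈F) , image-suc f e)
    where
    f : Fin (order F) → Fin m
    f i = inject≤ i ≤m
  pendant-embedding F@record { order = _ ; isEdge = _ ; uniform = _ } m (inj₂ (refl , x , deg)) e₁ ∣e₁∣
    with degree≡1 F deg
  ... | eₓ , eₓ∈F , x∈eₓ , unique = pendant x eₓ x∈eₓ e₁ ∣eₓ∣ , pendant-injective x eₓ x∈eₓ e₁ ∣eₓ∣ , edge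
    where
    ∣eₓ∣ : suc ∣ e₁ ∣ ≡ ∣ eₓ ∣
    ∣eₓ∣ = trans ∣e₁∣ (sym (uniform F eₓ eₓ∈F))
    θ = pendant x eₓ x∈eₓ e₁ ∣eₓ∣
    edge : ∀ e → Edge F e → (∃[ d ] ∣ d ∣ ≡ _ × image θ e ≡ outside ∷ d) ⊎ image θ e ≡ inside ∷ e₁
    edge e e∈F with x ∈? e
    ... | yes x∈e = inj₂ (trans (cong (image θ) (unique e e∈F x∈e)) (image-pendant x eₓ x∈eₓ e₁ ∣eₓ∣))
    ... | no x∉e  =
      let d , eq = outside-head (image θ e) (zero∉image-pendant x eₓ x∈eₓ e₁ ∣eₓ∣ x∉e)
      in inj₁ (d , trans (sym (cong ∣_∣ eq)) (trans (∣image∣ (pendant-injective x eₓ x∈eₓ e₁ ∣eₓ∣) e) (uniform F e e∈F)) , eq)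

  ⊑-refl : ∀ {r} (G : RGraph r) → G ⊑ G
  ⊑-refl G = record { vertex = id ; injective = id ; edge = λ e e∈G → subst (Edge G) (sym (image-id e)) e∈G }

  module _ {r} {F G : RGraph r} {p} (free : 𝒦 F p -Free G) where

    -- With such a core, G is itself a member of the forbidden family and contains itself.
    no-core : (C : Subset (order G)) → ∣ C ∣ ≡ p →
      (∀ u v → u ∈ C → v ∈ C → u ≢ v → Covered G u v) →
      (ψ : Fin (order F) → Fin (order G)) → Injective _≡_ _≡_ ψ → (∀ x → ψ x ∈ C) →
      (∀ e → Edge F e → Edge G (image ψ e)) → Empty
    no-core C ∣C∣ covered ψ ψ-inj ψ∈C ψ-edge = free G record
      { core     = C
      ; coreSize = ∣C∣
      ; copy     = record
        { vertex    = φ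
        ; injective = λ {i} {j} eq → ψ-inj (trans (sym (ι-φ i)) (trans (cong (ι C) eq) (ι-φ j)))
        ; edge      = λ e e∈F → subst (Edge G) (sym (trans (embed≡image C (image φ e))
            (trans (sym (image-∘ (ι C) φ e)) (image-cong ι-φ e)))) (ψ-edge e e∈F)
        }
      ; covered  = covered
      } (⊑-refl G)
      where
      φ : Fin (order F) → Fin ∣ C ∣
      φ x = proj₁ (ι-surjective C (ψ∈C x))
      ι-φ : ∀ x → ι C (φ x) ≡ ψ x
      ι-φ x = proj₂ (ι-surjective C (ψ∈C x))

    -- The vertices of a copy of F in `U` can be completed inside `U` to exactly `p` vertices, still
    -- pairwise covered, which form a core.
    covered⇒F-free : (U : Subset (order G)) → order F ≤ p → p ≤ ∣ U ∣ →
      (∀ u v → u ∈ U → v ∈ U → u ≢ v → Covered G u v) → ¬ (F ⊑ G [ U ])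
    covered⇒F-free U F≤p p≤U covered F⊑ =
      let C , A⊆C , C⊆U , ∣C∣ = intermediate (image ψ ⊤) U A⊆U
            (≤-trans (≤-reflexive (trans (∣image∣ ψ-inj ⊤) (∣⊤∣≡n (order F)))) F≤p) p≤U
      in no-core C ∣C∣ (λ u v u∈C v∈C → covered u v (C⊆U u∈C) (C⊆U v∈C)) ψ ψ-inj
           (λ x → A⊆C (∈-image⁺ ψ {⊤} ∈⊤))
           (λ e e∈F → subst (Edge G) (trans (embed≡image U _) (sym (image-∘ (ι U) vertex e))) (edge e e∈F))
      where
      open _⊑_ F⊑
      ψ : Fin (order F) → Fin (order G)
      ψ = ι U ∘ vertex
      ψ-inj : Injective _≡_ _≡_ ψ
      ψ-inj = injective ∘ ι-injective U
      A⊆U : image ψ ⊤ ⊆ U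
      A⊆U v∈ = let i , _ , eq = ∈-image⁻ ψ ⊤ v∈ in subst (_∈ U) eq (ι-∈ U (vertex i))

  module _ {r m} {F G : RGraph r} (free : 𝒦 F (suc m) -Free G)
           (hyp : order F ≤ m ⊎ (order F ≡ suc m × ∃[ v ] (degree F v ≡ 1))) where

    -- `κ zero` is the extra vertex and the other m values span the clique. All m + 1 vertices form
    -- the core, and a single edge through the extra vertex suffices by `pendant-embedding`.
    no-pendant-clique : (κ : Fin (suc m) → Fin (order G)) → Injective _≡_ _≡_ κ →
      (∀ e → ∣ e ∣ ≡ r → Edge G (image (κ ∘ suc) e)) →
      (∀ i j → i ≢ j → Covered G (κ i) (κ j)) →
      ∀ e₁ → Edge G (image κ (inside ∷ e₁)) → Empty
    no-pendant-clique κ κ-inj clique covered e₁ e₁∈G =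
      let θ , θ-inj , θ-edge = pendant-embedding F m hyp e₁
            (trans (sym (∣image∣ κ-inj (inside ∷ e₁))) (uniform G _ e₁∈G))
      in no-core free (image κ ⊤) (trans (∣image∣ κ-inj ⊤) (∣⊤∣≡n (suc m))) covered-image
           (κ ∘ θ) (θ-inj ∘ κ-inj) (λ x → ∈-image⁺ κ {⊤} ∈⊤)
           (λ e e∈F → subst (Edge G) (sym (image-∘ κ θ e)) (edge (θ-edge e e∈F)))
      where
      covered-image : ∀ u v → u ∈ image κ ⊤ → v ∈ image κ ⊤ → u ≢ v → Covered G u v
      covered-image u v u∈ v∈ u≢v with ∈-image⁻ κ ⊤ u∈ | ∈-image⁻ κ ⊤ v∈
      ... | i , _ , refl | j , _ , refl = covered i j (u≢v ∘ cong κ)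
      edge : ∀ {e} → (∃[ d ] ∣ d ∣ ≡ r × e ≡ outside ∷ d) ⊎ e ≡ inside ∷ e₁ → Edge G (image κ e)
      edge (inj₁ (d , ∣d∣ , refl)) = clique d ∣d∣
      edge (inj₂ refl)             = e₁∈G

-- Links into a complete set of m vertices, and twins of its vertices.

module Twins where
  open Polynomials
  open Symmetrization
  open Cores
  open import Data.Bool.Base using (true; false; if_then_else_)
  open import Data.Empty using (⊥-elim)
  open import Data.Product.Base using (_×_; _,_; proj₁; proj₂; ∃-syntax)
  open import Data.Sum.Base using (_⊎_; inj₁; inj₂; [_,_]′)
  open import Data.Fin.Base using (Fin; zero; suc)
  import Data.Fin.Properties as Fin
  open import Data.Fin.Subset using (Subset; inside; _∈_; _∉_; ∣_∣; _⊆_; ⁅_⁆; _∪_; _∩_; ⊤; ⊥; ∁)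
  open import Data.Fin.Subset.Properties using (∉⊥; _∈?_; anySubset?; ∣⁅x⁆∣≡1; x∈p∩q⁻; x∈p∩q⁺; x∈∁p⇒x∉p; ⊆⊤; ∣⊤∣≡n; x∉p⇒x∈∁p; ∣∁p∣≡n∸∣p∣; x∈p∪q⁻; x∈p∪q⁺; x∈⁅x⁆; x∈⁅y⁆⇒x≡y; ⊆-antisym; ∪-identityˡ; ∣⊥∣≡0; x≢y⇒x∉⁅y⁆)
  open import Data.Nat.Base
  open import Data.Nat.Properties
  open import Data.Vec.Base as Vec using (_∷_; _[_]≔_)
  open import Data.Vec.Functional using (updateAt) renaming (_∷_ to _◂_)
  open import Data.Vec.Functional.Properties using (updateAt-minimal; updateAt-updates)
  open import Function.Base using (_∘_; const)
  open import Function.Definitions using (Injective)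
  open import Relation.Binary.PropositionalEquality hiding (J; [_])
  open import Relation.Nullary using (¬_; yes; no; contradiction)
  open import Relation.Nullary.Decidable using (_×-dec_; ¬?; decidable-stable)

  indicator : ∀ {r} (G : RGraph r) → Subset (order G) → ℕ
  indicator G e = if isEdge G e then 1 else 0

  indicator-≢0 : ∀ {r} (G : RGraph r) {e} → indicator G e ≢ 0 → Edge G e
  indicator-≢0 G {e} ≢0 with isEdge G e
  ... | true  = _
  ... | false = contradiction refl ≢0

  indicator-≤χ : ∀ {r} (G : RGraph r) e → indicator G e ≤ χ r e
  indicator-≤χ G e with isEdge G e | uniform G e
  ... | true  | ∣e∣≡r = ≤-reflexive (sym (trans (cong (λ r → χ r e) (sym (∣e∣≡r _))) (χ-size e)))
  ... | false | _     = z≤n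

  insert-∪ : ∀ {n} x (e : Subset n) → e [ x ]≔ inside ≡ ⁅ x ⁆ ∪ e
  insert-∪ zero    (_ ∷ e) = cong (inside ∷_) (sym (∪-identityˡ e))
  insert-∪ (suc x) (b ∷ e) = cong (b ∷_) (insert-∪ x e)

  link-≢0 : ∀ {r} (G : RGraph r) z {e} → ∂ z (indicator G) e ≢ 0 → z ∉ e × Edge G (⁅ z ⁆ ∪ e)
  link-≢0 G z {e} ≢0 with z ∈? e
  ... | yes z∈e = contradiction (∂-∈ (indicator G) z∈e) ≢0
  ... | no z∉e  = z∉e , subst (Edge G) (insert-∪ z e)
    (indicator-≢0 G (λ eq → ≢0 (trans (∂-∉ z (indicator G) z∉e) eq)))

  remove-∪ : ∀ {n} {x} (e : Subset n) → x ∈ e → e ≡ ⁅ x ⁆ ∪ (e ∩ ∁ ⁅ x ⁆)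
  remove-∪ {x = x} e x∈e = ⊆-antisym to from
    where
    to : ∀ {y} → y ∈ e → y ∈ ⁅ x ⁆ ∪ (e ∩ ∁ ⁅ x ⁆)
    to {y} y∈e with y ∈? ⁅ x ⁆
    ... | yes y∈ = x∈p∪q⁺ (inj₁ y∈)
    ... | no y∉  = x∈p∪q⁺ (inj₂ (x∈p∩q⁺ (y∈e , x∉p⇒x∈∁p y∉)))
    from : ∀ {y} → y ∈ ⁅ x ⁆ ∪ (e ∩ ∁ ⁅ x ⁆) → y ∈ e
    from y∈ with x∈p∪q⁻ ⁅ x ⁆ _ y∈
    ... | inj₁ y∈x = subst (_∈ e) (sym (x∈⁅y⁆⇒x≡y x y∈x)) x∈e
    ... | inj₂ y∈′ = proj₁ (x∈p∩q⁻ e _ y∈′)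

  subset-avoiding : ∀ {k j} (A : Subset (suc k)) t → t ∉ A → ∣ A ∣ ≤ j → j ≤ k →
                    ∃[ e ] A ⊆ e × t ∉ e × ∣ e ∣ ≡ j
  subset-avoiding {k} A t t∉A A≤j j≤k =
    let e , A⊆e , e⊆ , ∣e∣ = intermediate A (∁ ⁅ t ⁆)
          (λ {x} x∈A → x∉p⇒x∈∁p (x≢y⇒x∉⁅y⁆ λ { refl → t∉A x∈A })) A≤j
          (≤-trans j≤k (≤-reflexive (sym (trans (∣∁p∣≡n∸∣p∣ ⁅ t ⁆) (cong (suc k ∸_) (∣⁅x⁆∣≡1 t))))))
    in e , A⊆e , (λ t∈e → x∈∁p⇒x∉p (e⊆ t∈e) (x∈⁅x⁆ t)) , ∣e∣

  ◂-injective : ∀ {m n} z (τ : Fin m → Fin n) → Injective _≡_ _≡_ τ → (∀ i → z ≢ τ i) → Injective _≡_ _≡_ (z ◂ τ)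
  ◂-injective z τ inj z≢ {zero}  {zero}  eq = refl
  ◂-injective z τ inj z≢ {zero}  {suc j} eq = contradiction eq (z≢ j)
  ◂-injective z τ inj z≢ {suc i} {zero}  eq = contradiction (sym eq) (z≢ i)
  ◂-injective z τ inj z≢ {suc i} {suc j} eq = cong suc (inj eq)

  module _ {ρ k} (G : RGraph (2 + ρ)) (ρ<k : suc ρ ≤ k) where

    clique⇒covered : (τ : Fin (suc k) → Fin (order G)) → (∀ e → ∣ e ∣ ≡ 2 + ρ → Edge G (image τ e)) →
                     ∀ i j → i ≢ j → Covered G (τ i) (τ j)
    clique⇒covered τ clique i j i≢j =
      let e , ij⊆e , _ , ∣e∣ = intermediate (⁅ i ⁆ ∪ ⁅ j ⁆) ⊤ ⊆⊤
            (≤-trans (≤-reflexive (trans (∣⁅x⁆∪p∣ i ⁅ j ⁆ (x≢y⇒x∉⁅y⁆ i≢j)) (cong suc (∣⁅x⁆∣≡1 j)))) (s≤s (s≤s z≤n)))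
            (≤-trans (s≤s ρ<k) (≤-reflexive (sym (∣⊤∣≡n (suc k)))))
      in image τ e , clique e ∣e∣ , ∈-image⁺ τ (ij⊆e (x∈p∪q⁺ (inj₁ (x∈⁅x⁆ i))))
                                  , ∈-image⁺ τ (ij⊆e (x∈p∪q⁺ (inj₂ (x∈⁅x⁆ j))))

    covered-sym : ∀ {u v} → Covered G u v → Covered G v u
    covered-sym (e , e∈G , u∈e , v∈e) = e , e∈G , v∈e , u∈e

    ◂-covered : ∀ z (τ : Fin (suc k) → Fin (order G)) → (∀ e → ∣ e ∣ ≡ 2 + ρ → Edge G (image τ e)) →
                (∀ i → Covered G z (τ i)) → ∀ i j → i ≢ j → Covered G ((z ◂ τ) i) ((z ◂ τ) j)
    ◂-covered z τ clique cov zero    zero    i≢j = contradiction refl i≢j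
    ◂-covered z τ clique cov zero    (suc j) i≢j = cov j
    ◂-covered z τ clique cov (suc i) zero    i≢j = covered-sym (cov i)
    ◂-covered z τ clique cov (suc i) (suc j) i≢j = clique⇒covered τ clique i j (i≢j ∘ cong suc)

  module LocalStructure {ρ k} {F G : RGraph (2 + ρ)} (ρ<k : suc ρ ≤ k)
      (free : 𝒦 F (2 + k) -Free G)
      (hyp : order F ≤ suc k ⊎ (order F ≡ 2 + k × ∃[ v ] (degree F v ≡ 1)))
      (τ : Fin (suc k) → Fin (order G)) (τ-inj : Injective _≡_ _≡_ τ)
      (clique : ∀ e → ∣ e ∣ ≡ 2 + ρ → Edge G (image τ e)) where

    link : Fin (order G) → Subset (suc k) → ℕ
    link z e = ∂ z (indicator G) (image τ e)

    -- As far as the clique can tell, `z` may take the place of `τ t`: it forms an edge with every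
    -- set of r - 1 of the other vertices.
    Twin : Fin (order G) → Fin (suc k) → Set
    Twin z t = ∀ e → ∣ e ∣ ≡ suc ρ → t ∉ e → link z e ≢ 0

    -- Vertices of the clique need no separate treatment. No link set of `τ i` contains `i`, so if
    -- every `t` lay in a link set of `z`, then `z` would lie outside the clique, as the injectivity
    -- of `z ◂ τ` demands.
    avoided : ∀ z → ∃[ t ] (∀ e → t ∈ e → link z e ≡ 0)
    avoided z with Fin.any? (λ t → ¬? (anySubset? λ e → (t ∈? e) ×-dec ¬? (link z e ≟ 0)))
    ... | yes (t , none) = t , λ e t∈e → decidable-stable (link z e ≟ 0) λ ≢0 → none (e , t∈e , ≢0)
    ... | no all = ⊥-elim (no-pendant-clique free hyp (z ◂ τ) (◂-injective z τ τ-inj z∉τ) clique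
            (◂-covered G ρ<k z τ clique z-covered) (proj₁ (through zero)) (proj₂ (link-≢0 G z (proj₂ (proj₂ (through zero))))))
      where
      through : ∀ t → ∃[ e ] (t ∈ e × link z e ≢ 0)
      through t = decidable-stable (anySubset? λ e → (t ∈? e) ×-dec ¬? (link z e ≟ 0)) (λ none → all (t , none))
      z∉τ : ∀ i → z ≢ τ i
      z∉τ i refl = let e , i∈e , ≢0 = through i in proj₁ (link-≢0 G z ≢0) (∈-image⁺ τ i∈e)
      z-covered : ∀ i → Covered G z (τ i)
      z-covered i = let e , i∈e , ≢0 = through i
                    in _ , proj₂ (link-≢0 G z ≢0) , x∈p∪q⁺ (inj₁ (x∈⁅x⁆ z)) , x∈p∪q⁺ (inj₂ (∈-image⁺ τ i∈e))

    twin? : ∀ z t → Twin z t ⊎ ∃[ e ] (∣ e ∣ ≡ suc ρ × t ∉ e × link z e ≡ 0)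
    twin? z t with anySubset? (λ e → (∣ e ∣ ≟ suc ρ) ×-dec ¬? (t ∈? e) ×-dec (link z e ≟ 0))
    ... | yes w   = inj₂ w
    ... | no none = inj₁ λ e ∣e∣ t∉e eq → none (e , ∣e∣ , t∉e , eq)

    twin-through : ∀ {z t} → Twin z t → ∀ i → i ≢ t → ∃[ e ] (i ∈ e × link z e ≢ 0)
    twin-through {z} {t} twin i i≢t =
      let e , i⊆e , t∉e , ∣e∣ = subset-avoiding ⁅ i ⁆ t (x≢y⇒x∉⁅y⁆ (i≢t ∘ sym))
                                  (≤-trans (≤-reflexive (∣⁅x⁆∣≡1 i)) (s≤s z≤n)) ρ<k
      in e , i⊆e (x∈⁅x⁆ i) , twin e ∣e∣ t∉e

    twin-≢ : ∀ {z t} → Twin z t → ∀ i → i ≢ t → z ≢ τ i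
    twin-≢ {z} {t} twin i i≢t refl = let e , i∈e , ≢0 = twin-through {z} {t} twin i i≢t
                             in proj₁ (link-≢0 G (τ i) ≢0) (∈-image⁺ τ i∈e)

    twin-covered : ∀ {z t} → Twin z t → ∀ i → i ≢ t → Covered G z (τ i)
    twin-covered {z} {t} twin i i≢t = let e , i∈e , ≢0 = twin-through {z} {t} twin i i≢t
      in _ , proj₂ (link-≢0 G z ≢0) , x∈p∪q⁺ (inj₁ (x∈⁅x⁆ z)) , x∈p∪q⁺ (inj₂ (∈-image⁺ τ i∈e))

    module _ {u t} (twin : Twin u t) where
      replace : Fin (suc k) → Fin (order G)
      replace = updateAt τ t (const u)

      replace-∉ : ∀ e → t ∉ e → image replace e ≡ image τ e
      replace-∉ e t∉e = ⊆-antisym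
        (λ v∈ → let i , i∈e , eq = ∈-image⁻ replace e v∈
                in subst (_∈ image τ e) (trans (sym (minimal i∈e)) eq) (∈-image⁺ τ i∈e))
        (λ v∈ → let i , i∈e , eq = ∈-image⁻ τ e v∈
                in subst (_∈ image replace e) (trans (minimal i∈e) eq) (∈-image⁺ replace i∈e))
        where
        minimal : ∀ {i} → i ∈ e → replace i ≡ τ i
        minimal {i} i∈e = updateAt-minimal i t τ λ { refl → t∉e i∈e }

      replace-injective : Injective _≡_ _≡_ replace
      replace-injective {i} {j} eq with i Fin.≟ t | j Fin.≟ t
      ... | yes refl | yes refl = refl
      ... | yes refl | no j≢t   = contradiction (trans (sym (updateAt-updates t τ)) (trans eq (updateAt-minimal j t τ j≢t))) (twin-≢ twin j j≢t)
      ... | no i≢t   | yes refl = contradiction (trans (sym (updateAt-updates t τ)) (trans (sym eq) (updateAt-minimal i t τ i≢t))) (twin-≢ twin i i≢t)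
      ... | no i≢t   | no j≢t   = τ-inj (trans (sym (updateAt-minimal i t τ i≢t)) (trans eq (updateAt-minimal j t τ j≢t)))

      image-⁅⁆∪ : ∀ {a b} (g : Fin a → Fin b) x e → image g (⁅ x ⁆ ∪ e) ≡ ⁅ g x ⁆ ∪ image g e
      image-⁅⁆∪ g x e = ⊆-antisym
        (λ v∈ → let i , i∈ , eq = ∈-image⁻ g _ v∈ in subst (_∈ _) eq
          ([ (λ i∈x → x∈p∪q⁺ (inj₁ (subst (λ y → g y ∈ ⁅ g x ⁆) (sym (x∈⁅y⁆⇒x≡y x i∈x)) (x∈⁅x⁆ (g x)))))
           , (λ i∈e → x∈p∪q⁺ (inj₂ (∈-image⁺ g i∈e))) ]′ (x∈p∪q⁻ ⁅ x ⁆ e i∈)))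
        (λ v∈ → [ (λ v∈x → subst (_∈ _) (sym (x∈⁅y⁆⇒x≡y (g x) v∈x)) (∈-image⁺ g {⁅ x ⁆ ∪ e} (x∈p∪q⁺ (inj₁ (x∈⁅x⁆ x)))))
                , (λ v∈e → let i , i∈e , eq = ∈-image⁻ g e v∈e in subst (_∈ _) eq (∈-image⁺ g {⁅ x ⁆ ∪ e} (x∈p∪q⁺ (inj₂ i∈e)))) ]′
                (x∈p∪q⁻ ⁅ g x ⁆ _ v∈))

      replace-clique : ∀ e → ∣ e ∣ ≡ 2 + ρ → Edge G (image replace e)
      replace-clique e ∣e∣ with t ∈? e
      ... | no t∉e  = subst (Edge G) (sym (replace-∉ e t∉e)) (clique e ∣e∣)
      ... | yes t∈e = subst (Edge G) (sym eq) (proj₂ (link-≢0 G u (twin d ∣d∣ t∉d)))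
        where
        d = e ∩ ∁ ⁅ t ⁆
        t∉d : t ∉ d
        t∉d t∈d = x∈∁p⇒x∉p (proj₂ (x∈p∩q⁻ e _ t∈d)) (x∈⁅x⁆ t)
        ∣d∣ : ∣ d ∣ ≡ suc ρ
        ∣d∣ = suc-injective (trans (sym (∣⁅x⁆∪p∣ t d t∉d)) (trans (cong ∣_∣ (sym (remove-∪ e t∈e))) ∣e∣))
        eq : image replace e ≡ ⁅ u ⁆ ∪ image τ d
        eq = trans (cong (image replace) (remove-∪ e t∈e)) (trans (image-⁅⁆∪ replace t d)
          (cong₂ (λ x p → ⁅ x ⁆ ∪ p) (updateAt-updates t τ) (replace-∉ d t∉d)))

      -- With `u` in the place of `τ t` the clique stays complete, and `v` becomes the extra vertex.
      -- Of the covered pairs that a core requires, only `u` with `v` does not follow from the twin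
      -- property; it is the one supplied by the refuted assumption.
      twins-uncovered : ∀ {v} → Twin v t → u ≢ v → ¬ Covered G u v
      twins-uncovered {v} twin′ u≢v cov =
        -- Any set of r - 1 clique vertices avoiding `t` gives an edge through `v`, and r ≤ m leaves
        -- room for one.
        let e₁ , _ , t∉e₁ , ∣e₁∣ = subset-avoiding ⊥ t (λ t∈⊥ → ∉⊥ t∈⊥) (≤-trans (≤-reflexive (∣⊥∣≡0 (suc k))) z≤n) ρ<k
        in no-pendant-clique free hyp (v ◂ replace) (◂-injective v replace replace-injective v≢) replace-clique
             (◂-covered G ρ<k v replace replace-clique v-covered) e₁
             (subst (λ p → Edge G (⁅ v ⁆ ∪ p)) (sym (replace-∉ e₁ t∉e₁)) (proj₂ (link-≢0 G v (twin′ e₁ ∣e₁∣ t∉e₁))))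
        where
        v≢ : ∀ i → v ≢ replace i
        v≢ i eq with i Fin.≟ t
        ... | yes refl = u≢v (trans (sym (updateAt-updates t τ)) (sym eq))
        ... | no i≢t   = twin-≢ twin′ i i≢t (trans eq (updateAt-minimal i t τ i≢t))
        v-covered : ∀ i → Covered G v (replace i)
        v-covered i with i Fin.≟ t
        ... | yes refl = subst (Covered G v) (sym (updateAt-updates t τ)) (covered-sym G ρ<k cov)
        ... | no i≢t   = subst (Covered G v) (sym (updateAt-minimal i t τ i≢t)) (twin-covered twin′ i i≢t)

-- The potential, the choice of constants, and the count of bad vertices.

module BadVertices where
  open Polynomials
  open Maclaurin
  open NearUniformity
  open Symmetrization
  open Cores
  open Twins
  open import Data.Bool.Base using (Bool; true; false; T; if_then_else_)
  open import Data.Bool.Properties using (T?; ¬-not)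
  open import Data.Product.Base using (_×_; _,_; proj₁; proj₂; ∃-syntax; Σ-syntax)
  open import Data.Sum.Base using (_⊎_; inj₁; inj₂; [_,_]′)
  open import Data.Fin.Base using (Fin; zero; suc; punchIn)
  import Data.Fin.Properties as Fin
  open import Data.Fin.Subset using (Subset; inside; _∈_; _∉_; ∣_∣; ⊤; ∁)
  open import Data.Fin.Subset.Properties using (_∈?_; anySubset?; ⊆⊤; ∣⊤∣≡n; x∈∁p⇒x∉p)
  open import Data.Nat.Base
  open import Data.Nat.Combinatorics using (_C_)
  open import Data.Nat.Properties
  open import Data.Nat.Tactic.RingSolver using (solve-∀)
  open import Data.Vec.Base as Vec using (_[_]≔_; tabulate)
  open import Data.Vec.Properties using ([]≔-updates; []≔-minimal; lookup∘tabulate; lookup⇒[]=)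
  open import Function.Base using (_∘_; const; it)
  open import Function.Definitions using (Injective)
  open import Relation.Binary.PropositionalEquality hiding (J; [_])
  open import Relation.Nullary using (¬_; Dec; yes; no)
  open import Relation.Nullary.Decidable using (_×-dec_; decidable-stable)
  open import Algebra.Properties.CommutativeMonoid.Sum +-0-commutativeMonoid using (sum; sum-cong-≗; ∑-distrib-+; sum-remove)

  covered? : ∀ {r} (G : RGraph r) u v → Dec (Covered G u v)
  covered? G u v = anySubset? (λ e → T? (isEdge G e) ×-dec (u ∈? e) ×-dec (v ∈? e))

  uncovered⇒0 : ∀ {r} (G : RGraph r) {u v} → ¬ Covered G u v → ∀ e → u ∈ e → v ∈ e → indicator G e ≡ 0
  uncovered⇒0 G ¬cov e u∈e v∈e = decidable-stable (_ ≟ 0) λ ≢0 → ¬cov (e , indicator-≢0 G ≢0 , u∈e , v∈e)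

  ∈-[]≔ : ∀ {n} {u : Fin n} z {e} → u ∈ e → u ∈ e [ z ]≔ inside
  ∈-[]≔ {u = u} z {e} u∈e with u Fin.≟ z
  ... | yes refl = []≔-updates e u
  ... | no u≢z   = []≔-minimal e u z u≢z u∈e

  uncovered⇒∂≡0 : ∀ {r} (G : RGraph r) {u v} z → ¬ Covered G u v → ∀ e → u ∈ e → v ∈ e → ∂ z (indicator G) e ≡ 0
  uncovered⇒∂≡0 G z ¬cov e u∈e v∈e with z ∈? e
  ... | yes z∈e = ∂-∈ (indicator G) z∈e
  ... | no z∉e  = trans (∂-∉ z (indicator G) z∉e) (uncovered⇒0 G ¬cov _ (∈-[]≔ z u∈e) (∈-[]≔ z v∈e))

  sum-mono : ∀ {n} {a b : Fin n → ℕ} → (∀ i → a i ≤ b i) → sum a ≤ sum b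
  sum-mono {zero}  a≤b = ≤-refl
  sum-mono {suc n} a≤b = +-mono-≤ (a≤b zero) (sum-mono (a≤b ∘ suc))

  sum-const : ∀ n b → sum {n} (const b) ≡ n * b
  sum-const zero    b = refl
  sum-const (suc n) b = cong (b +_) (sum-const n b)

  sum-*ˡ : ∀ {n} k (a : Fin n → ℕ) → sum (λ i → k * a i) ≡ k * sum a
  sum-*ˡ {zero}  k a = sym (*-zeroʳ k)
  sum-*ˡ {suc n} k a = trans (cong (k * a zero +_) (sum-*ˡ k (a ∘ suc))) (sym (*-distribˡ-+ k (a zero) _))

  weight : Bool → ℕ
  weight b = if b then 1 else 0

  sum-weight : ∀ {n} (b : Fin n → Bool) → sum (weight ∘ b) ≡ ∣ tabulate b ∣
  sum-weight {zero}  b = refl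
  sum-weight {suc n} b with b zero
  ... | true  = cong suc (sum-weight (b ∘ suc))
  ... | false = sum-weight (b ∘ suc)

  χ-image-≤ : ∀ {k n} r {τ : Fin k → Fin n} → Injective _≡_ _≡_ τ → ∀ e → χ r (image τ e) ≤ χ r e
  χ-image-≤ r {τ} inj e with χ r (image τ e) ≟ 0
  ... | yes eq = ≤-trans (≤-reflexive eq) z≤n
  ... | no ≢0  = ≤-reflexive (trans (one (image τ e) ∣image∣≡r) (sym (one e (trans (sym (∣image∣ inj e)) ∣image∣≡r))))
    where
    ∣image∣≡r = χ-∣∣ r (image τ e) ≢0
    one : ∀ {n} (e : Subset n) → ∣ e ∣ ≡ r → χ r e ≡ 1
    one e eq = trans (cong (λ r → χ r e) (sym eq)) (χ-size e)

  -- Indexing by `Fin m` instead of `Fin ∣ U ∣` lets the later estimates speak of m alone.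
  parametrize : ∀ {n m} (U : Subset n) → ∣ U ∣ ≡ m → Σ[ τ ∈ (Fin m → Fin n) ] (Injective _≡_ _≡_ τ ×
    (∀ y → (∀ v → v ∉ U → y v ≡ 0) → sum y ≡ sum (y ∘ τ) × (∀ g → poly g y ≡ poly (g ∘ image τ) (y ∘ τ))))
  parametrize U refl = ι U , ι-injective U , λ y y≡0 → sum-restrict U y y≡0 ,
    λ g → trans (poly-restrict U g y y≡0) (poly-cong (λ e → cong g (embed≡image U e)) (λ _ → refl))

  potential : ∀ {r} (G : RGraph r) → ℕ → Subset (order G) → ℕ
  potential G K e = K * indicator G e + sum (λ z → ∂ z (indicator G) e)

  poly-potential : ∀ {r} (G : RGraph r) K y →
    poly (potential G K) y ≡ K * poly (indicator G) y + sum (λ z → poly (∂ z (indicator G)) y)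
  poly-potential G K y = trans (poly-+ _ _ y) (cong₂ _+_ (poly-* K (indicator G) y) (poly-sum (λ z → ∂ z (indicator G)) y))

  symmetrized : ∀ {r} (G : RGraph r) K → let n = order G; f = indicator G in
    ∃[ U ] Σ[ y ∈ (Fin n → ℕ) ] ((∀ v → v ∉ U → y v ≡ 0) × sum y ≡ n ×
      (r + K) * poly f (const 1) ≤ K * poly f y + sum (λ z → poly (∂ z f) y) ×
      (∀ u v → u ∈ U → v ∈ U → u ≢ v → Covered G u v))
  symmetrized {r} G K =
    let U , y , y≡0 , sum≡ , le , cov = symmetrize (potential G K) (Covered G) (covered? G) uncovered (const 1)
    in U , y , y≡0 , trans sum≡ (trans (sum-const (order G) 1) (*-identityʳ _)) ,
       (begin
         (r + K) * p₁                                        ≡⟨ rearr r K p₁ ⟩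
         K * p₁ + r * p₁                                     ≡⟨ cong (K * p₁ +_) (euler r f (indicator-≤χ G)) ⟨
         K * p₁ + sum (λ z → poly (∂ z f) (const 1))         ≡⟨ poly-potential G K (const 1) ⟨
         poly (potential G K) (const 1)                      ≤⟨ le ⟩
         poly (potential G K) y                              ≡⟨ poly-potential G K y ⟩
         K * poly f y + sum (λ z → poly (∂ z f) y)           ∎) , cov
    where
    open ≤-Reasoning
    f = indicator G
    p₁ = poly f (const 1)
    rearr : ∀ r K p → (r + K) * p ≡ K * p + r * p
    rearr = solve-∀
    uncovered : ∀ {u v} → ¬ Covered G u v → ∀ e → u ∈ e → v ∈ e → potential G K e ≡ 0
    uncovered ¬cov e u∈e v∈e = cong₂ _+_
      (trans (cong (K *_) (uncovered⇒0 G ¬cov e u∈e v∈e)) (*-zeroʳ K))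
      (trans (sum-cong-≗ (λ z → uncovered⇒∂≡0 G z ¬cov e u∈e v∈e)) (trans (sum-const (order G) 0) (*-zeroʳ (order G))))

  links-≤ : ∀ {ρ} (G : RGraph (2 + ρ)) y → sum y ≡ order G →
            sum (λ z → poly (∂ z (indicator G)) y) ≤ order G ^ (2 + ρ)
  links-≤ {ρ} G y sum≡ = ≤-trans (sum-mono bound) (≤-reflexive (sum-const (order G) _))
    where
    bound : ∀ z → poly (∂ z (indicator G)) y ≤ order G ^ (1 + ρ)
    bound z = ≤-trans (poly≤E (1 + ρ) y (∂-≤χ (1 + ρ) z (indicator G) (indicator-≤χ G)))
      (≤-trans (E≤sum^ (1 + ρ) y) (≤-reflexive (cong (_^ (1 + ρ)) sum≡)))

  -- The error allowed in p, N/J after scaling by M, is spent in two halves. Discarding the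
  -- derivative sum costs M N/K = N/(2J) by the choice of K, and the density defect costs N/D ≤
  -- N/(2J).
  arith-value : ∀ r J D M {C N e p Q} .{{_ : NonZero M}} .{{_ : NonZero D}} → let K = 2 * M * J in
    2 * J ≤ D → D * C ≤ D * (M * e) + N → (r + K) * e ≤ K * p + Q → Q ≤ N → J * C ≤ J * (M * p) + N
  arith-value r J D M {C} {N} {e} {p} {Q} 2J≤D dense sym≤ Q≤N = *-cancelˡ-≤ (2 * (M * D)) {{nz}} (begin
    2 * (M * D) * (J * C)                          ≡⟨ rearr₁ M D J C ⟩
    K * (D * C)                                    ≤⟨ *-monoʳ-≤ K dense ⟩
    K * (D * (M * e) + N)                          ≡⟨ rearr₂ K D M e N ⟩
    D * M * (K * e) + K * N                        ≤⟨ +-monoˡ-≤ (K * N) (*-monoʳ-≤ (D * M) (≤-trans (*-monoˡ-≤ e (m≤n+m K r))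
                                                      (≤-trans sym≤ (+-monoʳ-≤ (K * p) Q≤N)))) ⟩
    D * M * (K * p + N) + K * N                    ≡⟨ rearr₃ D M J p N ⟩
    D * M * (K * p + N) + M * N * (2 * J)          ≤⟨ +-monoʳ-≤ (D * M * (K * p + N)) (*-monoʳ-≤ (M * N) 2J≤D) ⟩
    D * M * (K * p + N) + M * N * D                ≡⟨ rearr₄ D M J p N ⟩
    2 * (M * D) * (J * (M * p) + N)                ∎)
    where
    open ≤-Reasoning
    K = 2 * M * J
    nz : NonZero (2 * (M * D))
    nz = m*n≢0 2 (M * D) {{_}} {{m*n≢0 M D}}
    rearr₁ : ∀ M D J C → 2 * (M * D) * (J * C) ≡ 2 * M * J * (D * C)
    rearr₁ = solve-∀
    rearr₂ : ∀ K D M e N → K * (D * (M * e) + N) ≡ D * M * (K * e) + K * N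
    rearr₂ = solve-∀
    rearr₃ : ∀ D M J p N → D * M * (2 * M * J * p + N) + 2 * M * J * N ≡ D * M * (2 * M * J * p + N) + M * N * (2 * J)
    rearr₃ = solve-∀
    rearr₄ : ∀ D M J p N → D * M * (2 * M * J * p + N) + M * N * D ≡ 2 * (M * D) * (J * (M * p) + N)
    rearr₄ = solve-∀

  -- Once p is at most its extremal value c N/M, the part K p of the potential uses up no more than
  -- its share, and r c N/M = q N/m^j is left for Q. The factor r + K in `D` reduces the density
  -- defect to 1/R.
  arith-links : ∀ r K R m mʲ {c q N e p Q} .{{_ : NonZero (r + K)}} .{{_ : NonZero m}} →
    let M = m * mʲ; D = (r + K) * R in
    r * c ≡ m * q → D * (c * N) ≤ D * (M * e) + N → (r + K) * e ≤ K * p + Q → M * p ≤ c * N →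
    R * q * N ≤ R * mʲ * Q + N
  arith-links r K R m mʲ {c} {q} {N} {e} {p} {Q} rc≡mq dense sym≤ p≤ = *-cancelˡ-≤ m (*-cancelˡ-≤ (r + K)
    (+-cancelʳ-≤ (D * K * (c * N)) _ _ (begin
      (r + K) * (m * (R * q * N)) + D * K * (c * N)              ≡⟨ rearr₁ r K R m q N c ⟩
      D * N * (m * q) + D * K * (c * N)                          ≡⟨ cong (λ x → D * N * x + D * K * (c * N)) rc≡mq ⟨
      D * N * (r * c) + D * K * (c * N)                          ≡⟨ rearr₂ r K D c N ⟩
      (r + K) * (D * (c * N))                                    ≤⟨ *-monoʳ-≤ (r + K) dense ⟩
      (r + K) * (D * (M * e) + N)                                ≡⟨ rearr₃ (r + K) D M e N ⟩
      D * M * ((r + K) * e) + (r + K) * N                        ≤⟨ +-monoˡ-≤ _ (*-monoʳ-≤ (D * M) sym≤) ⟩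
      D * M * (K * p + Q) + (r + K) * N                          ≡⟨ rearr₄ D M K p Q (r + K) N ⟩
      D * K * (M * p) + (D * M * Q + (r + K) * N)                ≤⟨ +-mono-≤ (*-monoʳ-≤ (D * K) p≤)
                                                                     (+-monoʳ-≤ (D * M * Q) (*-monoʳ-≤ (r + K) (m≤n*m N m))) ⟩
      D * K * (c * N) + (D * M * Q + (r + K) * (m * N))          ≡⟨ rearr₅ (r + K) R K m mʲ Q N c ⟩
      (r + K) * (m * (R * mʲ * Q + N)) + D * K * (c * N)         ∎)))
    where
    open ≤-Reasoning
    M = m * mʲ
    D = (r + K) * R
    rearr₁ : ∀ r K R m q N c → (r + K) * (m * (R * q * N)) + (r + K) * R * K * (c * N)
      ≡ (r + K) * R * N * (m * q) + (r + K) * R * K * (c * N)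
    rearr₁ = solve-∀
    rearr₂ : ∀ r K D c N → D * N * (r * c) + D * K * (c * N) ≡ (r + K) * (D * (c * N))
    rearr₂ = solve-∀
    rearr₃ : ∀ k D M e N → k * (D * (M * e) + N) ≡ D * M * (k * e) + k * N
    rearr₃ = solve-∀
    rearr₄ : ∀ D M K p Q k N → D * M * (K * p + Q) + k * N ≡ D * K * (M * p) + (D * M * Q + k * N)
    rearr₄ = solve-∀
    rearr₅ : ∀ k R K m mʲ Q N c → k * R * K * (c * N) + (k * R * (m * mʲ) * Q + k * (m * N))
      ≡ k * (m * (R * mʲ * Q + N)) + k * R * K * (c * N)
    rearr₅ = solve-∀

  -- A deficit of M N/J cannot fit into an allowance of N/(Y J). It refutes both a missing r-set in
  -- T, with `J₂` for `J`, and a set U of more than m vertices, with `J₁ * r !` for `J`.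
  arith-gap : ∀ J Y M {C p N} → 1 ≤ N → 1 ≤ Y → 2 ≤ M → J * (M * p) + M * N ≤ J * C →
              ¬ (Y * J * C ≤ Y * J * (M * p) + N)
  arith-gap J Y M {C} {p} {N} 1≤N 1≤Y 2≤M gap le = <⇒≱ (begin-strict
    N             <⟨ m<m+n N 1≤N ⟩
    N + N         ≡⟨ cong (N +_) (+-identityʳ N) ⟨
    2 * N         ≤⟨ *-monoˡ-≤ N 2≤M ⟩
    M * N         ≤⟨ m≤n*m (M * N) Y {{>-nonZero 1≤Y}} ⟩
    Y * (M * N)   ∎)
    (+-cancelˡ-≤ (Y * J * (M * p)) _ _ (begin
      Y * J * (M * p) + Y * (M * N)  ≡⟨ rearr Y J (M * p) (M * N) ⟩
      Y * (J * (M * p) + M * N)      ≤⟨ *-monoʳ-≤ Y gap ⟩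
      Y * (J * C)                    ≡⟨ *-assoc Y J C ⟨
      Y * J * C                      ≤⟨ le ⟩
      Y * J * (M * p) + N            ∎))
    where
    open ≤-Reasoning
    rearr : ∀ Y J a b → Y * J * a + Y * b ≡ Y * (J * a + b)
    rearr = solve-∀

  C>0 : ∀ {n k} → k ≤ n → 1 ≤ n C k
  C>0 {n}     {zero}  z≤n       = ≤-refl
  C>0 {suc n} {suc k} (s≤s k≤n) = n≢0⇒n>0 λ eq → <⇒≢ (C>0 k≤n) (sym (m+n≡0⇒m≡0 (n C k)
    (trans (sym (suc*C k n)) (trans (cong (suc k *_) eq) (*-zeroʳ (suc k))))))

  -- 1 / N₀ is the allowed proportion of bad vertices and 1 / J₁ a lower bound for
  -- [m]_r / m^r − π_λ(F).  The maximum of p at total weight n is c n^r / M; R W and J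
  -- are the precisions to which y is uniform and p(y) maximal, K is the weight of p
  -- in the potential, and 1 / D bounds the density defect of G.
  module Constants (κ ρ N₀ J₁ : ℕ) where
    m = 2 + κ
    k = 1 + κ
    r = 2 + ρ
    j = 1 + ρ
    c = m C r
    q = k C j
    M = m ^ r
    W = q * j * m ^ ρ
    -- A bad vertex loses at least (n/2m)^j. Scaled by R m^j this is 2 N₀ n^j, to be set against a
    -- total slack of 2 n^r.
    R = 2 ^ j * (2 * N₀)
    -- Weights are at least n/(2m), so a missing r-set of T loses at least n^r/J₂.
    J₂ = (2 * m) ^ r
    -- The squares are the precision that `near-uniform` consumes. Of the last two factors, one is
    -- the `J` of `arith-gap` in each of its two uses, and everything else in the product becomes
    -- `Y`.
    J = (R * W) * (R * W) * (k * k) * (J₂ * (J₁ * r !))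
    K = 2 * M * J
    D = (r + K) * R

  module Core (κ ρ N₀ J₁ : ℕ) .{{_ : NonZero N₀}} .{{_ : NonZero J₁}} (ρ≤κ : ρ ≤ κ)
      {F G : RGraph (2 + ρ)} (free : 𝒦 F (3 + κ) -Free G)
      (hyp : order F ≤ 2 + κ ⊎ (order F ≡ 3 + κ × ∃[ v ] (degree F v ≡ 1))) where
    open Constants κ ρ N₀ J₁

    private
      instance
        R≢0 : NonZero R
        R≢0 = m*n≢0 (2 ^ j) (2 * N₀) {{m^n≢0 2 j}} {{m*n≢0 2 N₀}}

        W≢0 : NonZero W
        W≢0 = m*n≢0 (q * j) (m ^ ρ) {{m*n≢0 q j {{>-nonZero (C>0 (s≤s ρ≤κ))}}}} {{m^n≢0 m ρ}}

        M≢0 : NonZero M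
        M≢0 = m^n≢0 m r

        J₁r!≢0 : NonZero (J₁ * r !)
        J₁r!≢0 = m*n≢0 J₁ (r !) {{it}} {{r !≢0}}

        J₂≢0 : NonZero J₂
        J₂≢0 = m^n≢0 (2 * m) r

        RW≢0 : NonZero (R * W)
        RW≢0 = m*n≢0 R W

        RW²k²≢0 : NonZero ((R * W) * (R * W) * (k * k))
        RW²k²≢0 = m*n≢0 ((R * W) * (R * W)) (k * k) {{m*n≢0 (R * W) (R * W)}}

        D≢0 : NonZero D
        D≢0 = m*n≢0 (r + K) R

      1≤c : 1 ≤ c
      1≤c = C>0 (s≤s (s≤s ρ≤κ))

      2≤^ : ∀ a b → 2 ≤ a → 2 ≤ a ^ suc b
      2≤^ a b 2≤a = ≤-trans 2≤a (m≤m*n a (a ^ b) {{m^n≢0 a b {{>-nonZero (≤-trans (s≤s z≤n) 2≤a)}}}})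

      2≤M : 2 ≤ M
      2≤M = 2≤^ m (1 + ρ) (s≤s (s≤s z≤n))

      2≤RW : 2 ≤ R * W
      2≤RW = ≤-trans (≤-trans (2≤^ 2 ρ ≤-refl) (m≤m*n (2 ^ j) (2 * N₀) {{m*n≢0 2 N₀}})) (m≤m*n R W)

      2≤J₂J₁r! : 2 ≤ J₂ * (J₁ * r !)
      2≤J₂J₁r! = ≤-trans (2≤^ (2 * m) (1 + ρ) (m≤m*n 2 m)) (m≤m*n J₂ (J₁ * r !))

      2J≤D : 2 * J ≤ D
      2J≤D = ≤-trans (*-monoˡ-≤ J (m≤m*n 2 M)) (≤-trans (m≤n+m K r) (m≤m*n (r + K) R))

      rc≡mq : r * c ≡ m * q
      rc≡mq = suc*C j k

    n : ℕ
    n = order G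

    f : Subset n → ℕ
    f = indicator G

    value-≤ : (y : Fin n → ℕ) (τ : Fin m → Fin n) → Injective _≡_ _≡_ τ → sum (y ∘ τ) ≡ n →
      poly f y ≡ poly (f ∘ image τ) (y ∘ τ) → M * poly f y ≤ c * n ^ r
    value-≤ y τ τ-inj sum-w poly-τ = begin
      M * poly f y                       ≡⟨ cong (M *_) poly-τ ⟩
      M * poly (f ∘ image τ) (y ∘ τ)     ≤⟨ *-monoʳ-≤ M (poly≤E r (y ∘ τ) (λ e → ≤-trans (indicator-≤χ G (image τ e)) (χ-image-≤ r τ-inj e))) ⟩
      M * E r (y ∘ τ)                    ≤⟨ maclaurin r m (y ∘ τ) ⟩
      c * sum (y ∘ τ) ^ r                ≡⟨ cong (λ N → c * N ^ r) sum-w ⟩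
      c * n ^ r                          ∎
      where open ≤-Reasoning

    module _ (m≤n : m ≤ n) (y : Fin n → ℕ)
      (value : J * (c * n ^ r) ≤ J * (M * poly f y) + n ^ r)
      (links : R * q * n ^ r ≤ R * m ^ j * sum (λ z → poly (∂ z f) y) + n ^ r)
      (τ : Fin m → Fin n) (τ-inj : Injective _≡_ _≡_ τ)
      (sum-w : sum (y ∘ τ) ≡ n) (poly-τ : ∀ g → poly g y ≡ poly (g ∘ image τ) (y ∘ τ)) where
      private
        1≤n : 1 ≤ n
        1≤n = ≤-trans (s≤s z≤n) m≤n

        1≤n^ : ∀ i → 1 ≤ n ^ i
        1≤n^ i = m^n>0 n {{>-nonZero 1≤n}} i

        w : Fin m → ℕ
        w = y ∘ τ

        p : ℕ
        p = poly f y

        f≤χ : ∀ e → f (image τ e) ≤ χ r e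
        f≤χ e = ≤-trans (indicator-≤χ G _) (χ-image-≤ r τ-inj e)

        p≤E : p ≤ E r w
        p≤E = ≤-trans (≤-reflexive (poly-τ f)) (poly≤E r w f≤χ)

        near : ∀ t → R * W * (m * sum (w ∘ punchIn t)) ≤ R * W * (k * sum w) + sum w
        near t = near-uniform κ ρ (R * W) (J₂ * (J₁ * r !)) p w t (subst (1 ≤_) (sym sum-w) 1≤n) 1≤c 2≤J₂J₁r! p≤E
          (subst (λ N → J * (c * N ^ r) ≤ J * (M * p) + N ^ r) (sym sum-w) value)

        w-≥ : ∀ t → n ≤ 2 * m * w t
        w-≥ t = ≤-trans (≤-reflexive (sym sum-w)) (weight-≥ k (R * W) {sum w} {w t} {sum (w ∘ punchIn t)} (sum-remove {i = t} w) (near t) 2≤RW)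

        clique : ∀ e → ∣ e ∣ ≡ r → Edge G (image τ e)
        clique e ∣e∣ = decidable-stable (T? _) λ e∉G → arith-gap J₂ ((R * W) * (R * W) * (k * k) * (J₁ * r !)) M
          (1≤n^ r) (>-nonZero⁻¹ _ {{m*n≢0 ((R * W) * (R * W) * (k * k)) (J₁ * r !)}}) 2≤M (missing e∉G)
          (subst (λ J → J * (c * n ^ r) ≤ J * (M * p) + n ^ r) (rearr ((R * W) * (R * W) * (k * k)) J₂ (J₁ * r !)) value)
          where
          open ≤-Reasoning
          rearr : ∀ a b c → a * (b * c) ≡ a * c * b
          rearr = solve-∀
          rearr₂ : ∀ J M p d → J * (M * p) + M * (J * d) ≡ J * (M * (p + d))
          rearr₂ = solve-∀
          missing : ¬ Edge G (image τ e) → J₂ * (M * p) + M * n ^ r ≤ J₂ * (c * n ^ r)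
          missing e∉G = begin
            J₂ * (M * p) + M * n ^ r
              ≤⟨ +-monoʳ-≤ (J₂ * (M * p)) (*-monoʳ-≤ M (subst (λ r → n ^ r ≤ (2 * m) ^ r * poly (δ e) w) ∣e∣
                   (poly-δ-≥ e w (2 * m) n (λ {i} _ → w-≥ i)))) ⟩
            J₂ * (M * p) + M * (J₂ * poly (δ e) w)
              ≡⟨ rearr₂ J₂ M p (poly (δ e) w) ⟩
            J₂ * (M * (p + poly (δ e) w))
              ≡⟨ cong (λ p → J₂ * (M * (p + poly (δ e) w))) (poly-τ f) ⟩
            J₂ * (M * (poly (f ∘ image τ) w + poly (δ e) w))
              ≤⟨ *-monoʳ-≤ J₂ (*-monoʳ-≤ M (poly+δ≤E r w e f≤χ
                   (decidable-stable (_ ≟ 0) (λ ≢0 → e∉G (indicator-≢0 G ≢0))) ∣e∣)) ⟩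
            J₂ * (M * E r w)
              ≤⟨ *-monoʳ-≤ J₂ (maclaurin r m w) ⟩
            J₂ * (c * sum w ^ r)
              ≡⟨ cong (λ N → J₂ * (c * N ^ r)) sum-w ⟩
            J₂ * (c * n ^ r) ∎

      open LocalStructure (s≤s ρ≤κ) free hyp τ τ-inj clique

      private
        twin : Fin n → Fin m
        twin z = proj₁ (avoided z)

        bad : Fin n → Bool
        bad z = [ const false , const true ]′ (twin? z (twin z))

        S : Subset n
        S = tabulate bad

        link≤χ : ∀ z e → link z e ≤ χ j e
        link≤χ z e = ≤-trans (∂-≤χ j z f (indicator-≤χ G) (image τ e)) (χ-image-≤ j τ-inj e)

        E-bound : ∀ t → R * (m ^ j * E j (w ∘ punchIn t)) ≤ (R * q + 1) * n ^ j
        E-bound t = subst (λ N → R * (m ^ j * E j (w ∘ punchIn t)) ≤ (R * q + 1) * N ^ j) sum-w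
          (E-punchIn-bound κ ρ R w t (near t))

        -- For every vertex D z is bounded by the extremal value, up to the error n^j of `E-bound`.
        -- For a bad vertex `twin?` returns a missing set that avoids its class `t`, and `R` is
        -- chosen so that this set costs 2 N₀ n^j.
        link-bound : ∀ z → R * m ^ j * poly (∂ z f) y + 2 * N₀ * n ^ j * weight (bad z) ≤ (R * q + 1) * n ^ j
        link-bound z = subst (λ x → R * m ^ j * x + 2 * N₀ * n ^ j * weight (bad z) ≤ (R * q + 1) * n ^ j)
          (sym (poly-τ (∂ z f))) (by-cases (twin? z (twin z)))
          where
          open ≤-Reasoning
          t = twin z
          by-cases : (s : Twin z t ⊎ ∃[ e ] (∣ e ∣ ≡ suc ρ × t ∉ e × link z e ≡ 0)) →
            R * m ^ j * poly (link z) w + 2 * N₀ * n ^ j * weight ([ const false , const true ]′ s) ≤ (R * q + 1) * n ^ j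
          by-cases (inj₁ _) = begin
            R * m ^ j * poly (link z) w + 2 * N₀ * n ^ j * 0
              ≡⟨ cong (R * m ^ j * poly (link z) w +_) (*-zeroʳ (2 * N₀ * n ^ j)) ⟩
            R * m ^ j * poly (link z) w + 0
              ≡⟨ trans (+-identityʳ _) (*-assoc R (m ^ j) _) ⟩
            R * (m ^ j * poly (link z) w)
              ≤⟨ *-monoʳ-≤ R (*-monoʳ-≤ (m ^ j) (link-≤E (link z) w t (link≤χ z) (proj₂ (avoided z)))) ⟩
            R * (m ^ j * E j (w ∘ punchIn t))
              ≤⟨ E-bound t ⟩
            (R * q + 1) * n ^ j ∎
          by-cases (inj₂ (e , ∣e∣ , t∉e , eq)) = begin
            R * m ^ j * poly (link z) w + 2 * N₀ * n ^ j * 1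
              ≡⟨ rearr (2 ^ j) (2 * N₀) (m ^ j) (poly (link z) w) (n ^ j) ⟩
            2 * N₀ * (2 ^ j * m ^ j * poly (link z) w + n ^ j)
              ≡⟨ cong (λ x → 2 * N₀ * (x * poly (link z) w + n ^ j)) (^-* 2 m j) ⟨
            2 * N₀ * ((2 * m) ^ j * poly (link z) w + n ^ j)
              ≤⟨ *-monoʳ-≤ (2 * N₀) (link+^≤E (link z) w t (link≤χ z) (proj₂ (avoided z)) (2 * m) n e w-≥ ∣e∣ t∉e eq) ⟩
            2 * N₀ * ((2 * m) ^ j * E j (w ∘ punchIn t))
              ≡⟨ cong (λ x → 2 * N₀ * (x * E j (w ∘ punchIn t))) (^-* 2 m j) ⟩
            2 * N₀ * (2 ^ j * m ^ j * E j (w ∘ punchIn t))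
              ≡⟨ rearr₂ (2 * N₀) (2 ^ j) (m ^ j) (E j (w ∘ punchIn t)) ⟩
            R * (m ^ j * E j (w ∘ punchIn t))
              ≤⟨ E-bound t ⟩
            (R * q + 1) * n ^ j ∎
            where
            rearr : ∀ a b m p n → a * b * m * p + b * n * 1 ≡ b * (a * m * p + n)
            rearr = solve-∀
            rearr₂ : ∀ b a m e → b * (a * m * e) ≡ a * b * (m * e)
            rearr₂ = solve-∀

        -- The slack is n^r from summing `E-bound` over all n vertices and another n^r from `links`.
        -- Each bad vertex uses up 2 N₀ n^j of these 2 n^r.
        ∣S∣-bound : N₀ * ∣ S ∣ ≤ n
        ∣S∣-bound = *-cancelˡ-≤ (2 * n ^ j) {{m*n≢0 2 (n ^ j) {{_}} {{>-nonZero (1≤n^ j)}}}}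
          (+-cancelˡ-≤ (R * m ^ j * Q) _ _ (begin
            R * m ^ j * Q + 2 * n ^ j * (N₀ * ∣ S ∣)
              ≡⟨ cong (R * m ^ j * Q +_) (rearr (n ^ j) N₀ ∣ S ∣) ⟩
            R * m ^ j * Q + 2 * N₀ * n ^ j * ∣ S ∣
              ≡⟨ cong (λ s → R * m ^ j * Q + 2 * N₀ * n ^ j * s) (sum-weight bad) ⟨
            R * m ^ j * Q + 2 * N₀ * n ^ j * sum (weight ∘ bad)
              ≡⟨ cong₂ _+_ (sum-*ˡ (R * m ^ j) (λ z → poly (∂ z f) y)) (sum-*ˡ (2 * N₀ * n ^ j) (weight ∘ bad)) ⟨
            sum (λ z → R * m ^ j * poly (∂ z f) y) + sum (λ z → 2 * N₀ * n ^ j * weight (bad z))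
              ≡⟨ ∑-distrib-+ (λ z → R * m ^ j * poly (∂ z f) y) (λ z → 2 * N₀ * n ^ j * weight (bad z)) ⟨
            sum (λ z → R * m ^ j * poly (∂ z f) y + 2 * N₀ * n ^ j * weight (bad z))
              ≤⟨ sum-mono link-bound ⟩
            sum {n} (const ((R * q + 1) * n ^ j))
              ≡⟨ sum-const n _ ⟩
            n * ((R * q + 1) * n ^ j)
              ≡⟨ rearr₂ n (R * q) (n ^ j) ⟩
            R * q * n ^ r + n ^ r
              ≤⟨ +-monoˡ-≤ (n ^ r) links ⟩
            R * m ^ j * Q + n ^ r + n ^ r
              ≡⟨ rearr₃ (R * m ^ j * Q) n (n ^ j) ⟩
            R * m ^ j * Q + 2 * n ^ j * n ∎))
          where
          open ≤-Reasoning
          Q = sum (λ z → poly (∂ z f) y)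
          rearr : ∀ n N s → 2 * n * (N * s) ≡ 2 * N * n * s
          rearr = solve-∀
          rearr₂ : ∀ n a b → n * ((a + 1) * b) ≡ a * (n * b) + n * b
          rearr₂ = solve-∀
          rearr₃ : ∀ a n b → a + n * b + n * b ≡ a + 2 * b * n
          rearr₃ = solve-∀

        bad-false : ∀ z → z ∈ ∁ S → bad z ≡ false
        bad-false z z∈∁S = ¬-not λ eq →
          x∈∁p⇒x∉p z∈∁S (lookup⇒[]= z S (trans (lookup∘tabulate bad z) eq))

        good⇒twin : ∀ z → z ∈ ∁ S → Twin z (twin z)
        good⇒twin z z∈∁S = by-cases (twin? z (twin z)) (bad-false z z∈∁S)
          where
          by-cases : (s : Twin z (twin z) ⊎ ∃[ e ] (∣ e ∣ ≡ suc ρ × twin z ∉ e × link z e ≡ 0)) →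
            [ const false , const true ]′ s ≡ false → Twin z (twin z)
          by-cases (inj₁ tw) _ = tw

      few-bad-vertices : ∃[ S ] (N₀ * ∣ S ∣ ≤ n × Partite m (G [ ∁ S ]))
      few-bad-vertices = S , ∣S∣-bound , twin ∘ ι (∁ S) , λ e e∈G u v u∈e v∈e same →
        ι-injective (∁ S) (decidable-stable (ι (∁ S) u Fin.≟ ι (∁ S) v) λ u≢v →
          twins-uncovered (good⇒twin _ (ι-∈ (∁ S) u))
            (subst (Twin (ι (∁ S) v)) (sym same) (good⇒twin _ (ι-∈ (∁ S) v))) u≢v
            (embed (∁ S) e , e∈G , embed-∈⁺ (∁ S) u∈e , embed-∈⁺ (∁ S) v∈e))

    -- Vertices of weight 0 fill up `U` to exactly m vertices, so that Maclaurin's inequality is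
    -- applied with m variables even if `U` is smaller.
    extend-core : m ≤ n → (U : Subset n) (y : Fin n → ℕ) → (∀ v → v ∉ U → y v ≡ 0) → sum y ≡ n → ∣ U ∣ ≤ m →
      Σ[ τ ∈ (Fin m → Fin n) ] (Injective _≡_ _≡_ τ × sum (y ∘ τ) ≡ n × (∀ g → poly g y ≡ poly (g ∘ image τ) (y ∘ τ)))
    extend-core m≤n U y y≡0 sum≡ ∣U∣≤m with intermediate U ⊤ ⊆⊤ ∣U∣≤m (≤-trans m≤n (≤-reflexive (sym (∣⊤∣≡n n))))
    ... | T , U⊆T , _ , ∣T∣ with parametrize T ∣T∣
    ...   | τ , τ-inj , restrict with restrict y (λ v v∉T → y≡0 v (λ v∈U → v∉T (U⊆T v∈U)))
    ...     | sum-τ , poly-τ = τ , τ-inj , trans (sym sum-τ) sum≡ , poly-τ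

    size-≤ : 1 ≤ n → (U : Subset n) (y : Fin n → ℕ) → (∀ v → v ∉ U → y v ≡ 0) → sum y ≡ n →
      (∀ u v → u ∈ U → v ∈ U → u ≢ v → Covered G u v) →
      (∀ H → ¬ (F ⊑ H) → (w : Fin (order H) → ℕ) → sum w ≡ n →
        J₁ * r ! * (M * poly (indicator H) w) + M * n ^ r ≤ J₁ * r ! * (c * n ^ r)) →
      J * (c * n ^ r) ≤ J * (M * poly f y) + n ^ r → ∣ U ∣ ≤ m
    size-≤ 1≤n U y y≡0 sum≡ cov sparse value = ≮⇒≥ λ m<∣U∣ →
      arith-gap (J₁ * r !) ((R * W) * (R * W) * (k * k) * J₂) M
        (m^n>0 n {{>-nonZero 1≤n}} r)
        (>-nonZero⁻¹ _ {{m*n≢0 ((R * W) * (R * W) * (k * k)) J₂}}) 2≤M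
        (subst (λ p → J₁ * r ! * (M * p) + M * n ^ r ≤ J₁ * r ! * (c * n ^ r)) (sym (poly-restrict U f y y≡0))
          (sparse (G [ U ]) (covered⇒F-free free U ([ m≤n⇒m≤1+n , ≤-reflexive ∘ proj₁ ]′ hyp) m<∣U∣ cov) (y ∘ ι U)
            (trans (sym (sum-restrict U y y≡0)) sum≡)))
        (subst (λ J → J * (c * n ^ r) ≤ J * (M * poly f y) + n ^ r)
          (sym (*-assoc ((R * W) * (R * W) * (k * k)) J₂ (J₁ * r !))) value)

    stable : m ≤ n →
      D * (c * n ^ r) ≤ D * (M * poly f (const 1)) + n ^ r →
      (∀ H → ¬ (F ⊑ H) → (w : Fin (order H) → ℕ) → sum w ≡ n →
        J₁ * r ! * (M * poly (indicator H) w) + M * n ^ r ≤ J₁ * r ! * (c * n ^ r)) →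
      ∃[ S ] (N₀ * ∣ S ∣ ≤ n × Partite m (G [ ∁ S ]))
    stable m≤n dense sparse =
      let U , y , y≡0 , sum≡ , sym≤ , cov = symmetrized G K
          -- Here only the trivial bound on the derivative sum is available. The sharp `links` below
          -- has to wait for ∣ U ∣ ≤ m, which `size-≤` derives from `value`.
          value = arith-value r J D M {c * n ^ r} {n ^ r} {poly f (const 1)} {poly f y} {sum (λ z → poly (∂ z f) y)}
                    2J≤D dense sym≤ (links-≤ G y sum≡)
          τ , τ-inj , sum-w , poly-τ = extend-core m≤n U y y≡0 sum≡
            (size-≤ (≤-trans (s≤s z≤n) m≤n) U y y≡0 sum≡ cov sparse value)
          links = arith-links r K R m (m ^ j) {c} {q} {n ^ r} {poly f (const 1)} {poly f y} {sum (λ z → poly (∂ z f) y)}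
                    rc≡mq dense sym≤ (value-≤ y τ τ-inj sum-w (poly-τ f))
      in few-bad-vertices m≤n y value links τ τ-inj sum-w poly-τ

-- Natural numbers inside ℚ, and the same polynomials at rational points.

module RationalPolynomials where
  open Polynomials
  open import Data.Maybe.Base using (just; nothing)
  open import Data.Fin.Base using (Fin; zero; suc)
  open import Data.Fin.Subset using (Subset; inside; outside)
  import Data.Integer.Base as ℤ
  import Data.Integer.Properties as ℤ
  open import Data.Integer.Base using (+_)
  import Data.Nat.Base as ℕ
  open ℕ using (ℕ; zero; suc; s≤s; z≤n)
  import Data.Nat.Properties as ℕ
  open import Data.Nat.Coprimality using (1-coprimeTo) renaming (sym to coprime-sym)
  open import Data.Product.Base using (_,_; ∃-syntax)
  open import Data.Rational.Base as ℚ using (ℚ; mkℚ; 0ℚ; 1ℚ; _/_; _+_; _*_; _≤_; _<_; ∣_∣; *≤*; *<*)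
  import Data.Rational.Properties as ℚ
  import Data.Rational.Unnormalised.Base as ℚᵘ
  import Data.Rational.Unnormalised.Properties as ℚᵘ
  open import Data.Vec.Base using ([]; _∷_)
  open import Data.Sum.Base using (inj₁; inj₂)
  open import Function.Base using (_∘_)
  open import Relation.Binary.PropositionalEquality hiding (J; [_])
  open import Tactic.RingSolver using (solve-∀)
  open import Tactic.RingSolver.Core.AlmostCommutativeRing using (AlmostCommutativeRing; fromCommutativeRing)

  ℚ-ring : AlmostCommutativeRing _ _
  ℚ-ring = fromCommutativeRing ℚ.+-*-commutativeRing λ { (mkℚ (+ 0) 0 _) → just refl ; _ → nothing }

  ⌜_⌝ : ℕ → ℚ
  ⌜ n ⌝ = + n / 1

  ⌜⌝≡ : ∀ n → ⌜ n ⌝ ≡ mkℚ (+ n) 0 (coprime-sym (1-coprimeTo n))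
  ⌜⌝≡ n = ℚ.↥p/↧p≡p (mkℚ (+ n) 0 (coprime-sym (1-coprimeTo n)))

  ⌜⌝-+ : ∀ a b → ⌜ a ℕ.+ b ⌝ ≡ ⌜ a ⌝ + ⌜ b ⌝
  ⌜⌝-+ a b = trans (cong (_/ 1) (sym (cong₂ ℤ._+_ (ℤ.*-identityʳ (+ a)) (ℤ.*-identityʳ (+ b)))))
    (sym (cong₂ _+_ (⌜⌝≡ a) (⌜⌝≡ b)))

  ⌜⌝-* : ∀ a b → ⌜ a ℕ.* b ⌝ ≡ ⌜ a ⌝ * ⌜ b ⌝
  ⌜⌝-* a b = trans (cong (_/ 1) (ℤ.pos-* a b)) (sym (cong₂ _*_ (⌜⌝≡ a) (⌜⌝≡ b)))

  ⌜⌝-mono : ∀ {a b} → a ℕ.≤ b → ⌜ a ⌝ ≤ ⌜ b ⌝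
  ⌜⌝-mono {a} {b} a≤b = subst₂ _≤_ (sym (⌜⌝≡ a)) (sym (⌜⌝≡ b))
    (*≤* (ℤ.*-monoʳ-≤-nonNeg (+ 1) (ℤ.+≤+ a≤b)))

  ⌜⌝-cancel-≤ : ∀ {a b} → ⌜ a ⌝ ≤ ⌜ b ⌝ → a ℕ.≤ b
  ⌜⌝-cancel-≤ {a} {b} le with subst₂ _≤_ (⌜⌝≡ a) (⌜⌝≡ b) le
  ... | *≤* le′ = ℤ.drop‿+≤+ (ℤ.*-cancelʳ-≤-pos (+ a) (+ b) (+ 1) le′)

  ⌜⌝-cancel-< : ∀ {a b} → ⌜ a ⌝ < ⌜ b ⌝ → a ℕ.< b
  ⌜⌝-cancel-< lt = ℕ.≰⇒> λ b≤a → ℚ.<-irrefl refl (ℚ.<-≤-trans lt (⌜⌝-mono b≤a))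

  0≤⌜⌝ : ∀ n → 0ℚ ≤ ⌜ n ⌝
  0≤⌜⌝ n = ⌜⌝-mono {0} {n} z≤n

  /-*⌜⌝ : ∀ a b .{{_ : ℕ.NonZero b}} → (+ a / b) * ⌜ b ⌝ ≡ ⌜ a ⌝
  /-*⌜⌝ a b@(suc b-1) = ℚ.toℚᵘ-injective (ℚᵘ.≃-trans (ℚ.toℚᵘ-homo-* (+ a / b) ⌜ b ⌝)
    (ℚᵘ.≃-trans (ℚᵘ.*-cong (ℚ.toℚᵘ-fromℚᵘ (ℚᵘ.mkℚᵘ (+ a) b-1)) (ℚ.toℚᵘ-fromℚᵘ (ℚᵘ.mkℚᵘ (+ b) 0)))
      (ℚᵘ.≃-trans (ℚᵘ.*≡* eq) (ℚᵘ.≃-sym (ℚ.toℚᵘ-fromℚᵘ (ℚᵘ.mkℚᵘ (+ a) 0))))))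
    where
    eq : + a ℤ.* + b ℤ.* + 1 ≡ + a ℤ.* (+ b ℤ.* + 1)
    eq = ℤ.*-assoc (+ a) (+ b) (+ 1)

  -- The number 1/(i + 1), given in lowest terms so that it is visibly positive.
  κ : ℕ → ℚ
  κ i = mkℚ (+ 1) i (1-coprimeTo (suc i))

  ⌜⌝*κ : ∀ i → ⌜ suc i ⌝ * κ i ≡ 1ℚ
  ⌜⌝*κ i = trans (cong (_* κ i) (⌜⌝≡ (suc i))) (ℚ.*-inverseʳ (mkℚ (+ suc i) 0 (coprime-sym (1-coprimeTo (suc i)))))

  0≤κ : ∀ i → 0ℚ ≤ κ i
  0≤κ i = ℚ.<⇒≤ (ℚ.positive⁻¹ (κ i))

  mul-mono : ∀ {a b c d} → 0ℚ ≤ b → 0ℚ ≤ c → a ≤ b → c ≤ d → a * c ≤ b * d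
  mul-mono {a} {b} {c} {d} 0≤b 0≤c a≤b c≤d =
    ℚ.≤-trans (ℚ.*-monoʳ-≤-nonNeg c {{ℚ.nonNegative 0≤c}} a≤b) (ℚ.*-monoˡ-≤-nonNeg b {{ℚ.nonNegative 0≤b}} c≤d)

  0≤* : ∀ {a b} → 0ℚ ≤ a → 0ℚ ≤ b → 0ℚ ≤ a * b
  0≤* {a} {b} 0≤a 0≤b = ℚ.nonNegative⁻¹ _ {{ℚ.nonNeg*nonNeg⇒nonNeg a {{ℚ.nonNegative 0≤a}} b {{ℚ.nonNegative 0≤b}}}}

  archimedean : ∀ c ε → 0ℚ < ε → ∃[ N ] (∀ i → N ℕ.≤ i → ⌜ c ⌝ * κ i ≤ ε)
  archimedean c (mkℚ (+ 0) d _) (*<* (ℤ.+<+ ()))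
  archimedean c (mkℚ ℤ.-[1+ n ] d _) (*<* ())
  -- A positive fraction with denominator d + 1 is at least `κ d`, so i ≥ c (d + 1) is far enough.
  archimedean c ε@(mkℚ ℤ.+[1+ n ] d _) 0<ε = c ℕ.* suc d , λ i N≤i → begin
    ⌜ c ⌝ * κ i                        ≡⟨ trans (cong (⌜ c ⌝ * κ i *_) (⌜⌝*κ d)) (ℚ.*-identityʳ (⌜ c ⌝ * κ i)) ⟨
    ⌜ c ⌝ * κ i * (⌜ suc d ⌝ * κ d)    ≡⟨ rearr ⌜ c ⌝ (κ i) ⌜ suc d ⌝ (κ d) ⟩
    ⌜ c ⌝ * ⌜ suc d ⌝ * κ i * κ d      ≡⟨ cong (λ x → x * κ i * κ d) (⌜⌝-* c (suc d)) ⟨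
    ⌜ c ℕ.* suc d ⌝ * κ i * κ d        ≤⟨ ℚ.*-monoʳ-≤-nonNeg (κ d) (ℚ.*-monoʳ-≤-nonNeg (κ i) (⌜⌝-mono (ℕ.m≤n⇒m≤1+n N≤i))) ⟩
    ⌜ suc i ⌝ * κ i * κ d              ≡⟨ trans (cong (_* κ d) (⌜⌝*κ i)) (ℚ.*-identityˡ (κ d)) ⟩
    κ d                                ≤⟨ *≤* (ℤ.*-monoʳ-≤-nonNeg (+ suc d) (ℤ.+≤+ (s≤s (z≤n {n})))) ⟩
    ε                                  ∎
    where
    open ℚ.≤-Reasoning
    rearr : ∀ a b c d → a * b * (c * d) ≡ a * c * b * d
    rearr = solve-∀ ℚ-ring

  _^ℚ_ : ℚ → ℕ → ℚ
  x ^ℚ zero  = 1ℚ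
  x ^ℚ suc r = x * x ^ℚ r

  ⌜⌝-^ : ∀ a r → ⌜ a ℕ.^ r ⌝ ≡ ⌜ a ⌝ ^ℚ r
  ⌜⌝-^ a zero    = refl
  ⌜⌝-^ a (suc r) = trans (⌜⌝-* a (a ℕ.^ r)) (cong (⌜ a ⌝ *_) (⌜⌝-^ a r))

  ⌜⌝^*κ^ : ∀ i r → ⌜ suc i ⌝ ^ℚ r * κ i ^ℚ r ≡ 1ℚ
  ⌜⌝^*κ^ i zero    = refl
  ⌜⌝^*κ^ i (suc r) = trans (rearr ⌜ suc i ⌝ (⌜ suc i ⌝ ^ℚ r) (κ i) (κ i ^ℚ r)) (cong₂ _*_ (⌜⌝*κ i) (⌜⌝^*κ^ i r))
    where
    rearr : ∀ a b c d → a * b * (c * d) ≡ a * c * (b * d)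
    rearr = solve-∀ ℚ-ring

  0≤^ : ∀ {x} r → 0ℚ ≤ x → 0ℚ ≤ x ^ℚ r
  0≤^ zero    0≤x = 0≤⌜⌝ 1
  0≤^ (suc r) 0≤x = 0≤* 0≤x (0≤^ r 0≤x)

  polyℚ : ∀ {n} → (Subset n → ℕ) → (Fin n → ℚ) → ℚ
  polyℚ {zero}  g x = ⌜ g [] ⌝
  polyℚ {suc n} g x = polyℚ (g ∘ (outside ∷_)) (x ∘ suc) + x zero * polyℚ (g ∘ (inside ∷_)) (x ∘ suc)

  polyℚ-cong : ∀ {n} (g : Subset n → ℕ) {x y : Fin n → ℚ} → x ≗ y → polyℚ g x ≡ polyℚ g y
  polyℚ-cong {zero}  g x≗y = refl
  polyℚ-cong {suc n} g x≗y = cong₂ _+_ (polyℚ-cong _ (x≗y ∘ suc)) (cong₂ _*_ (x≗y zero) (polyℚ-cong _ (x≗y ∘ suc)))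

  polyℚ-zero : ∀ {n} (g : Subset n → ℕ) x → (∀ e → g e ≡ 0) → polyℚ g x ≡ 0ℚ
  polyℚ-zero {zero}  g x g≡0 = cong ⌜_⌝ (g≡0 [])
  polyℚ-zero {suc n} g x g≡0 = cong₂ _+_ (polyℚ-zero _ (x ∘ suc) (g≡0 ∘ (outside ∷_)))
    (trans (cong (x zero *_) (polyℚ-zero _ (x ∘ suc) (g≡0 ∘ (inside ∷_)))) (ℚ.*-zeroʳ (x zero)))

  -- Absolute values are needed because a rational approximation of a nonnegative real coordinate
  -- may be slightly negative. The coefficients are nonnegative, so the triangle inequality
  -- suffices.
  ∣polyℚ∣≤ : ∀ {n} (g : Subset n → ℕ) {x y : Fin n → ℚ} → (∀ i → ∣ x i ∣ ≤ y i) → ∣ polyℚ g x ∣ ≤ polyℚ g y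
  ∣polyℚ∣≤ {zero}  g x≤y = ℚ.≤-reflexive (ℚ.0≤p⇒∣p∣≡p (0≤⌜⌝ (g [])))
  ∣polyℚ∣≤ {suc n} g {x} {y} x≤y = begin
    ∣ a + x zero * b ∣        ≤⟨ ℚ.∣p+q∣≤∣p∣+∣q∣ a (x zero * b) ⟩
    ∣ a ∣ + ∣ x zero * b ∣    ≡⟨ cong (λ z → ∣ a ∣ + z) (ℚ.∣p*q∣≡∣p∣*∣q∣ (x zero) b) ⟩
    ∣ a ∣ + ∣ x zero ∣ * ∣ b ∣ ≤⟨ ℚ.+-mono-≤ (∣polyℚ∣≤ (g ∘ (outside ∷_)) (x≤y ∘ suc))
                                  (mul-mono (ℚ.≤-trans (ℚ.0≤∣p∣ (x zero)) (x≤y zero)) (ℚ.0≤∣p∣ b) (x≤y zero)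
                                    (∣polyℚ∣≤ (g ∘ (inside ∷_)) (x≤y ∘ suc))) ⟩
    polyℚ g y                 ∎
    where
    open ℚ.≤-Reasoning
    a = polyℚ (g ∘ (outside ∷_)) (x ∘ suc)
    b = polyℚ (g ∘ (inside ∷_)) (x ∘ suc)

  p≤∣p∣ : ∀ p → p ≤ ∣ p ∣
  p≤∣p∣ p with ℚ.≤-total 0ℚ p
  ... | inj₁ 0≤p = ℚ.≤-reflexive (sym (ℚ.0≤p⇒∣p∣≡p 0≤p))
  ... | inj₂ p≤0 = ℚ.≤-trans p≤0 (ℚ.0≤∣p∣ p)

  polyℚ-mono : ∀ {n} (g : Subset n → ℕ) {x y : Fin n → ℚ} → (∀ i → ∣ x i ∣ ≤ y i) → polyℚ g x ≤ polyℚ g y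
  polyℚ-mono g {x} x≤y = ℚ.≤-trans (p≤∣p∣ (polyℚ g x)) (∣polyℚ∣≤ g x≤y)

  -- Homogeneity of degree `r`; it translates between integer weights of total n and points of the
  -- simplex with denominator n.
  polyℚ-scale : ∀ {n} r (g : Subset n → ℕ) (a : Fin n → ℕ) c → (∀ e → g e ℕ.≤ χ r e) →
                polyℚ g (λ v → ⌜ a v ⌝ * c) ≡ ⌜ poly g a ⌝ * c ^ℚ r
  polyℚ-scale {zero}  zero    g a c g≤χ = sym (ℚ.*-identityʳ ⌜ g [] ⌝)
  polyℚ-scale {zero}  (suc r) g a c g≤χ = trans (cong ⌜_⌝ g≡0) (sym (trans (cong (λ x → ⌜ x ⌝ * c ^ℚ suc r) g≡0) (ℚ.*-zeroˡ (c ^ℚ suc r))))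
    where g≡0 = ℕ.n≤0⇒n≡0 (g≤χ [])
  polyℚ-scale {suc n} r g a c g≤χ = begin
    polyℚ g₀ x + ⌜ a zero ⌝ * c * polyℚ g₁ x
      ≡⟨ cong₂ _+_ (polyℚ-scale r g₀ (a ∘ suc) c (λ e → ℕ.≤-trans (g≤χ (outside ∷ e)) (ℕ.≤-reflexive (χ-out r e)))) (inside-part r g≤χ) ⟩
    ⌜ poly g₀ (a ∘ suc) ⌝ * c ^ℚ r + ⌜ a zero ℕ.* poly g₁ (a ∘ suc) ⌝ * c ^ℚ r
      ≡⟨ ℚ.*-distribʳ-+ (c ^ℚ r) ⌜ poly g₀ (a ∘ suc) ⌝ _ ⟨
    (⌜ poly g₀ (a ∘ suc) ⌝ + ⌜ a zero ℕ.* poly g₁ (a ∘ suc) ⌝) * c ^ℚ r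
      ≡⟨ cong (_* c ^ℚ r) (⌜⌝-+ (poly g₀ (a ∘ suc)) _) ⟨
    ⌜ poly g a ⌝ * c ^ℚ r ∎
    where
    open ≡-Reasoning
    g₀ = g ∘ (outside ∷_)
    g₁ = g ∘ (inside ∷_)
    x : Fin n → ℚ
    x v = ⌜ a (suc v) ⌝ * c
    rearr : ∀ a c p q → a * c * (p * q) ≡ a * p * (c * q)
    rearr = solve-∀ ℚ-ring
    inside-part : ∀ r → (∀ e → g e ℕ.≤ χ r e) →
      ⌜ a zero ⌝ * c * polyℚ g₁ x ≡ ⌜ a zero ℕ.* poly g₁ (a ∘ suc) ⌝ * c ^ℚ r
    inside-part zero g≤χ = trans
      (trans (cong (⌜ a zero ⌝ * c *_) (polyℚ-zero g₁ x g₁≡0)) (ℚ.*-zeroʳ (⌜ a zero ⌝ * c)))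
      (sym (cong (λ p → ⌜ p ⌝ * 1ℚ) (trans (cong (a zero ℕ.*_) (poly-zero g₁ (a ∘ suc) g₁≡0)) (ℕ.*-zeroʳ (a zero)))))
      where
      g₁≡0 : ∀ e → g₁ e ≡ 0
      g₁≡0 e = ℕ.n≤0⇒n≡0 (g≤χ (inside ∷ e))
    inside-part (suc r) g≤χ = trans (cong (⌜ a zero ⌝ * c *_) (polyℚ-scale r g₁ (a ∘ suc) c (g≤χ ∘ (inside ∷_))))
      (trans (rearr ⌜ a zero ⌝ c ⌜ poly g₁ (a ∘ suc) ⌝ (c ^ℚ r))
        (cong (_* c ^ℚ suc r) (sym (⌜⌝-* (a zero) (poly g₁ (a ∘ suc))))))

-- Rounding errors and maxima over integer weights of given total.

module GridPoints where
  open Polynomials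
  open Twins using (indicator)
  open BadVertices using (sum-mono; sum-const; sum-*ˡ)
  open import Data.Bool.Base using (Bool; true; false; if_then_else_)
  open import Data.Bool.Properties using (T?)
  open import Data.Fin.Base using (Fin; zero; suc)
  open import Data.Fin.Subset using (Subset; inside; outside)
  open import Data.List.Base as List using (List; []; _∷_; length; filterᵇ; _++_)
  open import Data.List.Properties using (filter-++; length-++)
  open import Data.Nat.Base
  open import Data.Nat.Properties
  open import Data.Nat.Tactic.RingSolver using (solve-∀)
  open import Data.Product.Base using (_×_; _,_; proj₁; proj₂; ∃-syntax; Σ-syntax)
  open import Data.Sum.Base using (_⊎_; inj₁; inj₂)
  open import Data.Vec.Base using ([]; _∷_)
  open import Data.Vec.Functional using () renaming (_∷_ to _◂_)
  open import Function.Base using (_∘_; const)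
  open import Relation.Binary.PropositionalEquality hiding (J; [_])
  open import Algebra.Properties.CommutativeMonoid.Sum +-0-commutativeMonoid using (sum; ∑-distrib-+)

  -- Raising one variable by 1 adds its derivative. Derivatives grow with the point, so all of them
  -- may be taken at the fully raised point.
  poly-suc : ∀ {n} (g : Subset n → ℕ) a →
             poly g (suc ∘ a) ≤ poly g a + sum (λ z → poly (∂ z g) (suc ∘ a))
  poly-suc {zero}  g a = m≤m+n _ 0
  poly-suc {suc n} g a = begin
    poly g₀ b + (b₁ + a₀ * b₁)
      ≤⟨ +-mono-≤ (poly-suc g₀ (a ∘ suc)) (+-monoʳ-≤ b₁ (*-monoʳ-≤ a₀ (poly-suc g₁ (a ∘ suc)))) ⟩
    p₀ + s₀ + (b₁ + a₀ * (p₁ + s₁))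
      ≤⟨ ≤-trans (m≤m+n _ s₁) (≤-reflexive (rearr p₀ s₀ b₁ a₀ p₁ s₁)) ⟩
    p₀ + a₀ * p₁ + (b₁ + suc a₀ * 0 + (s₀ + suc a₀ * s₁))
      ≡⟨ cong₂ (λ x y → p₀ + a₀ * p₁ + (b₁ + suc a₀ * x + y)) (poly-zero {n} (λ _ → 0) b (λ _ → refl))
          (trans (∑-distrib-+ (λ z → poly (∂ z g₀) b) (λ z → suc a₀ * poly (∂ z g₁) b)) (cong (s₀ +_) (sum-*ˡ (suc a₀) (λ z → poly (∂ z g₁) b)))) ⟨
    poly g a + sum (λ z → poly (∂ z g) (suc ∘ a)) ∎
    where
    open ≤-Reasoning
    g₀ = g ∘ (outside ∷_)
    g₁ = g ∘ (inside ∷_)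
    a₀ = a zero
    b : Fin n → ℕ
    b = suc ∘ a ∘ suc
    b₁ = poly g₁ b
    p₀ = poly g₀ (a ∘ suc)
    p₁ = poly g₁ (a ∘ suc)
    s₀ = sum (λ z → poly (∂ z g₀) b)
    s₁ = sum (λ z → poly (∂ z g₁) b)
    rearr : ∀ p₀ s₀ b₁ a₀ p₁ s₁ → p₀ + s₀ + (b₁ + a₀ * (p₁ + s₁)) + s₁ ≡ p₀ + a₀ * p₁ + (b₁ + suc a₀ * 0 + (s₀ + suc a₀ * s₁))
    rearr = solve-∀

  poly-suc-≤ : ∀ {n} j (g : Subset n → ℕ) a → (∀ e → g e ≤ χ (suc j) e) →
               poly g (suc ∘ a) ≤ poly g a + n * (n + sum a) ^ j
  poly-suc-≤ {n} j g a g≤χ = ≤-trans (poly-suc g a) (+-monoʳ-≤ (poly g a)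
    (≤-trans (sum-mono bound) (≤-reflexive (sum-const n _))))
    where
    bound : ∀ z → poly (∂ z g) (suc ∘ a) ≤ (n + sum a) ^ j
    bound z = ≤-trans (poly≤E j (suc ∘ a) (∂-≤χ j z g g≤χ)) (≤-trans (E≤sum^ j (suc ∘ a))
      (≤-reflexive (cong (_^ j) (trans (∑-distrib-+ (const 1) a) (cong (_+ sum a) (trans (sum-const n 1) (*-identityʳ n)))))))

  argmax-ℕ : ∀ k (h : ℕ → ℕ) → ∃[ i ] (i ≤ k × ∀ j → j ≤ k → h j ≤ h i)
  argmax-ℕ zero    h = 0 , ≤-refl , λ { _ z≤n → ≤-refl }
  argmax-ℕ (suc k) h with argmax-ℕ k h
  ... | i , i≤k , max with ≤-total (h i) (h (suc k))
  ...   | inj₁ le = suc k , ≤-refl , λ j j≤ → case-≤ j (m≤n⇒m<n∨m≡n j≤)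
    where
    case-≤ : ∀ j → j < suc k ⊎ j ≡ suc k → h j ≤ h (suc k)
    case-≤ j (inj₁ (s≤s j≤k)) = ≤-trans (max j j≤k) le
    case-≤ j (inj₂ refl)      = ≤-refl
  ...   | inj₂ ge = i , m≤n⇒m≤1+n i≤k , λ j j≤ → case-≤ j (m≤n⇒m<n∨m≡n j≤)
    where
    case-≤ : ∀ j → j < suc k ⊎ j ≡ suc k → h j ≤ h i
    case-≤ j (inj₁ (s≤s j≤k)) = max j j≤k
    case-≤ j (inj₂ refl)      = ge

  ◂-η : ∀ {n} (b : Fin (suc n) → ℕ) → b zero ◂ (b ∘ suc) ≗ b
  ◂-η b zero    = refl
  ◂-η b (suc i) = refl

  -- The first coordinate ranges over a finite interval, and for each of its values the rest is
  -- optimized recursively. `Φ` must respect pointwise equality, as weights are functions.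
  argmax : ∀ t k (Φ : (Fin (suc t) → ℕ) → ℕ) → (∀ {a b} → a ≗ b → Φ a ≡ Φ b) →
           Σ[ a ∈ (Fin (suc t) → ℕ) ] (sum a ≡ k × ∀ b → sum b ≡ k → Φ b ≤ Φ a)
  argmax zero    k Φ ext = const k , +-identityʳ k , λ b sum≡ → ≤-reflexive (ext λ { zero → trans (sym (+-identityʳ (b zero))) sum≡ })
  argmax (suc t) k Φ ext =
    let i , i≤k , max = argmax-ℕ k (λ i → Φ (i ◂ proj₁ (best i)))
    in i ◂ proj₁ (best i) , trans (cong (i +_) (proj₁ (proj₂ (best i)))) (m+[n∸m]≡n i≤k) , λ b sum≡ → begin
      Φ b                                            ≡⟨ ext (◂-η b) ⟨
      Φ (b zero ◂ (b ∘ suc))                         ≤⟨ proj₂ (proj₂ (best (b zero))) (b ∘ suc)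
                                                         (sym (trans (cong (_∸ b zero) (sym sum≡)) (m+n∸m≡n (b zero) _))) ⟩
      Φ (b zero ◂ proj₁ (best (b zero)))             ≤⟨ max (b zero) (≤-trans (m≤m+n _ _) (≤-reflexive sum≡)) ⟩
      Φ (i ◂ proj₁ (best i))                         ∎
    where
    open ≤-Reasoning
    best : ∀ i → Σ[ a ∈ (Fin (suc t) → ℕ) ] (sum a ≡ k ∸ i × ∀ b → sum b ≡ k ∸ i → Φ (i ◂ b) ≤ Φ (i ◂ a))
    best i = argmax t (k ∸ i) (λ a → Φ (i ◂ a)) λ a≗b → ext λ { zero → refl ; (suc v) → a≗b v }

  -- A weight of smaller total is first filled up at its first coordinate, which does not decrease
  -- the polynomial.
  poly-argmax : ∀ {n} .{{_ : NonZero n}} (g : Subset n → ℕ) k →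
    Σ[ a ∈ (Fin n → ℕ) ] (sum a ≡ k × ∀ b → sum b ≤ k → poly g b ≤ poly g a)
  poly-argmax {suc t} g k with argmax _ k (poly g) (poly-cong {g = g} {h = g} (λ _ → refl))
  ... | a , sum≡ , max = a , sum≡ , λ b sum≤ →
    let b′ = (k ∸ sum b + b zero) ◂ (b ∘ suc)
        le : ∀ i → b i ≤ b′ i
        le = λ { zero → m≤n+m (b zero) (k ∸ sum b) ; (suc i) → ≤-refl }
    in ≤-trans (poly-mono {g = g} {h = g} {y = b′} (λ _ → ≤-refl) le)
         (max b′ (trans (+-assoc (k ∸ sum b) (b zero) _) (m∸n+n≡m sum≤)))

  length-filter-map : ∀ {A B : Set} (p : B → Bool) (f : A → B) xs →
    length (filterᵇ p (List.map f xs)) ≡ length (filterᵇ (p ∘ f) xs)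
  length-filter-map p f []       = refl
  length-filter-map p f (x ∷ xs) with p (f x)
  ... | true  = cong suc (length-filter-map p f xs)
  ... | false = length-filter-map p f xs

  length-filter-subsets : ∀ {n} (p : Subset n → Bool) →
    length (filterᵇ p (subsets n)) ≡ poly (λ e → if p e then 1 else 0) (const 1)
  length-filter-subsets {zero}  p with p []
  ... | true  = refl
  ... | false = refl
  length-filter-subsets {suc n} p = begin
    length (filterᵇ p (List.map (outside ∷_) S ++ List.map (inside ∷_) S))
      ≡⟨ cong length (filter-++ (T? ∘ p) (List.map (outside ∷_) S) _) ⟩
    length (filterᵇ p (List.map (outside ∷_) S) ++ filterᵇ p (List.map (inside ∷_) S))
      ≡⟨ length-++ (filterᵇ p (List.map (outside ∷_) S)) ⟩
    length (filterᵇ p (List.map (outside ∷_) S)) + length (filterᵇ p (List.map (inside ∷_) S))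
      ≡⟨ cong₂ _+_ (trans (length-filter-map p (outside ∷_) S) (length-filter-subsets (p ∘ (outside ∷_))))
                   (trans (length-filter-map p (inside ∷_) S) (trans (length-filter-subsets (p ∘ (inside ∷_))) (sym (*-identityˡ _)))) ⟩
    poly (λ e → if p e then 1 else 0) (const 1) ∎
    where
    open ≡-Reasoning
    S = subsets n

  size≡poly : ∀ {r} (G : RGraph r) → size G ≡ poly (indicator G) (const 1)
  size≡poly G = length-filter-subsets (isEdge G)

-- The Lagrange polynomial at rational points and its maxima on finer and finer grids.

module GridMaxima where
  open Polynomials
  open Maclaurin using (^-*)
  open Twins using (indicator)
  open RationalPolynomials
  open GridPoints
  open import Data.Bool.Base using (Bool; true; false; if_then_else_)
  open import Data.Fin.Base using (Fin; zero; suc)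
  open import Data.Fin.Subset using (Subset; inside; outside)
  import Data.Integer.Base as ℤ
  import Data.Integer.Properties as ℤ
  open import Data.List.Base as List using (List; []; _∷_; filterᵇ; _++_; tabulate)
  import Data.Nat.Base as ℕ
  open ℕ using (ℕ; zero; suc; s≤s; z≤n; _!; _⊔_)
  import Data.Nat.DivMod as ℕ
  import Data.Nat.Properties as ℕ
  open import Data.Product.Base using (_×_; _,_; proj₁; proj₂; ∃-syntax)
  open import Data.Rational.Base as ℚ using (ℚ; mkℚ; 0ℚ; 1ℚ; _/_; _+_; _*_; _≤_; _<_; ∣_∣; *≤*)
  import Data.Rational.Properties as ℚ
  open import Data.Vec.Base using ([]; _∷_)
  open import Function.Base using (_∘_; const)
  open import Relation.Binary.PropositionalEquality hiding (J; [_])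
  open import Tactic.RingSolver using (solve-∀)
  open import Algebra.Properties.CommutativeMonoid.Sum ℕ.+-0-commutativeMonoid using (sum)
  open import Algebra.Properties.CommutativeMonoid.Sum ℚ.+-0-commutativeMonoid using () renaming (sum to sumℚ; sum-cong-≗ to sumℚ-cong)

  sumℚ-mono : ∀ {n} {x y : Fin n → ℚ} → (∀ i → x i ≤ y i) → sumℚ x ≤ sumℚ y
  sumℚ-mono {zero}  x≤y = ℚ.≤-refl
  sumℚ-mono {suc n} x≤y = ℚ.+-mono-≤ (x≤y zero) (sumℚ-mono (x≤y ∘ suc))

  sumℚ-*ˡ : ∀ {n} c (x : Fin n → ℚ) → sumℚ (λ i → c * x i) ≡ c * sumℚ x
  sumℚ-*ˡ {zero}  c x = sym (ℚ.*-zeroʳ c)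
  sumℚ-*ˡ {suc n} c x = trans (cong (c * x zero +_) (sumℚ-*ˡ c (x ∘ suc))) (sym (ℚ.*-distribˡ-+ c (x zero) _))

  sumℚ-⌜⌝ : ∀ {n} (a : Fin n → ℕ) → sumℚ (⌜_⌝ ∘ a) ≡ ⌜ sum a ⌝
  sumℚ-⌜⌝ {zero}  a = refl
  sumℚ-⌜⌝ {suc n} a = trans (cong (⌜ a zero ⌝ +_) (sumℚ-⌜⌝ (a ∘ suc))) (sym (⌜⌝-+ (a zero) _))

  sumℚ-const : ∀ n c → sumℚ {n} (const c) ≡ ⌜ n ⌝ * c
  sumℚ-const zero    c = sym (ℚ.*-zeroˡ c)
  sumℚ-const (suc n) c = trans (cong (c +_) (sumℚ-const n c))
    (trans (rearr c ⌜ n ⌝) (cong (_* c) (sym (⌜⌝-+ 1 n))))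
    where
    rearr : ∀ c n → c + n * c ≡ (1ℚ + n) * c
    rearr = solve-∀ ℚ-ring

  seq-sum : ∀ {n l} (x : Fin n → ℝ) (f : Fin l → Fin n) i →
            seq (sumᴿ (List.map x (tabulate f))) i ≡ sumℚ (λ v → seq (x (f v)) i)
  seq-sum {l = zero}  x f i = refl
  seq-sum {l = suc l} x f i = cong (seq (x (f zero)) i +_) (seq-sum x (f ∘ suc) i)

  module _ {A : Set} (p : A → Bool) (φ : A → ℚ) where
    filtered-sum : List A → ℚ
    filtered-sum []       = 0ℚ
    filtered-sum (x ∷ xs) = if p x then φ x + filtered-sum xs else filtered-sum xs

    filtered-sum-++ : ∀ xs ys → filtered-sum (xs ++ ys) ≡ filtered-sum xs + filtered-sum ys
    filtered-sum-++ []       ys = sym (ℚ.+-identityˡ _)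
    filtered-sum-++ (x ∷ xs) ys with p x
    ... | true  = trans (cong (φ x +_) (filtered-sum-++ xs ys)) (sym (ℚ.+-assoc (φ x) _ _))
    ... | false = filtered-sum-++ xs ys

  filtered-sum-map : ∀ {A B : Set} (p : B → Bool) φ (f : A → B) xs →
    filtered-sum p φ (List.map f xs) ≡ filtered-sum (p ∘ f) (φ ∘ f) xs
  filtered-sum-map p φ f []       = refl
  filtered-sum-map p φ f (x ∷ xs) with p (f x)
  ... | true  = cong (φ (f x) +_) (filtered-sum-map p φ f xs)
  ... | false = filtered-sum-map p φ f xs

  filtered-sum-*ˡ : ∀ {A : Set} (p : A → Bool) c φ xs →
    filtered-sum p (λ x → c * φ x) xs ≡ c * filtered-sum p φ xs
  filtered-sum-*ˡ p c φ []       = sym (ℚ.*-zeroʳ c)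
  filtered-sum-*ˡ p c φ (x ∷ xs) with p x
  ... | true  = trans (cong (c * φ x +_) (filtered-sum-*ˡ p c φ xs)) (sym (ℚ.*-distribˡ-+ c (φ x) _))
  ... | false = filtered-sum-*ˡ p c φ xs

  seq-filtered-sum : ∀ {A : Set} (p : A → Bool) (f : A → ℝ) xs i →
    seq (sumᴿ (List.map f (filterᵇ p xs))) i ≡ filtered-sum p (λ e → seq (f e) i) xs
  seq-filtered-sum p f []       i = refl
  seq-filtered-sum p f (x ∷ xs) i with p x
  ... | true  = cong (seq (f x) i +_) (seq-filtered-sum p f xs i)
  ... | false = seq-filtered-sum p f xs i

  filtered-sum-subsets : ∀ {n} (p : Subset n → Bool) (x : Fin n → ℝ) i →
    filtered-sum p (λ e → seq (∏[ e ] x) i) (subsets n) ≡ polyℚ (λ e → if p e then 1 else 0) (λ v → seq (x v) i)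
  filtered-sum-subsets {zero}  p x i with p []
  ... | true  = refl
  ... | false = refl
  filtered-sum-subsets {suc n} p x i = begin
    filtered-sum p φ (List.map (outside ∷_) S ++ List.map (inside ∷_) S)
      ≡⟨ filtered-sum-++ p φ (List.map (outside ∷_) S) _ ⟩
    filtered-sum p φ (List.map (outside ∷_) S) + filtered-sum p φ (List.map (inside ∷_) S)
      ≡⟨ cong₂ _+_
          (trans (filtered-sum-map p φ (outside ∷_) S) (filtered-sum-subsets (p ∘ (outside ∷_)) (x ∘ suc) i))
          (trans (filtered-sum-map p φ (inside ∷_) S)
            (trans (filtered-sum-*ˡ (p ∘ (inside ∷_)) (seq (x zero) i) (λ e → seq (∏[ e ] (x ∘ suc)) i) S)
              (cong (seq (x zero) i *_) (filtered-sum-subsets (p ∘ (inside ∷_)) (x ∘ suc) i)))) ⟩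
    polyℚ (λ e → if p e then 1 else 0) (λ v → seq (x v) i) ∎
    where
    open ≡-Reasoning
    S = subsets n
    φ : Subset (suc n) → ℚ
    φ e = seq (∏[ e ] x) i

  seq-lagrangePoly : ∀ {r} (G : RGraph r) x i →
    seq (lagrangePoly G x) i ≡ ⌜ r ! ⌝ * polyℚ (indicator G) (λ v → seq (x v) i)
  seq-lagrangePoly {r} G x i = cong (⌜ r ! ⌝ *_)
    (trans (seq-filtered-sum (isEdge G) (λ e → ∏[ e ] x) (subsets (order G)) i) (filtered-sum-subsets (isEdge G) x i))

  floor : ∀ q → 0ℚ ≤ q → ∃[ a ] (⌜ a ⌝ ≤ q × q ≤ ⌜ suc a ⌝)
  floor (mkℚ ℤ.-[1+ n ] d _) (*≤* ())
  floor q@(mkℚ (ℤ.+ n) d _) 0≤q = a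
    , subst (_≤ q) (sym (⌜⌝≡ a)) (*≤* (subst₂ ℤ._≤_ (ℤ.pos-* a (suc d)) (ℤ.pos-* n 1) (ℤ.+≤+ lower)))
    , subst (q ≤_) (sym (⌜⌝≡ (suc a))) (*≤* (subst₂ ℤ._≤_ (ℤ.pos-* n 1) (ℤ.pos-* (suc a) (suc d)) (ℤ.+≤+ upper)))
    where
    open ℕ.≤-Reasoning
    a = n ℕ./ suc d
    lower : a ℕ.* suc d ℕ.≤ n ℕ.* 1
    lower = ℕ.≤-trans (ℕ.m/n*n≤m n (suc d)) (ℕ.≤-reflexive (sym (ℕ.*-identityʳ n)))
    upper : n ℕ.* 1 ℕ.≤ suc a ℕ.* suc d
    upper = begin
      n ℕ.* 1                           ≡⟨ ℕ.*-identityʳ n ⟩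
      n                                 ≡⟨ ℕ.m≡m%n+[m/n]*n n (suc d) ⟩
      n ℕ.% suc d ℕ.+ a ℕ.* suc d       ≤⟨ ℕ.+-monoˡ-≤ (a ℕ.* suc d) (ℕ.<⇒≤ (ℕ.m%n<n n (suc d))) ⟩
      suc a ℕ.* suc d                   ∎

  module GridMaximum {n} .{{_ : ℕ.NonZero n}} (j : ℕ) (g : Subset n → ℕ) (g≤χ : ∀ e → g e ℕ.≤ χ (suc j) e) where

    r : ℕ
    r = suc j

    grid : ℕ → Fin n → ℕ
    grid i = proj₁ (poly-argmax g (suc i))

    sum-grid : ∀ i → sum (grid i) ≡ suc i
    sum-grid i = proj₁ (proj₂ (poly-argmax g (suc i)))

    value : ℕ → ℚ
    value i = ⌜ r ! ⌝ * polyℚ g (λ v → ⌜ grid i v ⌝ * κ i)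

    -- A Lipschitz constant: rounding to denominator i + 1 changes the polynomial by at most `slope`
    -- times `κ i`.
    slope : ℕ
    slope = r ! ℕ.* (n ℕ.* suc n ℕ.^ j)

    grid-≤ : ∀ i a → sum a ℕ.≤ suc i → poly g (suc ∘ a) ℕ.≤ poly g (grid i) ℕ.+ n ℕ.* suc n ℕ.^ j ℕ.* suc i ℕ.^ j
    grid-≤ i a sum≤ = begin
      poly g (suc ∘ a)                                  ≤⟨ poly-suc-≤ j g a g≤χ ⟩
      poly g a ℕ.+ n ℕ.* (n ℕ.+ sum a) ℕ.^ j            ≤⟨ ℕ.+-mono-≤ (proj₂ (proj₂ (poly-argmax g (suc i))) a sum≤)
                                                            (ℕ.*-monoʳ-≤ n (ℕ.^-monoˡ-≤ j n+sum≤)) ⟩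
      poly g (grid i) ℕ.+ n ℕ.* (suc n ℕ.* suc i) ℕ.^ j ≡⟨ cong (λ x → poly g (grid i) ℕ.+ x)
                                                            (trans (cong (n ℕ.*_) (^-* (suc n) (suc i) j)) (sym (ℕ.*-assoc n _ _))) ⟩
      poly g (grid i) ℕ.+ n ℕ.* suc n ℕ.^ j ℕ.* suc i ℕ.^ j ∎
      where
      open ℕ.≤-Reasoning
      n+sum≤ : n ℕ.+ sum a ℕ.≤ suc n ℕ.* suc i
      n+sum≤ = ℕ.≤-trans (ℕ.≤-reflexive (ℕ.+-comm n (sum a))) (ℕ.+-mono-≤ sum≤ (ℕ.m≤m*n n (suc i)))

    -- (i + 1) x is rounded down to an integer weight `a`, which competes with the grid maximum,
    -- while `suc ∘ a` dominates (i + 1) x. The strict bound i + 2 still forces the total of `a` to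
    -- be at most i + 1; it leaves room for points that lie only nearly in the simplex.
    approx : ∀ i (x : Fin n → ℚ) → (∀ v → 0ℚ ≤ x v) → sumℚ (λ v → ⌜ suc i ⌝ * x v) < ⌜ 2 ℕ.+ i ⌝ →
             ⌜ r ! ⌝ * polyℚ g x ≤ value i + ⌜ slope ⌝ * κ i
    approx i x 0≤x sum< = begin
      ⌜ r ! ⌝ * polyℚ g x
        ≤⟨ ℚ.*-monoˡ-≤-nonNeg ⌜ r ! ⌝ {{ρ≥0}} (polyℚ-mono g ∣x∣≤) ⟩
      ⌜ r ! ⌝ * polyℚ g (λ v → ⌜ suc (a v) ⌝ * κ i)
        ≡⟨ cong (⌜ r ! ⌝ *_) (polyℚ-scale r g (suc ∘ a) (κ i) g≤χ) ⟩
      ⌜ r ! ⌝ * (⌜ poly g (suc ∘ a) ⌝ * κ i ^ℚ r)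
        ≤⟨ ℚ.*-monoˡ-≤-nonNeg ⌜ r ! ⌝ {{ρ≥0}} (ℚ.*-monoʳ-≤-nonNeg (κ i ^ℚ r) {{ℚ.nonNegative (0≤^ r (0≤κ i))}}
             (⌜⌝-mono (grid-≤ i a sum-a≤))) ⟩
      ⌜ r ! ⌝ * (⌜ poly g (grid i) ℕ.+ B ℕ.* suc i ℕ.^ j ⌝ * κ i ^ℚ r)
        ≡⟨ cong (λ y → ⌜ r ! ⌝ * (y * κ i ^ℚ r)) (trans (⌜⌝-+ (poly g (grid i)) _)
             (cong (⌜ poly g (grid i) ⌝ +_) (trans (⌜⌝-* B (suc i ℕ.^ j)) (cong (⌜ B ⌝ *_) (⌜⌝-^ (suc i) j))))) ⟩
      ⌜ r ! ⌝ * ((⌜ poly g (grid i) ⌝ + ⌜ B ⌝ * ⌜ suc i ⌝ ^ℚ j) * (κ i * κ i ^ℚ j))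
        ≡⟨ rearr ⌜ r ! ⌝ ⌜ poly g (grid i) ⌝ ⌜ B ⌝ (⌜ suc i ⌝ ^ℚ j) (κ i) (κ i ^ℚ j) ⟩
      ⌜ r ! ⌝ * (⌜ poly g (grid i) ⌝ * (κ i * κ i ^ℚ j)) + ⌜ r ! ⌝ * ⌜ B ⌝ * κ i * (⌜ suc i ⌝ ^ℚ j * κ i ^ℚ j)
        ≡⟨ cong₂ (λ y z → ⌜ r ! ⌝ * y + z) (sym (polyℚ-scale r g (grid i) (κ i) g≤χ))
             (trans (cong (⌜ r ! ⌝ * ⌜ B ⌝ * κ i *_) (⌜⌝^*κ^ i j)) (trans (ℚ.*-identityʳ _) (cong (_* κ i) (sym (⌜⌝-* (r !) B))))) ⟩
      value i + ⌜ slope ⌝ * κ i ∎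
      where
      open ℚ.≤-Reasoning
      ρ≥0 = ℚ.nonNegative (0≤⌜⌝ (r !))
      B = n ℕ.* suc n ℕ.^ j
      fl : ∀ v → ∃[ a ] (⌜ a ⌝ ≤ ⌜ suc i ⌝ * x v × ⌜ suc i ⌝ * x v ≤ ⌜ suc a ⌝)
      fl v = floor (⌜ suc i ⌝ * x v) (0≤* (0≤⌜⌝ (suc i)) (0≤x v))
      a : Fin n → ℕ
      a v = proj₁ (fl v)
      sum-a≤ : sum a ℕ.≤ suc i
      sum-a≤ = ℕ.≤-pred (⌜⌝-cancel-< (ℚ.≤-<-trans (ℚ.≤-reflexive (sym (sumℚ-⌜⌝ a)))
        (ℚ.≤-<-trans (sumℚ-mono (λ v → proj₁ (proj₂ (fl v)))) sum<)))
      ∣x∣≤ : ∀ v → ∣ x v ∣ ≤ ⌜ suc (a v) ⌝ * κ i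
      ∣x∣≤ v = begin
        ∣ x v ∣                  ≡⟨ ℚ.0≤p⇒∣p∣≡p (0≤x v) ⟩
        x v                      ≡⟨ trans (cong (_* x v) (⌜⌝*κ i)) (ℚ.*-identityˡ (x v)) ⟨
        ⌜ suc i ⌝ * κ i * x v    ≡⟨ rearr₂ ⌜ suc i ⌝ (κ i) (x v) ⟩
        ⌜ suc i ⌝ * x v * κ i    ≤⟨ ℚ.*-monoʳ-≤-nonNeg (κ i) (proj₂ (proj₂ (fl v))) ⟩
        ⌜ suc (a v) ⌝ * κ i      ∎
        where
        rearr₂ : ∀ a b c → a * b * c ≡ a * c * b
        rearr₂ = solve-∀ ℚ-ring
      rearr : ∀ ρ u b s c d → ρ * ((u + b * s) * (c * d)) ≡ ρ * (u * (c * d)) + ρ * b * c * (s * d)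
      rearr = solve-∀ ℚ-ring

    approx-grid : ∀ i l w → sum w ≡ suc l → ⌜ r ! ⌝ * polyℚ g (λ v → ⌜ w v ⌝ * κ l) ≤ value i + ⌜ slope ⌝ * κ i
    approx-grid i l w sum≡ = approx i (λ v → ⌜ w v ⌝ * κ l) (λ v → 0≤* (0≤⌜⌝ (w v)) (0≤κ l)) (begin-strict
      sumℚ (λ v → ⌜ suc i ⌝ * (⌜ w v ⌝ * κ l))     ≡⟨ sumℚ-cong (λ v → rearr ⌜ suc i ⌝ ⌜ w v ⌝ (κ l)) ⟩
      sumℚ (λ v → ⌜ suc i ⌝ * κ l * ⌜ w v ⌝)       ≡⟨ sumℚ-*ˡ (⌜ suc i ⌝ * κ l) (⌜_⌝ ∘ w) ⟩
      ⌜ suc i ⌝ * κ l * sumℚ (⌜_⌝ ∘ w)             ≡⟨ cong (⌜ suc i ⌝ * κ l *_) (trans (sumℚ-⌜⌝ w) (cong ⌜_⌝ sum≡)) ⟩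
      ⌜ suc i ⌝ * κ l * ⌜ suc l ⌝                  ≡⟨ rearr₂ ⌜ suc i ⌝ (κ l) ⌜ suc l ⌝ ⟩
      ⌜ suc i ⌝ * (⌜ suc l ⌝ * κ l)                ≡⟨ trans (cong (⌜ suc i ⌝ *_) (⌜⌝*κ l)) (ℚ.*-identityʳ _) ⟩
      ⌜ suc i ⌝                                    <⟨ ⌜⌝-<-suc (suc i) ⟩
      ⌜ 2 ℕ.+ i ⌝                                  ∎)
      where
      open ℚ.≤-Reasoning
      rearr : ∀ a b c → a * (b * c) ≡ a * c * b
      rearr = solve-∀ ℚ-ring
      rearr₂ : ∀ a b c → a * b * c ≡ a * (c * b)
      rearr₂ = solve-∀ ℚ-ring
      ⌜⌝-<-suc : ∀ k → ⌜ k ⌝ < ⌜ suc k ⌝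
      ⌜⌝-<-suc k = ℚ.≰⇒> λ le → ℕ.<-irrefl refl (⌜⌝-cancel-≤ {suc k} {k} le)

    -- Applied in both directions, this makes the sequence of grid maxima Cauchy.
    value-≤ : ∀ i l → value l ≤ value i + ⌜ slope ⌝ * κ i
    value-≤ i l = approx-grid i l (grid l) (sum-grid l)

-- Constructive real inequalities and the existence of the Lagrangian.

module Lagrangians where
  open Twins using (indicator; indicator-≤χ)
  open RationalPolynomials
  open GridMaxima
  open import Data.Empty using (⊥-elim)
  open import Data.Fin.Base using (Fin; zero; suc)
  open import Data.List.Base as List using (allFin)
  import Data.Nat.Base as ℕ
  open ℕ using (ℕ; zero; suc; s≤s; z≤n; _!; _⊔_)
  import Data.Nat.Properties as ℕ
  open import Data.Product.Base using (_×_; _,_; proj₁; proj₂; ∃-syntax)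
  open import Data.Rational.Base as ℚ using (ℚ; 0ℚ; 1ℚ; ½; _+_; _*_; _-_; -_; _≤_; _<_; ∣_∣)
  import Data.Rational.Properties as ℚ
  open import Data.Sum.Base using (inj₁; inj₂)
  open import Function.Base using (_∘_; const; id)
  open import Relation.Binary.PropositionalEquality hiding (J; [_])
  open import Relation.Nullary using (¬_)
  open import Tactic.RingSolver using (solve-∀)
  open import Algebra.Properties.CommutativeMonoid.Sum ℚ.+-0-commutativeMonoid using () renaming (sum to sumℚ; sum-cong-≗ to sumℚ-cong; ∑-distrib-+ to sumℚ-+)

  0<½* : ∀ {ε} → 0ℚ < ε → 0ℚ < ½ * ε
  0<½* {ε} 0<ε = ℚ.positive⁻¹ (½ * ε) {{ℚ.pos*pos⇒pos ½ ε {{ℚ.positive 0<ε}}}}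

  ½*+½* : ∀ ε → ½ * ε + ½ * ε ≡ ε
  ½*+½* ε = trans (sym (ℚ.*-distribʳ-+ ε ½ ½)) (ℚ.*-identityˡ ε)

  ½*< : ∀ {ε} → 0ℚ < ε → ½ * ε < ε
  ½*< {ε} 0<ε = begin-strict
    ½ * ε            ≡⟨ ℚ.+-identityʳ (½ * ε) ⟨
    ½ * ε + 0ℚ       <⟨ ℚ.+-monoʳ-< (½ * ε) (0<½* 0<ε) ⟩
    ½ * ε + ½ * ε    ≡⟨ ½*+½* ε ⟩
    ε                ∎
    where open ℚ.≤-Reasoning

  ∣p-q∣≤⇒p≤q+ : ∀ {p q ε} → ∣ p - q ∣ ≤ ε → p ≤ q + ε
  ∣p-q∣≤⇒p≤q+ {p} {q} {ε} le = begin
    p               ≡⟨ rearr p q ⟩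
    q + (p - q)     ≤⟨ ℚ.+-monoʳ-≤ q (ℚ.≤-trans (p≤∣p∣ (p - q)) le) ⟩
    q + ε           ∎
    where
    open ℚ.≤-Reasoning
    rearr : ∀ p q → p ≡ q + (p - q)
    rearr = solve-∀ ℚ-ring

  ≤+⇒-≤ : ∀ {p q ε} → p ≤ q + ε → p - q ≤ ε
  ≤+⇒-≤ {p} {q} {ε} le = begin
    p - q         ≤⟨ ℚ.+-monoˡ-≤ (- q) le ⟩
    q + ε - q     ≡⟨ rearr q ε ⟩
    ε             ∎
    where
    open ℚ.≤-Reasoning
    rearr : ∀ q ε → q + ε - q ≡ ε
    rearr = solve-∀ ℚ-ring

  ∣-∣≤ : ∀ {p q ε} → p ≤ q + ε → q ≤ p + ε → ∣ p - q ∣ ≤ ε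
  ∣-∣≤ {p} {q} {ε} p≤ q≤ with ℚ.∣p∣≡p∨∣p∣≡-p (p - q)
  ... | inj₁ eq = ℚ.≤-trans (ℚ.≤-reflexive eq) (≤+⇒-≤ p≤)
  ... | inj₂ eq = ℚ.≤-trans (ℚ.≤-reflexive (trans eq (rearr p q))) (≤+⇒-≤ q≤)
    where
    rearr : ∀ p q → - (p - q) ≡ q - p
    rearr = solve-∀ ℚ-ring

  -- `≤ᴿ` is a negation and carries no witness, but at a fixed index the comparison in ℚ is
  -- decidable. A failure at one index beyond both moduli, each taken for η/4, persists at all later
  -- indices with gap η/2 and so yields y <ᴿ x.
  ≤ᴿ⇒eventually-≤ : ∀ {x y} → x ≤ᴿ y → ∀ η → 0ℚ < η → ∃[ N ] (∀ i → N ℕ.≤ i → seq x i ≤ seq y i + η)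
  ≤ᴿ⇒eventually-≤ {x} {y} x≤y η 0<η = N , bound
    where
    h q : ℚ
    h = ½ * η
    q = ½ * h
    N₁ N₂ N : ℕ
    N₁ = proj₁ (cauchy x q (0<½* (0<½* 0<η)))
    N₂ = proj₁ (cauchy y q (0<½* (0<½* 0<η)))
    N = N₁ ⊔ N₂
    open ℚ.≤-Reasoning
    rearr : ∀ y q h → y + q + h ≡ y + h + q
    rearr = solve-∀ ℚ-ring
    bound : ∀ i → N ℕ.≤ i → seq x i ≤ seq y i + η
    bound i N≤i with ℚ.≤-total (seq x i) (seq y i + η)
    ... | inj₁ le = le
    ... | inj₂ ge = ⊥-elim (x≤y (h , 0<½* 0<η , N , λ k N≤k → ℚ.≮⇒≥ λ lt → ℚ.<-irrefl refl (begin-strict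
      seq x k + q           <⟨ ℚ.+-monoˡ-< q lt ⟩
      seq y k + h + q       ≤⟨ ℚ.+-monoˡ-≤ q (ℚ.+-monoˡ-≤ h (∣p-q∣≤⇒p≤q+ {seq y k} {seq y i}
                                (proj₂ (cauchy y q (0<½* (0<½* 0<η))) k i (ℕ.m⊔n≤o⇒n≤o N₁ N₂ N≤k) (ℕ.m⊔n≤o⇒n≤o N₁ N₂ N≤i)))) ⟩
      seq y i + q + h + q   ≡⟨ rearr₂ (seq y i) q h ⟩
      seq y i + (h + (q + q)) ≡⟨ cong (λ z → seq y i + z) (trans (cong (h +_) (½*+½* h)) (½*+½* η)) ⟩
      seq y i + η           ≤⟨ ge ⟩
      seq x i               ≤⟨ ∣p-q∣≤⇒p≤q+ {seq x i} {seq x k}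
                                (proj₂ (cauchy x q (0<½* (0<½* 0<η))) i k (ℕ.m⊔n≤o⇒m≤o N₁ N₂ N≤i) (ℕ.m⊔n≤o⇒m≤o N₁ N₂ N≤k)) ⟩
      seq x k + q           ∎)))
      where
      rearr₂ : ∀ y q h → y + q + h + q ≡ y + (h + (q + q))
      rearr₂ = solve-∀ ℚ-ring

  eventually-all : ∀ {n} {P : Fin n → ℕ → Set} → (∀ v → ∃[ N ] (∀ i → N ℕ.≤ i → P v i)) →
                   ∃[ N ] (∀ i → N ℕ.≤ i → ∀ v → P v i)
  eventually-all {zero}  ev = 0 , λ _ _ ()
  eventually-all {suc n} ev =
    let N₁ , p = ev zero
        N₂ , q = eventually-all (ev ∘ suc)
    in N₁ ⊔ N₂ , λ { i N≤i zero    → p i (ℕ.m⊔n≤o⇒m≤o N₁ N₂ N≤i)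
                   ; i N≤i (suc v) → q i (ℕ.m⊔n≤o⇒n≤o N₁ N₂ N≤i) v }

  module LagrangianExists {j} (H : RGraph (suc j)) .{{_ : ℕ.NonZero (order H)}} where
    open GridMaximum j (indicator H) (indicator-≤χ H) public

    n : ℕ
    n = order H

    value-close : ∀ {ε} i l → ⌜ slope ⌝ * κ i ≤ ε → ⌜ slope ⌝ * κ l ≤ ε → ∣ value i - value l ∣ ≤ ε
    value-close i l i≤ l≤ = ∣-∣≤ (ℚ.≤-trans (value-≤ l i) (ℚ.+-monoʳ-≤ (value l) l≤))
                                 (ℚ.≤-trans (value-≤ i l) (ℚ.+-monoʳ-≤ (value i) i≤))

    lagrangian : ℝ
    lagrangian = record
      { seq    = value
      ; cauchy = λ ε 0<ε → let N , small = archimedean slope ε 0<ε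
                           in N , λ i l N≤i N≤l → value-close i l (small i N≤i) (small l N≤l) }

    -- A coordinate x ≥ -η satisfies ∣x∣ ≤ x + 2η. Moving every coordinate up by 2η raises the total
    -- to at most 1 + (1 + 2n) η, and `small` keeps k + 1 times this below k + 2, as `approx`
    -- requires.
    near-simplex : ∀ k η x → (∀ v → 0ℚ ≤ x v + η) → sumℚ x ≤ 1ℚ + η → 0ℚ ≤ η →
      ⌜ suc k ℕ.* (1 ℕ.+ 2 ℕ.* n) ⌝ * η < 1ℚ →
      ⌜ r ! ⌝ * polyℚ (indicator H) x ≤ value k + ⌜ slope ⌝ * κ k
    near-simplex k η x 0≤x+η sum≤ 0≤η small = ℚ.≤-trans
      (ℚ.*-monoˡ-≤-nonNeg ⌜ r ! ⌝ {{ℚ.nonNegative (0≤⌜⌝ (r !))}} (polyℚ-mono (indicator H) ∣x∣≤))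
      (approx k x′ (λ v → ℚ.≤-trans (ℚ.0≤∣p∣ (x v)) (∣x∣≤ v)) (begin-strict
        sumℚ (λ v → ⌜ suc k ⌝ * x′ v)
          ≡⟨ sumℚ-*ˡ ⌜ suc k ⌝ x′ ⟩
        ⌜ suc k ⌝ * sumℚ x′
          ≡⟨ cong (⌜ suc k ⌝ *_) (trans (sumℚ-+ x (const (η + η))) (cong (sumℚ x +_) (sumℚ-const n (η + η)))) ⟩
        ⌜ suc k ⌝ * (sumℚ x + ⌜ n ⌝ * (η + η))
          ≤⟨ ℚ.*-monoˡ-≤-nonNeg ⌜ suc k ⌝ {{ℚ.nonNegative (0≤⌜⌝ (suc k))}} (ℚ.+-monoˡ-≤ (⌜ n ⌝ * (η + η)) sum≤) ⟩
        ⌜ suc k ⌝ * (1ℚ + η + ⌜ n ⌝ * (η + η))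
          ≡⟨ rearr ⌜ suc k ⌝ ⌜ n ⌝ η ⟩
        ⌜ suc k ⌝ * ((1ℚ + (⌜ n ⌝ + ⌜ n ⌝)) * η) + ⌜ suc k ⌝
          ≡⟨ cong (_+ ⌜ suc k ⌝) (trans (sym (ℚ.*-assoc ⌜ suc k ⌝ _ η)) (cong (_* η) (sym scale))) ⟩
        ⌜ suc k ℕ.* (1 ℕ.+ 2 ℕ.* n) ⌝ * η + ⌜ suc k ⌝
          <⟨ ℚ.+-monoˡ-< ⌜ suc k ⌝ small ⟩
        1ℚ + ⌜ suc k ⌝
          ≡⟨ ⌜⌝-+ 1 (suc k) ⟨
        ⌜ 2 ℕ.+ k ⌝ ∎))
      where
      open ℚ.≤-Reasoning
      x′ : Fin n → ℚ
      x′ v = x v + (η + η)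
      rearr : ∀ k n η → k * (1ℚ + η + n * (η + η)) ≡ k * ((1ℚ + (n + n)) * η) + k
      rearr = solve-∀ ℚ-ring
      scale : ⌜ suc k ℕ.* (1 ℕ.+ 2 ℕ.* n) ⌝ ≡ ⌜ suc k ⌝ * (1ℚ + (⌜ n ⌝ + ⌜ n ⌝))
      scale = trans (⌜⌝-* (suc k) (1 ℕ.+ 2 ℕ.* n)) (cong (⌜ suc k ⌝ *_) (trans (⌜⌝-+ 1 (2 ℕ.* n))
        (cong (1ℚ +_) (trans (cong ⌜_⌝ (cong (n ℕ.+_) (ℕ.+-identityʳ n))) (⌜⌝-+ n n)))))
      ∣x∣≤ : ∀ v → ∣ x v ∣ ≤ x′ v
      ∣x∣≤ v with ℚ.∣p∣≡p∨∣p∣≡-p (x v)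
      ... | inj₁ eq = begin
        ∣ x v ∣         ≡⟨ eq ⟩
        x v             ≡⟨ ℚ.+-identityʳ (x v) ⟨
        x v + 0ℚ        ≤⟨ ℚ.+-monoʳ-≤ (x v) (ℚ.+-mono-≤ 0≤η 0≤η) ⟩
        x′ v            ∎
      ... | inj₂ eq = begin
        ∣ x v ∣                            ≡⟨ trans eq (sym (ℚ.+-identityʳ (- x v))) ⟩
        - x v + 0ℚ                         ≤⟨ ℚ.+-monoʳ-≤ (- x v) (ℚ.+-mono-≤ (0≤x+η v) (0≤x+η v)) ⟩
        - x v + ((x v + η) + (x v + η))    ≡⟨ rearr₂ (x v) η ⟩
        x′ v                               ∎
        where
        rearr₂ : ∀ x η → - x + ((x + η) + (x + η)) ≡ x + (η + η)
        rearr₂ = solve-∀ ℚ-ring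

    upper-bound : ∀ x → Simplex n x → lagrangePoly H x ≤ᴿ lagrangian
    upper-bound x (0≤x , sum≈ , _) (e , 0<e , N , far) = ℚ.<-irrefl refl (begin-strict
      value i + ½ * e
        <⟨ ℚ.+-monoʳ-< (value i) (½*< 0<e) ⟩
      value i + e
        ≤⟨ far i N≤i ⟩
      seq (lagrangePoly H x) i
        ≡⟨ seq-lagrangePoly H x i ⟩
      ⌜ r ! ⌝ * polyℚ (indicator H) (λ v → seq (x v) i)
        ≤⟨ near-simplex k η (λ v → seq (x v) i) (pos i N₁≤i) (subst (_≤ 1ℚ + η) (seq-sum x id i) (total i N₂≤i)) (0≤κ K) η-small ⟩
      value k + ⌜ slope ⌝ * κ k
        ≤⟨ ℚ.+-mono-≤ (value-≤ i k) (small k ℕ.≤-refl) ⟩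
      value i + ⌜ slope ⌝ * κ i + q
        ≤⟨ ℚ.+-monoˡ-≤ q (ℚ.+-monoʳ-≤ (value i) (small i k≤i)) ⟩
      value i + q + q
        ≡⟨ trans (ℚ.+-assoc (value i) q q) (cong (value i +_) (½*+½* (½ * e))) ⟩
      value i + ½ * e ∎)
      where
      open ℚ.≤-Reasoning
      -- q = ½ * (½ * e) A quarter of `e` pays for rounding to grid k and another quarter for
      -- passing from grid k to the later grid i, which leaves a contradiction with the assumed gap
      -- `e`.
      q : ℚ
      q = ½ * (½ * e)
      k : ℕ
      k = proj₁ (archimedean slope q (0<½* (0<½* 0<e)))
      small = proj₂ (archimedean slope q (0<½* (0<½* 0<e)))
      K : ℕ
      K = suc k ℕ.* (1 ℕ.+ 2 ℕ.* n)
      η : ℚ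
      η = κ K
      0<η : 0ℚ < η
      0<η = ℚ.positive⁻¹ (κ K)
      η-small : ⌜ K ⌝ * η < 1ℚ
      η-small = begin-strict
        ⌜ K ⌝ * η             ≡⟨ ℚ.+-identityʳ _ ⟨
        ⌜ K ⌝ * η + 0ℚ        <⟨ ℚ.+-monoʳ-< (⌜ K ⌝ * η) 0<η ⟩
        ⌜ K ⌝ * η + η         ≡⟨ rearr ⌜ K ⌝ η ⟩
        (1ℚ + ⌜ K ⌝) * η      ≡⟨ cong (_* η) (⌜⌝-+ 1 K) ⟨
        ⌜ suc K ⌝ * η         ≡⟨ ⌜⌝*κ K ⟩
        1ℚ                    ∎
        where
        rearr : ∀ K η → K * η + η ≡ (1ℚ + K) * η
        rearr = solve-∀ ℚ-ring
      all-pos = eventually-all {P = λ v i → 0ℚ ≤ seq (x v) i + η} (λ v → ≤ᴿ⇒eventually-≤ {0ᴿ} {x v} (0≤x v) η 0<η)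
      N₁ : ℕ
      N₁ = proj₁ all-pos
      pos = proj₂ all-pos
      all-total = ≤ᴿ⇒eventually-≤ {sumᴿ (List.map x (allFin n))} {1ᴿ} sum≈ η 0<η
      N₂ : ℕ
      N₂ = proj₁ all-total
      total = proj₂ all-total
      i : ℕ
      i = (N ⊔ k) ⊔ (N₁ ⊔ N₂)
      N≤i = ℕ.m⊔n≤o⇒m≤o N k (ℕ.m⊔n≤o⇒m≤o (N ⊔ k) (N₁ ⊔ N₂) ℕ.≤-refl)
      k≤i = ℕ.m⊔n≤o⇒n≤o N k (ℕ.m⊔n≤o⇒m≤o (N ⊔ k) (N₁ ⊔ N₂) ℕ.≤-refl)
      N₁≤i = ℕ.m⊔n≤o⇒m≤o N₁ N₂ (ℕ.m⊔n≤o⇒n≤o (N ⊔ k) (N₁ ⊔ N₂) ℕ.≤-refl)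
      N₂≤i = ℕ.m⊔n≤o⇒n≤o N₁ N₂ (ℕ.m⊔n≤o⇒n≤o (N ⊔ k) (N₁ ⊔ N₂) ℕ.≤-refl)

    grid-point : ℕ → Fin n → ℝ
    grid-point k v = fromℚ (⌜ grid k v ⌝ * κ k)

    grid-simplex : ∀ k → Simplex n (grid-point k)
    grid-simplex k = nonneg , not-above , not-below
      where
      open ℚ.≤-Reasoning
      nonneg : ∀ v → 0ᴿ ≤ᴿ grid-point k v
      nonneg v (e , 0<e , N , far) = ℚ.<-irrefl refl (begin-strict
        0ℚ                            ≤⟨ 0≤* (0≤⌜⌝ (grid k v)) (0≤κ k) ⟩
        ⌜ grid k v ⌝ * κ k            ≡⟨ ℚ.+-identityʳ _ ⟨
        ⌜ grid k v ⌝ * κ k + 0ℚ       <⟨ ℚ.+-monoʳ-< (⌜ grid k v ⌝ * κ k) 0<e ⟩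
        ⌜ grid k v ⌝ * κ k + e        ≤⟨ far N ℕ.≤-refl ⟩
        0ℚ                            ∎)
      total : ∀ i → seq (sumᴿ (List.map (grid-point k) (allFin n))) i ≡ 1ℚ
      total i = begin-equality
        seq (sumᴿ (List.map (grid-point k) (allFin n))) i   ≡⟨ seq-sum (grid-point k) id i ⟩
        sumℚ (λ v → ⌜ grid k v ⌝ * κ k)                     ≡⟨ sumℚ-cong (λ v → ℚ.*-comm ⌜ grid k v ⌝ (κ k)) ⟩
        sumℚ (λ v → κ k * ⌜ grid k v ⌝)                     ≡⟨ sumℚ-*ˡ (κ k) (⌜_⌝ ∘ grid k) ⟩
        κ k * sumℚ (⌜_⌝ ∘ grid k)                           ≡⟨ cong (κ k *_) (trans (sumℚ-⌜⌝ (grid k)) (cong ⌜_⌝ (sum-grid k))) ⟩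
        κ k * ⌜ suc k ⌝                                     ≡⟨ trans (ℚ.*-comm (κ k) ⌜ suc k ⌝) (⌜⌝*κ k) ⟩
        1ℚ                                                  ∎
      ε-free : ∀ {e} → 0ℚ < e → ¬ (1ℚ + e ≤ 1ℚ)
      ε-free 0<e le = ℚ.<-irrefl refl (ℚ.<-≤-trans (ℚ.+-monoʳ-< 1ℚ 0<e) le)
      not-above : sumᴿ (List.map (grid-point k) (allFin n)) ≤ᴿ 1ᴿ
      not-above (e , 0<e , N , far) = ε-free 0<e (subst (1ℚ + e ≤_) (total N) (far N ℕ.≤-refl))
      not-below : 1ᴿ ≤ᴿ sumᴿ (List.map (grid-point k) (allFin n))
      not-below (e , 0<e , N , far) = ε-free 0<e (subst (λ z → z + e ≤ 1ℚ) (total N) (far N ℕ.≤-refl))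

    -- The maximizing point of a fine enough grid serves; half of the rational lower bound `e` of
    -- `ε` pays for the grid, and the other half is the gap.
    approached : ∀ ε → 0ᴿ <ᴿ ε → ∃[ x ] (Simplex n x × lagrangian -ᴿ ε <ᴿ lagrangePoly H x)
    approached ε (e , 0<e , N , far) = grid-point k , grid-simplex k , ½ * e , 0<½* 0<e , N , λ i N≤i → begin
      value i - seq ε i + ½ * e                       ≤⟨ ℚ.+-monoˡ-≤ (½ * e) (ℚ.+-mono-≤
                                                          (ℚ.≤-trans (value-≤ k i) (ℚ.+-monoʳ-≤ (value k) (small k ℕ.≤-refl)))
                                                          (ℚ.neg-antimono-≤ (ℚ.≤-trans (ℚ.≤-reflexive (sym (ℚ.+-identityˡ e))) (far i N≤i)))) ⟩
      value k + ½ * e - e + ½ * e                     ≡⟨ rearr (value k) (½ * e) e ⟩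
      value k + ((½ * e + ½ * e) - e)                 ≡⟨ cong (value k +_) (trans (cong (_- e) (½*+½* e)) (ℚ.+-inverseʳ e)) ⟩
      value k + 0ℚ                                    ≡⟨ ℚ.+-identityʳ (value k) ⟩
      value k                                         ≡⟨ seq-lagrangePoly H (grid-point k) i ⟨
      seq (lagrangePoly H (grid-point k)) i           ∎
      where
      open ℚ.≤-Reasoning
      k : ℕ
      k = proj₁ (archimedean slope (½ * e) (0<½* 0<e))
      small = proj₂ (archimedean slope (½ * e) (0<½* 0<e))
      rearr : ∀ v h e → v + h - e + h ≡ v + ((h + h) - e)
      rearr = solve-∀ ℚ-ring

    isLagrangian : IsLagrangian H lagrangian
    isLagrangian = upper-bound , approached

-- From real densities to inequalities in ℕ, and the final choice of δ₁ and n₁.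

module Conclusion where
  open Polynomials
  open Maclaurin
  open Twins
  open BadVertices
  open RationalPolynomials
  open GridPoints
  open Lagrangians
  open import Data.Fin.Base using (Fin; zero; suc)
  open import Data.Fin.Subset using (∁) renaming (∣_∣ to card)
  open import Data.Nat.Combinatorics using (_C_; _P_; k>n⇒nPk≡0)
  open import Data.Nat.Combinatorics.Base using (_P′_)
  import Data.Nat.Base as ℕ
  open ℕ using (ℕ; zero; suc; s≤s; z≤n; _!; _⊔_; NonTrivial)
  import Data.Nat.Properties as ℕ
  import Data.Nat.Tactic.RingSolver as ℕ-Solver
  open import Data.Product.Base using (_×_; _,_; proj₁; proj₂; ∃-syntax)
  open import Data.Rational.Base as ℚ using (ℚ; 0ℚ; ½; _+_; _*_; _-_; -_; _≤_; _<_)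
  import Data.Rational.Properties as ℚ
  open import Data.Sum.Base using (_⊎_)
  open import Function.Base using (const)
  open import Relation.Binary.PropositionalEquality hiding (J; [_])
  open import Relation.Nullary using (¬_)
  open import Tactic.RingSolver using (solve-∀)
  open import Algebra.Properties.CommutativeMonoid.Sum ℕ.+-0-commutativeMonoid using (sum)

  +-cancelʳ-≤ : ∀ {a b} c → a + c ≤ b + c → a ≤ b
  +-cancelʳ-≤ {a} {b} c le = subst₂ _≤_ (rearr a c) (rearr b c) (ℚ.+-monoˡ-≤ (- c) le)
    where
    rearr : ∀ a c → a + c - c ≡ a
    rearr = solve-∀ ℚ-ring

  sum-nonZero : ∀ {k} (w : Fin k → ℕ) → 1 ℕ.≤ sum w → ℕ.NonZero k
  sum-nonZero {suc k} w 1≤ = _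

  -- If an F-free H exceeded λ₀ - γ/2 at the point w/(l + 1), its Lagrangian would exceed `s` by
  -- γ/4, a further γ/4 having been spent on the grid approximation. This contradicts
  -- `DensityBound`.
  F-free-value : ∀ {j} (F : RGraph (suc j)) s → DensityBound F s → ∀ λ₀ γ → 0ℚ < γ →
    ∀ N → (∀ i → N ℕ.≤ i → seq s i + γ ≤ λ₀) →
    ∀ (H : RGraph (suc j)) → ¬ (F ⊑ H) → ∀ l (w : Fin (order H) → ℕ) → sum w ≡ suc l →
    ⌜ suc j ! ⌝ * (⌜ poly (indicator H) w ⌝ * κ l ^ℚ suc j) + ½ * γ ≤ λ₀
  F-free-value {j} F s bound λ₀ γ 0<γ N far H free l w sum≡ = ℚ.≮⇒≥ λ lt →
    bound H free lagrangian isLagrangian (q , 0<½* (0<½* 0<γ) , N ⊔ k , λ i N≤i → +-cancelʳ-≤ (q + ½ * γ) (begin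
      seq s i + q + (q + ½ * γ)         ≡⟨ rearr (seq s i) q (½ * γ) ⟩
      seq s i + (q + q + ½ * γ)         ≡⟨ cong (λ z → seq s i + z) (trans (cong (_+ ½ * γ) (½*+½* (½ * γ))) (½*+½* γ)) ⟩
      seq s i + γ                       ≤⟨ far i (ℕ.m⊔n≤o⇒m≤o N k N≤i) ⟩
      λ₀                                ≤⟨ ℚ.<⇒≤ lt ⟩
      ⌜ suc j ! ⌝ * (⌜ poly (indicator H) w ⌝ * κ l ^ℚ suc j) + ½ * γ
        ≡⟨ cong (λ z → ⌜ suc j ! ⌝ * z + ½ * γ) (polyℚ-scale (suc j) (indicator H) w (κ l) (indicator-≤χ H)) ⟨
      ⌜ suc j ! ⌝ * polyℚ (indicator H) (λ v → ⌜ w v ⌝ * κ l) + ½ * γ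
        ≤⟨ ℚ.+-monoˡ-≤ (½ * γ) (approx-grid i l w sum≡) ⟩
      value i + ⌜ slope ⌝ * κ i + ½ * γ
        ≤⟨ ℚ.+-monoˡ-≤ (½ * γ) (ℚ.+-monoʳ-≤ (value i) (small i (ℕ.m⊔n≤o⇒n≤o N k N≤i))) ⟩
      value i + q + ½ * γ               ≡⟨ ℚ.+-assoc (value i) q (½ * γ) ⟩
      value i + (q + ½ * γ)             ∎))
    where
    open ℚ.≤-Reasoning
    instance
      order≢0 : ℕ.NonZero (order H)
      order≢0 = sum-nonZero w (subst (1 ℕ.≤_) (sym sum≡) (s≤s z≤n))
    open LagrangianExists H using (lagrangian; isLagrangian; value; slope; approx-grid)
    q : ℚ
    q = ½ * (½ * γ)
    k : ℕ
    k = proj₁ (archimedean slope q (0<½* (0<½* 0<γ)))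
    small = proj₂ (archimedean slope q (0<½* (0<½* 0<γ)))
    rearr : ∀ s q h → s + q + (q + h) ≡ s + (q + q + h)
    rearr = solve-∀ ℚ-ring

  clear-denominators : ∀ J₁ M a N ρ p l r λ₀ → N ≡ suc l → λ₀ * ⌜ M ⌝ ≡ ⌜ a ⌝ →
    ⌜ ρ ⌝ * (⌜ p ⌝ * κ l ^ℚ r) + κ J₁ ≤ λ₀ →
    suc J₁ ℕ.* ρ ℕ.* (M ℕ.* p) ℕ.+ M ℕ.* N ℕ.^ r ℕ.≤ suc J₁ ℕ.* (a ℕ.* N ℕ.^ r)
  clear-denominators J₁ M a _ ρ p l r λ₀ refl λ₀M≡a le = ⌜⌝-cancel-≤ (begin
    ⌜ suc J₁ ℕ.* ρ ℕ.* (M ℕ.* p) ℕ.+ M ℕ.* suc l ℕ.^ r ⌝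
      ≡⟨ trans (⌜⌝-+ (suc J₁ ℕ.* ρ ℕ.* (M ℕ.* p)) _) (cong₂ _+_
           (trans (⌜⌝-* (suc J₁ ℕ.* ρ) (M ℕ.* p)) (cong₂ _*_ (⌜⌝-* (suc J₁) ρ) (⌜⌝-* M p)))
           (trans (⌜⌝-* M (suc l ℕ.^ r)) (cong (⌜ M ⌝ *_) (⌜⌝-^ (suc l) r)))) ⟩
    j₁ * ⌜ ρ ⌝ * (⌜ M ⌝ * ⌜ p ⌝) + ⌜ M ⌝ * nʳ
      ≡⟨ cong₂ _+_ (trans (sym (ℚ.*-identityʳ (j₁ * ⌜ ρ ⌝ * (⌜ M ⌝ * ⌜ p ⌝)))) (cong (j₁ * ⌜ ρ ⌝ * (⌜ M ⌝ * ⌜ p ⌝) *_) (sym (⌜⌝^*κ^ l r))))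
           (trans (sym (ℚ.*-identityʳ (⌜ M ⌝ * nʳ))) (cong (⌜ M ⌝ * nʳ *_) (sym (⌜⌝*κ J₁)))) ⟩
    j₁ * ⌜ ρ ⌝ * (⌜ M ⌝ * ⌜ p ⌝) * (nʳ * κ l ^ℚ r) + ⌜ M ⌝ * nʳ * (j₁ * κ J₁)
      ≡⟨ rearr j₁ ⌜ ρ ⌝ ⌜ M ⌝ ⌜ p ⌝ nʳ (κ l ^ℚ r) (κ J₁) ⟩
    j₁ * ⌜ M ⌝ * nʳ * (⌜ ρ ⌝ * (⌜ p ⌝ * κ l ^ℚ r) + κ J₁)
      ≤⟨ ℚ.*-monoˡ-≤-nonNeg (j₁ * ⌜ M ⌝ * nʳ) {{ℚ.nonNegative (0≤* (0≤* (0≤⌜⌝ (suc J₁)) (0≤⌜⌝ M)) (0≤^ r (0≤⌜⌝ (suc l))))}} le ⟩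
    j₁ * ⌜ M ⌝ * nʳ * λ₀
      ≡⟨ rearr₂ j₁ ⌜ M ⌝ nʳ λ₀ ⟩
    j₁ * (λ₀ * ⌜ M ⌝ * nʳ)
      ≡⟨ cong₂ (λ x y → j₁ * (x * y)) λ₀M≡a (sym (⌜⌝-^ (suc l) r)) ⟩
    j₁ * (⌜ a ⌝ * ⌜ suc l ℕ.^ r ⌝)
      ≡⟨ trans (⌜⌝-* (suc J₁) (a ℕ.* suc l ℕ.^ r)) (cong (j₁ *_) (⌜⌝-* a (suc l ℕ.^ r))) ⟨
    ⌜ suc J₁ ℕ.* (a ℕ.* suc l ℕ.^ r) ⌝ ∎)
    where
    open ℚ.≤-Reasoning
    j₁ nʳ : ℚ
    j₁ = ⌜ suc J₁ ⌝
    nʳ = ⌜ suc l ⌝ ^ℚ r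
    rearr : ∀ j ρ M p n k κ → j * ρ * (M * p) * (n * k) + M * n * (j * κ) ≡ j * M * n * (ρ * (p * k) + κ)
    rearr = solve-∀ ℚ-ring
    rearr₂ : ∀ j M n l → j * M * n * l ≡ j * (l * M * n)
    rearr₂ = solve-∀ ℚ-ring

  density-in-ℕ : ∀ d M a Cₙ e λ₀ → λ₀ * ⌜ M ⌝ ≡ ⌜ a ⌝ → (λ₀ - κ d) * ⌜ Cₙ ⌝ ≤ ⌜ e ⌝ →
    suc d ℕ.* (a ℕ.* Cₙ) ℕ.≤ suc d ℕ.* (M ℕ.* e) ℕ.+ M ℕ.* Cₙ
  density-in-ℕ d M a Cₙ e λ₀ λ₀M≡a le = ⌜⌝-cancel-≤ (begin
    ⌜ suc d ℕ.* (a ℕ.* Cₙ) ⌝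
      ≡⟨ trans (⌜⌝-* (suc d) (a ℕ.* Cₙ)) (cong (⌜ suc d ⌝ *_) (trans (⌜⌝-* a Cₙ) (cong (_* ⌜ Cₙ ⌝) (sym λ₀M≡a)))) ⟩
    D * (λ₀ * ⌜ M ⌝ * ⌜ Cₙ ⌝)
      ≡⟨ rearr D λ₀ ⌜ M ⌝ ⌜ Cₙ ⌝ (κ d) ⟩
    D * (⌜ M ⌝ * ((λ₀ - κ d) * ⌜ Cₙ ⌝)) + D * κ d * (⌜ M ⌝ * ⌜ Cₙ ⌝)
      ≤⟨ ℚ.+-monoˡ-≤ _ (ℚ.*-monoˡ-≤-nonNeg D {{ℚ.nonNegative (0≤⌜⌝ (suc d))}}
           (ℚ.*-monoˡ-≤-nonNeg ⌜ M ⌝ {{ℚ.nonNegative (0≤⌜⌝ M)}} le)) ⟩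
    D * (⌜ M ⌝ * ⌜ e ⌝) + D * κ d * (⌜ M ⌝ * ⌜ Cₙ ⌝)
      ≡⟨ cong₂ _+_ (trans (⌜⌝-* (suc d) (M ℕ.* e)) (cong (D *_) (⌜⌝-* M e)))
           (trans (⌜⌝-* M Cₙ) (sym (trans (cong (_* (⌜ M ⌝ * ⌜ Cₙ ⌝)) (⌜⌝*κ d)) (ℚ.*-identityˡ _)))) ⟨
    ⌜ suc d ℕ.* (M ℕ.* e) ⌝ + ⌜ M ℕ.* Cₙ ⌝
      ≡⟨ ⌜⌝-+ (suc d ℕ.* (M ℕ.* e)) (M ℕ.* Cₙ) ⟨
    ⌜ suc d ℕ.* (M ℕ.* e) ℕ.+ M ℕ.* Cₙ ⌝ ∎)
    where
    open ℚ.≤-Reasoning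
    D : ℚ
    D = ⌜ suc d ⌝
    rearr : ∀ D l M b κ → D * (l * M * b) ≡ D * (M * ((l - κ) * b)) + D * κ * (M * b)
    rearr = solve-∀ ℚ-ring

  -- Passes from C(n,r) to n^r. Of the M + 1 parts of the allowed error, M absorb the density defect
  -- M C(n,r) and one absorbs n^r - [n]_r, which is small because n is large.
  arith-dense : ∀ D M c r! Cₙ e n nʲ r² → r! ℕ.* Cₙ ℕ.≤ n ℕ.* nʲ → Cₙ ℕ.≤ r! ℕ.* Cₙ → n ℕ.* nʲ ℕ.≤ r! ℕ.* Cₙ ℕ.+ r² ℕ.* nʲ →
    suc M ℕ.* D ℕ.* c ℕ.* r² ℕ.≤ n →
    suc M ℕ.* D ℕ.* (r! ℕ.* c ℕ.* Cₙ) ℕ.≤ suc M ℕ.* D ℕ.* (M ℕ.* e) ℕ.+ M ℕ.* Cₙ →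
    D ℕ.* (c ℕ.* (n ℕ.* nʲ)) ℕ.≤ D ℕ.* (M ℕ.* e) ℕ.+ n ℕ.* nʲ
  arith-dense D M c r! Cₙ e n nʲ r² P≤ C≤ ≤P large le = ℕ.*-cancelˡ-≤ (suc M) (begin
    suc M ℕ.* (D ℕ.* (c ℕ.* (n ℕ.* nʲ)))
      ≤⟨ ℕ.*-monoʳ-≤ (suc M) (ℕ.*-monoʳ-≤ D (ℕ.*-monoʳ-≤ c ≤P)) ⟩
    suc M ℕ.* (D ℕ.* (c ℕ.* (r! ℕ.* Cₙ ℕ.+ r² ℕ.* nʲ)))
      ≡⟨ rearr (suc M) D c r! Cₙ r² nʲ ⟩
    suc M ℕ.* D ℕ.* (r! ℕ.* c ℕ.* Cₙ) ℕ.+ suc M ℕ.* D ℕ.* c ℕ.* r² ℕ.* nʲ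
      ≤⟨ ℕ.+-mono-≤ le (ℕ.*-monoˡ-≤ nʲ large) ⟩
    suc M ℕ.* D ℕ.* (M ℕ.* e) ℕ.+ M ℕ.* Cₙ ℕ.+ n ℕ.* nʲ
      ≤⟨ ℕ.+-monoˡ-≤ (n ℕ.* nʲ) (ℕ.+-monoʳ-≤ (suc M ℕ.* D ℕ.* (M ℕ.* e)) (ℕ.*-monoʳ-≤ M (ℕ.≤-trans C≤ P≤))) ⟩
    suc M ℕ.* D ℕ.* (M ℕ.* e) ℕ.+ M ℕ.* (n ℕ.* nʲ) ℕ.+ n ℕ.* nʲ
      ≡⟨ rearr₂ M D e (n ℕ.* nʲ) ⟩
    suc M ℕ.* (D ℕ.* (M ℕ.* e) ℕ.+ n ℕ.* nʲ) ∎)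
    where
    open ℕ.≤-Reasoning
    rearr : ∀ M D c r C q n → M ℕ.* (D ℕ.* (c ℕ.* (r ℕ.* C ℕ.+ q ℕ.* n))) ≡ M ℕ.* D ℕ.* (r ℕ.* c ℕ.* C) ℕ.+ M ℕ.* D ℕ.* c ℕ.* q ℕ.* n
    rearr = ℕ-Solver.solve-∀
    rearr₂ : ∀ M D e N → suc M ℕ.* D ℕ.* (M ℕ.* e) ℕ.+ M ℕ.* N ℕ.+ N ≡ suc M ℕ.* (D ℕ.* (M ℕ.* e) ℕ.+ N)
    rearr₂ = ℕ-Solver.solve-∀

  small-≤ᴿ : ∀ ε e i N a n → N ℕ.* a ℕ.≤ n → N ≡ suc i → κ i ≤ e → ∀ N₁ → (∀ l → N₁ ℕ.≤ l → e ≤ seq ε l) →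
             fromℕ a ≤ᴿ ε *ᴿ fromℕ n
  small-≤ᴿ ε e i _ a n Na≤n refl κ≤e N₁ e≤ε (d , 0<d , N₂ , far) = ℚ.<-irrefl refl (begin-strict
    ⌜ a ⌝                        ≡⟨ trans (cong (_* ⌜ a ⌝) (⌜⌝*κ i)) (ℚ.*-identityˡ ⌜ a ⌝) ⟨
    ⌜ suc i ⌝ * κ i * ⌜ a ⌝      ≡⟨ rearr ⌜ suc i ⌝ (κ i) ⌜ a ⌝ ⟩
    κ i * (⌜ suc i ⌝ * ⌜ a ⌝)    ≡⟨ cong (κ i *_) (⌜⌝-* (suc i) a) ⟨
    κ i * ⌜ suc i ℕ.* a ⌝        ≤⟨ mul-mono (ℚ.≤-trans (0≤κ i) κ≤) (0≤⌜⌝ (suc i ℕ.* a)) κ≤ (⌜⌝-mono Na≤n) ⟩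
    seq ε l * ⌜ n ⌝              ≡⟨ ℚ.+-identityʳ _ ⟨
    seq ε l * ⌜ n ⌝ + 0ℚ         <⟨ ℚ.+-monoʳ-< (seq ε l * ⌜ n ⌝) 0<d ⟩
    seq ε l * ⌜ n ⌝ + d          ≤⟨ far l (ℕ.m≤n⊔m N₁ N₂) ⟩
    ⌜ a ⌝                        ∎)
    where
    open ℚ.≤-Reasoning
    l : ℕ
    l = N₁ ⊔ N₂
    κ≤ : κ i ≤ seq ε l
    κ≤ = ℚ.≤-trans κ≤e (e≤ε l (ℕ.m≤m⊔n N₁ N₂))
    rearr : ∀ a b c → a * b * c ≡ b * (a * c)
    rearr = solve-∀ ℚ-ring

  -- Strictly above a nonnegative density, [m]_r cannot vanish; this is where r ≤ m comes from.
  positive-density : ∀ s λ₀ M a → 0ᴿ ≤ᴿ s → s <ᴿ fromℚ λ₀ → λ₀ * ⌜ M ⌝ ≡ ⌜ a ⌝ → 1 ℕ.≤ M → a ≢ 0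
  positive-density s λ₀ M _ 0≤s (γ , 0<γ , N , far) λ₀M 1≤M refl = ℚ.<-irrefl refl (begin-strict
    0ℚ                 <⟨ 0<½* 0<γ ⟩
    ½ * γ              ≤⟨ half≤ ⟩
    λ₀                 ≡⟨ ℚ.*-identityʳ λ₀ ⟨
    λ₀ * ⌜ 1 ⌝         ≤⟨ ℚ.*-monoˡ-≤-nonNeg λ₀ {{ℚ.nonNegative (ℚ.≤-trans (ℚ.<⇒≤ (0<½* 0<γ)) half≤)}} (⌜⌝-mono 1≤M) ⟩
    λ₀ * ⌜ M ⌝         ≡⟨ λ₀M ⟩
    0ℚ                 ∎)
    where
    open ℚ.≤-Reasoning
    ev = ≤ᴿ⇒eventually-≤ {0ᴿ} {s} 0≤s (½ * γ) (0<½* 0<γ)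
    i : ℕ
    i = N ⊔ proj₁ ev
    half≤ : ½ * γ ≤ λ₀
    half≤ = begin
      ½ * γ                        ≡⟨ ℚ.+-identityˡ (½ * γ) ⟨
      0ℚ + ½ * γ                   ≤⟨ ℚ.+-monoˡ-≤ (½ * γ) (proj₂ ev i (ℕ.m≤n⊔m N (proj₁ ev))) ⟩
      seq s i + ½ * γ + ½ * γ      ≡⟨ trans (ℚ.+-assoc (seq s i) _ _) (cong (λ z → seq s i + z) (½*+½* γ)) ⟩
      seq s i + γ                  ≤⟨ far i (ℕ.m≤m⊔n N (proj₁ ev)) ⟩
      λ₀                           ∎

  module Main (μ ρ : ℕ) (F : RGraph (2 ℕ.+ ρ))
      (hyp : order F ℕ.≤ 2 ℕ.+ μ ⊎ (order F ≡ 3 ℕ.+ μ × ∃[ v ] (degree F v ≡ 1)))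
      (s : ℝ) (density : IsLagrangianDensity F s)
      (γ : ℚ) (0<γ : 0ℚ < γ) (Nₛ : ℕ)
      (far : ∀ i → Nₛ ℕ.≤ i → seq s i + γ ≤ seq (turánDensity (2 ℕ.+ μ) (2 ℕ.+ ρ)) i) where

    λ₀ : ℚ
    λ₀ = seq (turánDensity (2 ℕ.+ μ) (2 ℕ.+ ρ)) 0

    λ₀M : λ₀ * ⌜ (2 ℕ.+ μ) ℕ.^ (2 ℕ.+ ρ) ⌝ ≡ ⌜ (2 ℕ.+ μ) P (2 ℕ.+ ρ) ⌝
    λ₀M = /-*⌜⌝ ((2 ℕ.+ μ) P (2 ℕ.+ ρ)) ((2 ℕ.+ μ) ℕ.^ (2 ℕ.+ ρ)) {{ℕ.m^n≢0 (2 ℕ.+ μ) (2 ℕ.+ ρ)}}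

    ρ≤μ : ρ ℕ.≤ μ
    ρ≤μ = ℕ.≮⇒≥ λ μ<ρ → positive-density s λ₀ ((2 ℕ.+ μ) ℕ.^ (2 ℕ.+ ρ)) ((2 ℕ.+ μ) P (2 ℕ.+ ρ)) (proj₁ density)
      (γ , 0<γ , Nₛ , far) λ₀M (ℕ.m^n>0 (2 ℕ.+ μ) (2 ℕ.+ ρ)) (k>n⇒nPk≡0 (s≤s (s≤s μ<ρ)))

    -- `F-free-value` leaves the gap γ/2, so 1/J₁ is taken below that; the stored number is J₁ - 1.
    J₁-1 : ℕ
    J₁-1 = proj₁ (archimedean 1 (½ * γ) (0<½* 0<γ))

    κJ₁≤ : κ J₁-1 ≤ ½ * γ
    κJ₁≤ = ℚ.≤-trans (ℚ.≤-reflexive (sym (ℚ.*-identityˡ (κ J₁-1)))) (proj₂ (archimedean 1 (½ * γ) (0<½* 0<γ)) J₁-1 ℕ.≤-refl)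

    sparse : ∀ N → 1 ℕ.≤ N → ∀ H → ¬ (F ⊑ H) → (w : Fin (order H) → ℕ) → sum w ≡ N →
      let m = 2 ℕ.+ μ; r = 2 ℕ.+ ρ in
      suc J₁-1 ℕ.* r ! ℕ.* (m ℕ.^ r ℕ.* poly (indicator H) w) ℕ.+ m ℕ.^ r ℕ.* N ℕ.^ r
        ℕ.≤ suc J₁-1 ℕ.* r ! ℕ.* ((m C r) ℕ.* N ℕ.^ r)
    sparse (suc l) 1≤N H free w sum≡ = ℕ.≤-trans
      (clear-denominators J₁-1 (m ℕ.^ r) (m P r) (suc l) (r !) (poly (indicator H) w) l r λ₀ refl λ₀M
        (ℚ.≤-trans (ℚ.+-monoʳ-≤ (⌜ r ! ⌝ * (⌜ poly (indicator H) w ⌝ * κ l ^ℚ r)) κJ₁≤)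
          (F-free-value F s (proj₁ (proj₂ density)) λ₀ γ 0<γ Nₛ far H free l w sum≡)))
      (ℕ.≤-reflexive (trans (cong (λ x → suc J₁-1 ℕ.* (x ℕ.* suc l ℕ.^ r)) (sym (k!*C≡P m r)))
        (rearr (suc J₁-1) (r !) (m C r) (suc l ℕ.^ r))))
      where
      m = 2 ℕ.+ μ
      r = 2 ℕ.+ ρ
      rearr : ∀ j a b c → j ℕ.* (a ℕ.* b ℕ.* c) ≡ j ℕ.* a ℕ.* (b ℕ.* c)
      rearr = ℕ-Solver.solve-∀

    module _ (ε : ℝ) (e : ℚ) (0<e : 0ℚ < e) (Nₑ : ℕ) (e≤ε : ∀ i → Nₑ ℕ.≤ i → 0ℚ + e ≤ seq ε i) where
      N₀-1 : ℕ
      N₀-1 = proj₁ (archimedean 1 e 0<e)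

      open Constants μ ρ (suc N₀-1) (suc J₁-1)

      κN₀≤ : κ N₀-1 ≤ e
      κN₀≤ = ℚ.≤-trans (ℚ.≤-reflexive (sym (ℚ.*-identityˡ (κ N₀-1)))) (proj₂ (archimedean 1 e 0<e) N₀-1 ℕ.≤-refl)

      D₁ : ℕ
      D₁ = suc M ℕ.* D

      D₁≢0 : ℕ.NonZero D₁
      D₁≢0 = ℕ.m*n≢0 (suc M) D {{_}} {{ℕ.m*n≢0 (r ℕ.+ K) R {{_}} {{ℕ.m*n≢0 (2 ℕ.^ j) (2 ℕ.* suc N₀-1) {{ℕ.m^n≢0 2 j}}}}}}

      δ₁ : ℝ
      δ₁ = fromℚ (κ (ℕ.pred D₁))

      0<δ₁ : 0ᴿ <ᴿ δ₁
      0<δ₁ = κ (ℕ.pred D₁) , ℚ.positive⁻¹ (κ (ℕ.pred D₁)) , 0 , λ i _ → ℚ.≤-reflexive (ℚ.+-identityˡ _)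

      -- The first summand makes room for T; the second is the threshold of `arith-dense` for
      -- replacing [n]_r by n^r.
      n₁ : ℕ
      n₁ = m ℕ.+ D₁ ℕ.* c ℕ.* (r ℕ.* r)

      conclusion : ∀ (G : RGraph r) → n₁ ℕ.≤ order G → 𝒦 F (suc m) -Free G →
        (turánDensity m r -ᴿ δ₁) *ᴿ fromℕ (order G C r) <ᴿ fromℕ (size G) →
        ∃[ S ] (fromℕ (card S) ≤ᴿ ε *ᴿ fromℕ (order G) × Partite m (G [ ∁ S ]))
      conclusion G n₁≤n free (d , 0<d , N , dense) =
        let S , small , partite = Core.stable μ ρ (suc N₀-1) (suc J₁-1) ρ≤μ free hyp m≤n dense-ℕ (sparse n (ℕ.≤-trans (s≤s z≤n) m≤n))
        in S , small-≤ᴿ ε e N₀-1 (suc N₀-1) (card S) n small refl κN₀≤ Nₑ (λ l N≤l → ℚ.≤-trans (ℚ.≤-reflexive (sym (ℚ.+-identityˡ e))) (e≤ε l N≤l))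
             , partite
        where
        n : ℕ
        n = order G
        m≤n : m ℕ.≤ n
        m≤n = ℕ.m+n≤o⇒m≤o m n₁≤n
        r≤n : r ℕ.≤ n
        r≤n = ℕ.≤-trans (s≤s (s≤s ρ≤μ)) m≤n
        rC≡P′ : r ! ℕ.* (n C r) ≡ n P′ r
        rC≡P′ = trans (k!*C≡P n r) (P≡P′ r≤n)
        dense₀ : (λ₀ - κ (ℕ.pred D₁)) * ⌜ n C r ⌝ ≤ ⌜ poly (indicator G) (const 1) ⌝
        dense₀ = begin
          (λ₀ - κ (ℕ.pred D₁)) * ⌜ n C r ⌝          ≡⟨ ℚ.+-identityʳ ((λ₀ - κ (ℕ.pred D₁)) * ⌜ n C r ⌝) ⟨
          (λ₀ - κ (ℕ.pred D₁)) * ⌜ n C r ⌝ + 0ℚ     ≤⟨ ℚ.+-monoʳ-≤ ((λ₀ - κ (ℕ.pred D₁)) * ⌜ n C r ⌝) (ℚ.<⇒≤ 0<d) ⟩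
          (λ₀ - κ (ℕ.pred D₁)) * ⌜ n C r ⌝ + d      ≤⟨ dense N ℕ.≤-refl ⟩
          ⌜ size G ⌝                                ≡⟨ cong ⌜_⌝ (size≡poly G) ⟩
          ⌜ poly (indicator G) (const 1) ⌝          ∎
          where open ℚ.≤-Reasoning
        dense₁ : D₁ ℕ.* (r ! ℕ.* c ℕ.* (n C r)) ℕ.≤ D₁ ℕ.* (M ℕ.* poly (indicator G) (const 1)) ℕ.+ M ℕ.* (n C r)
        dense₁ = subst₂ (λ D a → D ℕ.* (a ℕ.* (n C r)) ℕ.≤ D ℕ.* (M ℕ.* poly (indicator G) (const 1)) ℕ.+ M ℕ.* (n C r))
          (ℕ.suc-pred D₁ {{D₁≢0}}) (sym (k!*C≡P m r))
          (density-in-ℕ (ℕ.pred D₁) M (m P r) (n C r) (poly (indicator G) (const 1)) λ₀ λ₀M dense₀)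
        dense-ℕ : D ℕ.* (c ℕ.* n ℕ.^ r) ℕ.≤ D ℕ.* (M ℕ.* poly (indicator G) (const 1)) ℕ.+ n ℕ.^ r
        dense-ℕ = arith-dense D M c (r !) (n C r) (poly (indicator G) (const 1)) n (n ℕ.^ j) (r ℕ.* r)
          (ℕ.≤-trans (ℕ.≤-reflexive rC≡P′) (P′≤^ n r))
          (ℕ.m≤n*m (n C r) (r !) {{r ℕ.!≢0}})
          (ℕ.≤-trans (^≤P′ n j) (ℕ.≤-reflexive (cong (ℕ._+ r ℕ.* r ℕ.* n ℕ.^ j) (sym rC≡P′))))
          (ℕ.m+n≤o⇒n≤o m n₁≤n)
          dense₁

      result : ∃[ δ₁ ] (0ᴿ <ᴿ δ₁ × ∃[ n₁ ] (∀ (G : RGraph r) → n₁ ℕ.≤ order G → 𝒦 F (suc m) -Free G →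
        (turánDensity m r -ᴿ δ₁) *ᴿ fromℕ (order G C r) <ᴿ fromℕ (size G) →
        ∃[ S ] (fromℕ (card S) ≤ᴿ ε *ᴿ fromℕ (order G) × Partite m (G [ ∁ S ]))))
      result = δ₁ , 0<δ₁ , n₁ , conclusion

open import Data.Nat.Base using (ℕ; suc; _≤_; NonTrivial)
open import Data.Product.Base using (_×_; ∃-syntax; _,_)
open import Data.Sum.Base using (_⊎_)
open import Relation.Binary.PropositionalEquality using (_≡_)

theorem6p2 : (m r : ℕ) .{{_ : NonTrivial m}} .{{_ : NonTrivial r}} →
    (F : RGraph r) →
    (order F ≤ m ⊎ (order F ≡ suc m × ∃[ v ] (degree F v ≡ 1))) →
    (s : ℝ) → IsLagrangianDensity F s → s <ᴿ turánDensity m r →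
    Stable m r F
theorem6p2 (suc (suc μ)) (suc (suc ρ)) F hyp s density (γ , 0<γ , N , far) ε (e , 0<e , Nₑ , e≤ε) =
  Conclusion.Main.result μ ρ F hyp s density γ 0<γ N far ε e 0<e Nₑ e≤ε
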